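{- Let $G$ be a fractionally-critical triangle-free finite simple graph with maximum degree at most $3$ and $\frac{11}{4}<\chi_f(G)<3$. If $V(G)$ can be partitioned into $k$ admissible sets, then $\chi_f(G)\le 3-\frac{3}{k+1}$.
   Context: $\chi_f$ denotes the fractional chromatic number. $G$ is fractionally-critical if $\chi_f(H)<\chi_f(G)$ for every proper subgraph $H$ of $G$. For a vertex $u$ and positive integer $i$, $N_G^i(u)=\{v\in V(G): v\ne u \text{ and there is a path of length } i \text{ in } G \text{ connecting } u \text{ and } v\}$. A set $X\subseteq V(G)$ is admissible if it can be partitioned into three sets $X_1,X_2,X_3$ such that: (1) if $\{u,v\}\subseteq X_i$ for some $i$, then $v\notin N_G^1(u)\cup N_G^3(u)\cup N_G^5(u)$; (2) if $u\in X_i$ and $v\in X_j$ with $i\ne j$, then $v\notin N_G^1(u)\cup N_G^2(u)\cup N_G^4(u)$. -}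

module Defs where

open import Data.Nat using (ℕ; zero; suc; _≤_)
open import Data.Integer using (+_)
open import Data.Rational using (ℚ; _/_; _<_) renaming (_≤_ to _≤ℚ_)
open import Data.Bool using (Bool; true; false)
open import Data.Fin using (Fin; inject₁; fromℕ)
import Data.Fin as Fin
open import Data.Fin.Subset using (Subset; _∩_; Empty; ∣_∣)
open import Data.Vec using (Vec; lookup; tabulate)
open import Data.Product using (Σ; ∃; _×_)
open import Relation.Nullary using (¬_)
open import Relation.Binary.PropositionalEquality using (_≡_; _≢_)

record Graph : Set where
  field
    n      : ℕ
    adj    : Fin n → Fin n → Bool
    sym    : ∀ u v → adj u v ≡ adj v u
    irrefl : ∀ v → adj v v ≡ false
open Graph public

Edge : (G : Graph) → Fin (n G) → Fin (n G) → Set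
Edge G u v = adj G u v ≡ true

degree : (G : Graph) → Fin (n G) → ℕ
degree G v = ∣ tabulate (adj G v) ∣

MaxDegreeAtMost : ℕ → Graph → Set
MaxDegreeAtMost d G = ∀ v → degree G v ≤ d

TriangleFree : Graph → Set
TriangleFree G = ∀ u v w → ¬ (Edge G u v × Edge G v w × Edge G u w)

Coloring : (G : Graph) → ℕ → ℕ → Set
Coloring G a b = Σ (Fin (n G) → Subset a) λ c →
  (∀ v → ∣ c v ∣ ≡ b) × (∀ u v → Edge G u v → Empty (c u ∩ c v))

IsFracChrom : Graph → ℚ → Set
IsFracChrom G q =
  (Σ ℕ λ a → Σ ℕ λ b → Coloring G a (suc b) × (q ≡ (+ a) / suc b))
  × (∀ a b → Coloring G a (suc b) → q ≤ℚ (+ a) / suc b)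

IsProperSubgraph : (H G : Graph) → (Fin (n H) → Fin (n G)) → Set
IsProperSubgraph H G f =
  (∀ x y → f x ≡ f y → x ≡ y)
  × (∀ x y → Edge H x y → Edge G (f x) (f y))
  × ¬ ((∀ v → ∃ λ x → f x ≡ v) × (∀ x y → Edge G (f x) (f y) → Edge H x y))

FractionallyCritical : Graph → Set
FractionallyCritical G =
  ∀ (H : Graph) (f : Fin (n H) → Fin (n G)) → IsProperSubgraph H G f →
  ∀ qH qG → IsFracChrom H qH → IsFracChrom G qG → qH < qG

Path : (G : Graph) → ℕ → Fin (n G) → Fin (n G) → Set
Path G i u v = Σ (Vec (Fin (n G)) (suc i)) λ p →
  (lookup p Fin.zero ≡ u) × (lookup p (fromℕ i) ≡ v)
  × (∀ (j : Fin i) → Edge G (lookup p (inject₁ j)) (lookup p (Fin.suc j)))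
  × (∀ j k → lookup p j ≡ lookup p k → j ≡ k)

InN : (G : Graph) → ℕ → Fin (n G) → Fin (n G) → Set
InN G i u v = (v ≢ u) × Path G i u v

Admissible : (G : Graph) → (Fin (n G) → Set) → Set
Admissible G X = Σ (Fin (n G) → Fin 3) λ part →
  ∀ u v → X u → X v →
    (part u ≡ part v → ¬ InN G 1 u v × ¬ InN G 3 u v × ¬ InN G 5 u v)
    × (part u ≢ part v → ¬ InN G 1 u v × ¬ InN G 2 u v × ¬ InN G 4 u v)

{-# OPTIONS --safe #-}
-- An admissible set X with parts X₁, X₂, X₃ yields a 3-colouring of G − X in which all neighbours of Xᵢ have colour i, so that the
-- vertices of Xᵢ may carry the two other colours; the k colourings together use 3k colours and give every vertex at least k + 1.
-- To find it, precolour N(Xᵢ) with i.  The remaining vertices have lists at least as long as their degrees in the remaining graph.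
-- In a minimal uncolourable set, colouring greedily around a cycle shows that every cycle is odd and that its vertices all miss the
-- same colour; so there is no theta graph, and a lollipop with longest stick ends in an odd cycle of which at most one vertex has
-- a neighbour in the rest of the set.  By the path conditions the other vertices of this cycle are all joined to the neighbourhood
-- of a single vertex of X, so the cycle has length 5 or 7 (a triangle is excluded) and there are few possible patterns.
-- Each of them is reducible: by criticality the graph without the edges at the pattern has a fractional colouring of ratio less than
-- χ_f(G), and a colouring of ratio at least 11/4 extends.  As extendability depends only on how the colour sets of the at most three
-- outside neighbours intersect, it suffices to extend on the extreme rays of the cone of these intersection data.
module Submission where

open import Defs renaming (sym to adj-sym; irrefl to adj-irrefl)
open import Data.Nat using (ℕ; suc; zero)
open import Data.Fin using (Fin; #_)
open import Relation.Binary.PropositionalEquality using (_≡_)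

open import Data.Bool using (Bool; true; false; not; _∧_; if_then_else_; _∨_)
import Data.Bool.Properties as Boolₚ
open import Data.Empty using (⊥; ⊥-elim)
import Data.Fin as Fin
open import Data.Fin.Patterns using (0F; 1F; 2F; 3F; 4F)
import Data.Fin.Properties as Finₚ
open import Data.Fin.Subset using (Subset; ∣_∣; _∈_)
import Data.Fin.Subset.Properties as Subsetₚ
open import Data.List using (List; []; _∷_; _++_; length; map)
import Data.List as List
import Data.List.Properties as Listₚ
open import Data.List.Relation.Unary.All using (All; []; _∷_)
import Data.List.Relation.Unary.All as All
import Data.List.Relation.Unary.All.Properties as Allₚ
import Data.List.Membership.Propositional.Properties as ∈ₚ
open import Data.List.Membership.Propositional using () renaming (_∈_ to _∈ˡ_; _∉_ to _∉ˡ_)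
open import Data.List.Relation.Unary.AllPairs using (AllPairs; []; _∷_)
open import Data.List.Relation.Unary.Any using (here; there)
open import Data.List.Relation.Unary.Unique.Propositional using (Unique)
import Data.List.Relation.Unary.Unique.Propositional.Properties as Uniqueₚ
open import Data.Maybe using (Maybe; just; nothing; is-just)
import Data.Nat as Nat
open import Data.Nat.Solver using (module +-*-Solver)
import Data.Nat.Properties as ℕₚ
open import Data.Product using (Σ; ∃; _×_; _,_; proj₁; proj₂)
open import Data.Sum using (_⊎_; inj₁; inj₂; [_,_]′)
import Data.Unit
open import Data.Vec using (Vec; []; _∷_)
import Data.Vec as Vec
import Data.Vec.Properties as Vecₚ
import Data.Vec.Relation.Unary.All as VecAll
open VecAll using () renaming ([] to []ᵃ; _∷_ to _∷ᵃ_)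
import Data.Vec.Relation.Unary.All.Properties as VecAllₚ
open import Data.Vec.Relation.Unary.AllPairs using () renaming ([] to []ᵖ; _∷_ to _∷ᵖ_)
import Data.Vec.Relation.Unary.AllPairs.Properties as VecAllPairsₚ
import Data.Vec.Relation.Unary.Unique.Propositional as VecUnique
import Data.Vec.Relation.Unary.Unique.Propositional.Properties as VecUniqueₚ
open import Function using (_∘_; id)
import Data.Integer as ℤ
import Data.Integer.Properties as ℤₚ
import Data.Rational as ℚ
import Data.Rational.Properties as ℚₚ
import Data.Rational.Unnormalised as ℚᵘ
import Data.Rational.Unnormalised.Properties as ℚᵘₚ
open import Relation.Nullary using (¬_; ¬?; yes; no; Dec; Reflects; invert; proof)
open import Relation.Nullary.Decidable using (does; dec-true; dec-false; _×-dec_; decidable-stable; False; toWitnessFalse)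
open import Relation.Binary.PropositionalEquality using (_≢_; refl; sym; trans; cong; cong₂; subst; subst₂; module ≡-Reasoning)

-- Nothing provides the fractional chromatic number of a proper subgraph; criticality only refutes
-- that all its colourings have ratio at least χ_f(G). Existence claims (a light colouring,
-- colourability of smaller sets, three classes) are therefore doubly negated, until the decidable
-- final inequality removes the negations. Fractional colourings are kept as lists of independent
-- sets: repeating a list clears denominators, and exchanging the classes on a few vertices can keep
-- the length. The bound 11/4 provides slack: a colouring below it is padded with empty classes to
-- ratio exactly 11/4, still less than χ_f(G), so that every extension problem offers at least 11b/4
-- colours for sets of size b. A cycle whose vertices have all three colours available escapes the
-- argument about missing colours. It would be a component of G, which is refuted because the edges
-- of a critical graph lie in one component and some edge meets X. A class consisting of isolated
-- vertices has no such edge, hence its separate treatment.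

-- Counting in lists and merging families of sets

module Lists where
  open Nat using (_+_; _*_; _⊔_)

  bit : Bool → ℕ
  bit true  = 1
  bit false = 0

  cnt : ∀ {A : Set} → (A → Bool) → List A → ℕ
  cnt p []       = 0
  cnt p (x ∷ xs) = bit (p x) + cnt p xs

  cnt-++ : ∀ {A : Set} (p : A → Bool) xs ys → cnt p (xs ++ ys) ≡ cnt p xs + cnt p ys
  cnt-++ p []       ys = refl
  cnt-++ p (x ∷ xs) ys = trans (cong (bit (p x) +_) (cnt-++ p xs ys)) (sym (ℕₚ.+-assoc (bit (p x)) _ _))

  rep : ∀ {A : Set} → ℕ → List A → List A
  rep zero    xs = []
  rep (suc k) xs = xs ++ rep k xs

  cnt-rep : ∀ {A : Set} (p : A → Bool) k xs → cnt p (rep k xs) ≡ k * cnt p xs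
  cnt-rep p zero    xs = refl
  cnt-rep p (suc k) xs = trans (cnt-++ p xs (rep k xs)) (cong (cnt p xs +_) (cnt-rep p k xs))

  length-rep : ∀ {A : Set} k (xs : List A) → length (rep k xs) ≡ k * length xs
  length-rep zero    xs = refl
  length-rep (suc k) xs = trans (Listₚ.length-++ xs) (cong (length xs +_) (length-rep k xs))

  All-rep : ∀ {A : Set} {P : A → Set} k {xs} → All P xs → All P (rep k xs)
  All-rep zero    ps = []
  All-rep (suc k) ps = Allₚ.++⁺ ps (All-rep k ps)

  cnt-replicate-false : ∀ {A : Set} (p : A → Bool) k x → p x ≡ false → cnt p (List.replicate k x) ≡ 0
  cnt-replicate-false p zero    x eq = refl
  cnt-replicate-false p (suc k) x eq rewrite eq = cnt-replicate-false p k x eq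

  cnt-tabulate : ∀ {A : Set} {a} (p : A → Bool) (g : Fin a → A) (s : Subset a) →
    (∀ i → p (g i) ≡ Vec.lookup s i) → cnt p (List.tabulate g) ≡ ∣ s ∣
  cnt-tabulate p g []          eq = refl
  cnt-tabulate p g (true ∷ s)  eq rewrite eq Fin.zero = cong suc (cnt-tabulate p (g ∘ Fin.suc) s (eq ∘ Fin.suc))
  cnt-tabulate p g (false ∷ s) eq rewrite eq Fin.zero = cnt-tabulate p (g ∘ Fin.suc) s (eq ∘ Fin.suc)

  cnt-map : ∀ {A B : Set} (p : B → Bool) (f : A → B) xs → cnt p (map f xs) ≡ cnt (p ∘ f) xs
  cnt-map p f []       = refl
  cnt-map p f (x ∷ xs) = cong (bit (p (f x)) +_) (cnt-map p f xs)

  cnt-cong : ∀ {A : Set} {p q : A → Bool} xs → (∀ x → p x ≡ q x) → cnt p xs ≡ cnt q xs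
  cnt-cong []       eq = refl
  cnt-cong (x ∷ xs) eq = cong₂ _+_ (cong bit (eq x)) (cnt-cong xs eq)

  -- In merge the shorter family is padded with empty sets.
  module _ {V : Set} (S : V → Bool) where
    glue : (V → Bool) → (V → Bool) → V → Bool
    glue I J v = if S v then J v else I v

    merge : List (V → Bool) → List (V → Bool) → List (V → Bool)
    merge []       ys       = map (glue (λ _ → false)) ys
    merge (x ∷ xs) []       = map (λ I → glue I (λ _ → false)) (x ∷ xs)
    merge (x ∷ xs) (y ∷ ys) = glue x y ∷ merge xs ys

    length-merge : ∀ xs ys → length (merge xs ys) ≡ length xs ⊔ length ys
    length-merge []       ys       = Listₚ.length-map _ ys
    length-merge (x ∷ xs) []       = Listₚ.length-map _ (x ∷ xs)
    length-merge (x ∷ xs) (y ∷ ys) = cong suc (length-merge xs ys)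

    cnt-map-false : ∀ (g : (V → Bool) → V → Bool) v → (∀ I → g I v ≡ false) → ∀ xs → cnt (λ I → I v) (map g xs) ≡ 0
    cnt-map-false g v eq []       = refl
    cnt-map-false g v eq (x ∷ xs) rewrite eq x = cnt-map-false g v eq xs

    cnt-merge-in : ∀ v → S v ≡ true → ∀ xs ys → cnt (λ I → I v) (merge xs ys) ≡ cnt (λ I → I v) ys
    cnt-merge-in v s []       ys = trans (cnt-map _ _ ys) (cnt-cong ys λ J → cong (λ b → if b then J v else false) s)
    cnt-merge-in v s (x ∷ xs) [] = cnt-map-false (λ I → glue I (λ _ → false)) v (λ I → cong (λ b → if b then false else I v) s) (x ∷ xs)
    cnt-merge-in v s (x ∷ xs) (y ∷ ys) = cong₂ _+_ (cong (λ b → bit (if b then y v else x v)) s) (cnt-merge-in v s xs ys)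

    cnt-merge-out : ∀ v → S v ≡ false → ∀ xs ys → cnt (λ I → I v) (merge xs ys) ≡ cnt (λ I → I v) xs
    cnt-merge-out v s []       ys = cnt-map-false (glue (λ _ → false)) v (λ J → cong (λ b → if b then J v else false) s) ys
    cnt-merge-out v s (x ∷ xs) [] = trans (cnt-map _ _ (x ∷ xs)) (cnt-cong (x ∷ xs) λ I → cong (λ b → if b then false else I v) s)
    cnt-merge-out v s (x ∷ xs) (y ∷ ys) = cong₂ _+_ (cong (λ b → bit (if b then y v else x v)) s) (cnt-merge-out v s xs ys)

    All-merge : ∀ {P Q R : (V → Bool) → Set} → P (λ _ → false) → Q (λ _ → false) →
      (∀ {I J} → P I → Q J → R (glue I J)) → ∀ {xs ys} → All P xs → All Q ys → All R (merge xs ys)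
    All-merge p₀ q₀ r []       qs       = Allₚ.map⁺ (All.map (r p₀) qs)
    All-merge p₀ q₀ r (p ∷ ps) []       = Allₚ.map⁺ (All.map (λ p′ → r p′ q₀) (p ∷ ps))
    All-merge p₀ q₀ r (p ∷ ps) (q ∷ qs) = r p q ∷ All-merge p₀ q₀ r ps qs

open Lists

-- Fractional colourings as lists of independent sets

module Fractional (G : Graph) where
  open Nat using (_≤_; z≤n)

  VSet : Set
  VSet = Fin (n G) → Bool

  Independent : VSet → Set
  Independent I = ∀ u v → I u ≡ true → I v ≡ true → ¬ Edge G u v

  multiplicity : Fin (n G) → List VSet → ℕ
  multiplicity v = cnt (λ I → I v)

  -- A `Coloring` demands exactly `b` colours at each vertex, whereas covers are only bounded below;
  -- the surplus is cut off by keeping the first `b` classes that contain `v`.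
  pick : ℕ → (xs : List VSet) → Fin (n G) → Subset (length xs)
  pick b       []       v = []
  pick zero    (I ∷ xs) v = false ∷ pick zero xs v
  pick (suc b) (I ∷ xs) v = if I v then true ∷ pick b xs v else false ∷ pick (suc b) xs v

  ∣pick∣ : ∀ b xs v → b ≤ multiplicity v xs → ∣ pick b xs v ∣ ≡ b
  ∣pick∣ zero    []       v le = refl
  ∣pick∣ zero    (I ∷ xs) v le = ∣pick∣ zero xs v z≤n
  ∣pick∣ (suc b) (I ∷ xs) v le with I v
  ... | true  = cong suc (∣pick∣ b xs v (Nat.s≤s⁻¹ le))
  ... | false = ∣pick∣ (suc b) xs v le

  ∈-pick : ∀ b xs v i → Vec.lookup (pick b xs v) i ≡ true → List.lookup xs i v ≡ true
  ∈-pick zero    (I ∷ xs) v (Fin.suc i) eq = ∈-pick zero xs v i eq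
  ∈-pick (suc b) (I ∷ xs) v i           eq with I v in Iv
  ∈-pick (suc b) (I ∷ xs) v Fin.zero    eq | true  = Iv
  ∈-pick (suc b) (I ∷ xs) v (Fin.suc i) eq | true  = ∈-pick b xs v i eq
  ∈-pick (suc b) (I ∷ xs) v (Fin.suc i) eq | false = ∈-pick (suc b) xs v i eq

  toColoring : ∀ xs b → All Independent xs → (∀ v → b ≤ multiplicity v xs) → Coloring G (length xs) b
  toColoring xs b ind cov = pick b xs , (λ v → ∣pick∣ b xs v (cov v)) , λ u v e (i , i∈) →
    let (p , q) = Subsetₚ.x∈p∩q⁻ (pick b xs u) (pick b xs v) i∈ in
    All.lookupAny ind (lookup∈ i) .proj₁ u v
      (subst (λ I → I u ≡ true) (lookup≡ i) (∈-pick b xs u i (Vecₚ.[]=⇒lookup p)))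
      (subst (λ I → I v ≡ true) (lookup≡ i) (∈-pick b xs v i (Vecₚ.[]=⇒lookup q))) e
    where
    import Data.List.Relation.Unary.Any as Any
    lookup∈ : ∀ i → Any.Any (_≡ List.lookup xs i) xs
    lookup∈ i = Any.map sym (∈ₚ.∈-lookup i)
    lookup≡ : ∀ i → List.lookup xs i ≡ Any.lookup (lookup∈ i)
    lookup≡ i = sym (All.lookupAny ind (lookup∈ i) .proj₂)

  fromColoring : ∀ {a b} → Coloring G a b →
    Σ (List VSet) λ xs → length xs ≡ a × All Independent xs × (∀ v → multiplicity v xs ≡ b)
  fromColoring {a} (c , card , disj) = List.tabulate classes , Listₚ.length-tabulate classes ,
    Allₚ.tabulate⁺ (λ i u v iu iv e → disj u v e
      (i , Subsetₚ.x∈p∩q⁺ (Vecₚ.lookup⇒[]= i (c u) iu , Vecₚ.lookup⇒[]= i (c v) iv))) ,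
    λ v → trans (cnt-tabulate (λ I → I v) classes (c v) (λ i → refl)) (card v)
    where
    classes : Fin a → VSet
    classes i v = Vec.lookup (c v) i

-- Cross-multiplication of ratios

module Ratios where
  open Nat using (_*_; _≤_; _<_)
  open ℤ using (+_)

  toℚᵘ-/ : ∀ a b → ℚ.toℚᵘ ((+ a) ℚ./ suc b) ℚᵘ.≃ ℚᵘ.mkℚᵘ (+ a) b
  toℚᵘ-/ a b = ℚₚ.toℚᵘ-fromℚᵘ (ℚᵘ.mkℚᵘ (+ a) b)

  ≤⇒/≤/ : ∀ a b c d → a * suc d ≤ c * suc b → (+ a) ℚ./ suc b ℚ.≤ (+ c) ℚ./ suc d
  ≤⇒/≤/ a b c d le = ℚₚ.toℚᵘ-cancel-≤
    (ℚᵘₚ.≤-respˡ-≃ (ℚᵘₚ.≃-sym (toℚᵘ-/ a b)) (ℚᵘₚ.≤-respʳ-≃ (ℚᵘₚ.≃-sym (toℚᵘ-/ c d))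
      (ℚᵘ.*≤* (subst₂ ℤ._≤_ (ℤₚ.pos-* a (suc d)) (ℤₚ.pos-* c (suc b)) (ℤ.+≤+ le)))))

  /≤/⇒≤ : ∀ a b c d → (+ a) ℚ./ suc b ℚ.≤ (+ c) ℚ./ suc d → a * suc d ≤ c * suc b
  /≤/⇒≤ a b c d le = ℤₚ.drop‿+≤+ (subst₂ ℤ._≤_ (sym (ℤₚ.pos-* a (suc d))) (sym (ℤₚ.pos-* c (suc b)))
    (ℚᵘₚ.drop-*≤* (ℚᵘₚ.≤-respˡ-≃ (toℚᵘ-/ a b) (ℚᵘₚ.≤-respʳ-≃ (toℚᵘ-/ c d) (ℚₚ.toℚᵘ-mono-≤ le)))))

  /</⇒< : ∀ a b c d → (+ a) ℚ./ suc b ℚ.< (+ c) ℚ./ suc d → a * suc d < c * suc b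
  /</⇒< a b c d lt = ℕₚ.≰⇒> λ le → ℚₚ.<-irrefl refl (ℚₚ.<-≤-trans lt (≤⇒/≤/ c d a b le))

-- Criticality and deletion of edges

remove : (G : Graph) → (Fin (n G) → Bool) → Graph
remove G R = record
  { n      = n G
  ; adj    = λ u v → adj G u v ∧ not (R u) ∧ not (R v)
  ; sym    = λ u v → cong₂ _∧_ (adj-sym G u v) (Boolₚ.∧-comm (not (R u)) (not (R v)))
  ; irrefl = λ v → cong (_∧ not (R v) ∧ not (R v)) (adj-irrefl G v)
  }

-- The fractional chromatic number is p / suc d; all comparisons of ratios are cross-multiplied.
record Critical (G : Graph) : Set₁ where
  field
    p d           : ℕ
    minimal       : ∀ a b → Coloring G a (suc b) → p Nat.* suc b Nat.≤ a Nat.* suc d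
    critical      : ∀ H (f : Fin (n H) → Fin (n G)) → IsProperSubgraph H G f →
                    ¬ (∀ a b → Coloring H a (suc b) → p Nat.* suc b Nat.≤ a Nat.* suc d)
    big           : 11 Nat.* suc d Nat.< p Nat.* 4
    triangle-free : TriangleFree G
    subcubic      : MaxDegreeAtMost 3 G

module Subgraphs {G : Graph} (C : Critical G) where
  open Critical C
  open Nat using (_+_; _*_; _∸_; _≤_; _<_; _⊔_; z≤n; s≤s)
  open Fractional

  remove-edge : ∀ R {u v} → adj G u v ≡ true → R u ≡ false → R v ≡ false → Edge (remove G R) u v
  remove-edge R e ru rv rewrite e | ru | rv = refl

  -- `light` places the ratio below χ_f(G), `dense` places it at 11/4 or above; the latter is the
  -- hypothesis of `Extendable`.
  record Light (R : Fin (n G) → Bool) : Set where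
    field
      sets   : List (VSet G)
      size   : ℕ
      pos    : 1 ≤ size
      indep  : All (Independent (remove G R)) sets
      covers : ∀ v → multiplicity G v sets ≡ size
      light  : length sets * suc d < p * size
      dense  : 11 * size ≤ 4 * length sets

  minimal-sets : ∀ xs b → 1 ≤ b → All (Independent G) xs → (∀ v → b ≤ multiplicity G v xs) →
    p * b ≤ length xs * suc d
  minimal-sets xs (suc b) _ ind cov = minimal (length xs) b (toColoring G xs (suc b) ind cov)

  light-coloring : ∀ R {a b} → Coloring (remove G R) a (suc b) → a * suc d < p * suc b → Light R
  light-coloring R {a} {b} c lt with fromColoring (remove G R) c
  ... | xs , refl , ind , cov with 11 * suc b Nat.≤? 4 * a
  ... | yes le = record
    { sets = xs ; size = suc b ; pos = s≤s z≤n ; indep = ind ; covers = cov ; light = lt ; dense = le }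
  -- Four copies are padded with empty classes to length `11 * suc b`, so the ratio becomes exactly
  -- 11/4, and `big` keeps the result light.
  ... | no nle = record
    { sets = ys ; size = 4 * suc b ; pos = s≤s z≤n
    ; indep = Allₚ.++⁺ (All-rep 4 ind) (Allₚ.replicate⁺ (11 * suc b ∸ 4 * a) λ _ _ ())
    ; covers = λ v → begin
        multiplicity G v ys ≡⟨ cnt-++ _ (rep 4 xs) _ ⟩
        cnt _ (rep 4 xs) + cnt _ (List.replicate k ∅) ≡⟨ cong₂ _+_ (cnt-rep _ 4 xs) (cnt-replicate-false _ k ∅ refl) ⟩
        4 * cnt _ xs + 0 ≡⟨ ℕₚ.+-identityʳ _ ⟩
        4 * cnt _ xs ≡⟨ cong (4 *_) (cov v) ⟩
        4 * suc b ∎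
    ; light = subst (_< p * (4 * suc b)) (cong (_* suc d) (sym len))
        (subst₂ _<_ (trans (cong (_* suc b) (ℕₚ.*-comm 11 (suc d))) (trans (ℕₚ.*-assoc (suc d) 11 (suc b)) (ℕₚ.*-comm (suc d) _))) (ℕₚ.*-assoc p 4 (suc b))
          (ℕₚ.*-monoˡ-< (suc b) big))
    ; dense = ℕₚ.≤-reflexive (trans (trans (sym (ℕₚ.*-assoc 11 4 (suc b))) (ℕₚ.*-assoc 4 11 (suc b))) (cong (4 *_) (sym len)))
    }
    where
    open ≡-Reasoning
    ∅ : VSet G
    ∅ _ = false
    k = 11 * suc b ∸ 4 * length xs
    ys = rep 4 xs ++ List.replicate k ∅
    len : length ys ≡ 11 * suc b
    len = begin
      length ys ≡⟨ Listₚ.length-++ (rep 4 xs) ⟩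
      length (rep 4 xs) + length (List.replicate k ∅) ≡⟨ cong₂ _+_ (length-rep 4 xs) (Listₚ.length-replicate k) ⟩
      4 * length xs + k ≡⟨ ℕₚ.m+[n∸m]≡n (ℕₚ.<⇒≤ (ℕₚ.≰⇒> nle)) ⟩
      11 * suc b ∎

  -- The identity embeds the graph with deleted edges, and the edge at `R` makes this subgraph
  -- proper. Criticality merely refutes that every colouring of it is heavy, hence the double
  -- negation.
  light-exists : ∀ R {u v} → Edge G u v → R u ≡ true → ¬ ¬ Light R
  light-exists R {u} {v} e ru k = critical (remove G R) id
    ( (λ _ _ eq → eq)
    , (λ x y h → Boolₚ.∧-conicalˡ (adj G x y) _ h)
    , λ (_ , full) → case-false (full u v e) )
    λ a b c → ℕₚ.≮⇒≥ λ lt → k (light-coloring R c lt)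
    where
    case-false : ¬ (adj G u v ∧ not (R u) ∧ not (R v) ≡ true)
    case-false h rewrite e | ru with () ← h

  -- The edges of a critical graph lie in one component. Otherwise a light colouring that is proper
  -- off `S` and one that is proper on `S`, brought to equal size by repetition, can be glued: no
  -- edge crosses, and the merged family is only as long as the longer of the two, hence still
  -- light.
  connected : ∀ S → (∀ u v → Edge G u v → S u ≡ S v) →
    ∀ {u v x y} → Edge G u v → S u ≡ true → Edge G x y → S x ≡ false → ⊥
  connected S closed e su e′ sx =
    light-exists S e su λ L → light-exists (not ∘ S) e′ (cong not sx) λ L′ →
    let module L = Light L
        module L′ = Light L′
        xs = rep L′.size L.sets
        ys = rep L.size L′.sets
        B = L′.size * L.size
        zs = merge S xs ys
        cov : ∀ v → B ≤ multiplicity G v zs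
        cov v = ℕₚ.≤-reflexive (sym (covers L L′ v))
        lx : length xs * suc d < p * B
        lx = scaled L.sets L′.size L.size L′.pos L.light
        ly : length ys * suc d < p * B
        ly = subst (λ z → length ys * suc d < p * z) (ℕₚ.*-comm L.size L′.size) (scaled L′.sets L.size L′.size L.pos L′.light)
        lz : length zs * suc d < p * B
        lz = subst (λ z → z * suc d < p * B) (sym (length-merge S xs ys)) (⊔-bound (length xs) (length ys) lx ly)
    in ℕₚ.<⇒≱ lz (minimal-sets zs B (ℕₚ.*-mono-≤ L′.pos L.pos)
      (All-merge S (λ _ _ ()) (λ _ _ ()) (λ {I} {J} p q → indep I J p q) (All-rep L′.size L.indep) (All-rep L.size L′.indep)) cov)
    where
    scaled : ∀ (xs : List (VSet G)) k b → 1 ≤ k → length xs * suc d < p * b → length (rep k xs) * suc d < p * (k * b)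
    scaled xs (suc k) b _ lt rewrite length-rep (suc k) xs | ℕₚ.*-assoc (suc k) (length xs) (suc d)
      | sym (ℕₚ.*-assoc p (suc k) b) | ℕₚ.*-comm p (suc k) | ℕₚ.*-assoc (suc k) p b = ℕₚ.*-monoʳ-< (suc k) lt
    ⊔-bound : ∀ a b {c} → a * suc d < c → b * suc d < c → (a ⊔ b) * suc d < c
    ⊔-bound a b la lb with ℕₚ.⊔-sel a b
    ... | inj₁ eq rewrite eq = la
    ... | inj₂ eq rewrite eq = lb
    covers : ∀ (L : Light S) (L′ : Light (not ∘ S)) v →
      multiplicity G v (merge S (rep (Light.size L′) (Light.sets L)) (rep (Light.size L) (Light.sets L′))) ≡ Light.size L′ * Light.size L
    covers L L′ v with S v in sv
    ... | true  = trans (cnt-merge-in S v sv (rep (Light.size L′) (Light.sets L)) (rep (Light.size L) (Light.sets L′))) (trans (cnt-rep _ (Light.size L) (Light.sets L′))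
      (trans (cong (Light.size L *_) (Light.covers L′ v)) (ℕₚ.*-comm (Light.size L) _)))
    ... | false = trans (cnt-merge-out S v sv (rep (Light.size L′) (Light.sets L)) (rep (Light.size L) (Light.sets L′))) (trans (cnt-rep _ (Light.size L′) (Light.sets L))
      (cong (Light.size L′ *_) (Light.covers L v)))
    indep : ∀ I J → Independent (remove G S) I → Independent (remove G (not ∘ S)) J → Independent G (glue S I J)
    indep I J iI iJ u v iu iv e with S u in su | S v in sv | closed u v e
    ... | true  | true  | _ = iJ u v iu iv (remove-edge (not ∘ S) e (cong not su) (cong not sv))
    ... | false | false | _ = iI u v iu iv (remove-edge S e su sv)

-- Sorting colours by the terminals that carry them

module Types where
  open Nat using (_+_; _*_; _≤_)

  -- A type records which of k terminals carry a given colour.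
  Type : ℕ → Set
  Type = Vec Bool

  sumT : ∀ k → (Type k → ℕ) → ℕ
  sumT zero    f = f []
  sumT (suc k) f = sumT k (f ∘ (true ∷_)) + sumT k (f ∘ (false ∷_))

  concatT : ∀ {A : Set} k → (Type k → List A) → List A
  concatT zero    f = f []
  concatT (suc k) f = concatT k (f ∘ (true ∷_)) ++ concatT k (f ∘ (false ∷_))

  allT : ∀ k → (Type k → Bool) → Bool
  allT zero    f = f []
  allT (suc k) f = allT k (f ∘ (true ∷_)) ∧ allT k (f ∘ (false ∷_))

  allT-sound : ∀ k {f} → allT k f ≡ true → ∀ τ → f τ ≡ true
  allT-sound zero    eq []          = eq
  allT-sound (suc k) eq (true  ∷ τ) = allT-sound k (Boolₚ.∧-conicalˡ _ _ eq) τ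
  allT-sound (suc k) eq (false ∷ τ) = allT-sound k (Boolₚ.∧-conicalʳ _ _ eq) τ

  sumT-cong : ∀ k {f g} → (∀ τ → f τ ≡ g τ) → sumT k f ≡ sumT k g
  sumT-cong zero    eq = eq []
  sumT-cong (suc k) eq = cong₂ _+_ (sumT-cong k (eq ∘ (true ∷_))) (sumT-cong k (eq ∘ (false ∷_)))

  sumT-mono : ∀ k {f g} → (∀ τ → f τ ≤ g τ) → sumT k f ≤ sumT k g
  sumT-mono zero    le = le []
  sumT-mono (suc k) le = ℕₚ.+-mono-≤ (sumT-mono k (le ∘ (true ∷_))) (sumT-mono k (le ∘ (false ∷_)))

  sumT-+ : ∀ k f g → sumT k (λ τ → f τ + g τ) ≡ sumT k f + sumT k g
  sumT-+ zero    f g = refl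
  sumT-+ (suc k) f g = trans (cong₂ _+_ (sumT-+ k _ _) (sumT-+ k _ _))
    (interchange (sumT k (f ∘ (true ∷_))) _ _ _)
    where open import Algebra.Properties.CommutativeSemigroup ℕₚ.+-commutativeSemigroup using (interchange)

  sumT-* : ∀ k c f → sumT k (λ τ → c * f τ) ≡ c * sumT k f
  sumT-* zero    c f = refl
  sumT-* (suc k) c f = trans (cong₂ _+_ (sumT-* k c _) (sumT-* k c _))
    (sym (ℕₚ.*-distribˡ-+ c (sumT k (f ∘ (true ∷_))) _))

  cnt-concatT : ∀ {A : Set} (p : A → Bool) k f → cnt p (concatT k f) ≡ sumT k (cnt p ∘ f)
  cnt-concatT p zero    f = refl
  cnt-concatT p (suc k) f = trans (cnt-++ p (concatT k (f ∘ (true ∷_))) _) (cong₂ _+_ (cnt-concatT p k _) (cnt-concatT p k _))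

  length-concatT : ∀ {A : Set} k (f : Type k → List A) → length (concatT k f) ≡ sumT k (length ∘ f)
  length-concatT zero    f = refl
  length-concatT (suc k) f = trans (Listₚ.length-++ (concatT k (f ∘ (true ∷_)))) (cong₂ _+_ (length-concatT k _) (length-concatT k _))

  All-concatT : ∀ {A : Set} {P : A → Set} k {f} → (∀ τ → All P (f τ)) → All P (concatT k f)
  All-concatT zero    ps = ps []
  All-concatT (suc k) ps = Allₚ.++⁺ (All-concatT k (ps ∘ (true ∷_))) (All-concatT k (ps ∘ (false ∷_)))

  sift : ∀ {A : Set} → (A → Bool) → Bool → List A → List A
  sift p b []       = []
  sift p b (x ∷ xs) = if does (p x Boolₚ.≟ b) then x ∷ sift p b xs else sift p b xs

  sift-all : ∀ {A : Set} {P : A → Set} p b {xs} → All P xs → All (λ x → p x ≡ b × P x) (sift p b xs)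
  sift-all p b {[]}     []         = []
  sift-all p b {x ∷ xs} (px ∷ pxs) with p x Boolₚ.≟ b
  ... | yes eq = (eq , px) ∷ sift-all p b pxs
  ... | no  _  = sift-all p b pxs

  cnt-sift : ∀ {A : Set} (q p : A → Bool) xs → cnt q (sift p true xs) + cnt q (sift p false xs) ≡ cnt q xs
  cnt-sift q p []       = refl
  cnt-sift q p (x ∷ xs) with p x
  ... | true  = trans (ℕₚ.+-assoc (bit (q x)) _ _) (cong (bit (q x) +_) (cnt-sift q p xs))
  ... | false = trans (swap-left (cnt q (sift p true xs)) (bit (q x)) _) (cong (bit (q x) +_) (cnt-sift q p xs))
    where
    swap-left : ∀ a b c → a + (b + c) ≡ b + (a + c)
    swap-left a b c = trans (sym (ℕₚ.+-assoc a b c)) (trans (cong (_+ c) (ℕₚ.+-comm a b)) (ℕₚ.+-assoc b a c))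

  module _ {V : Set} where
    -- The terminals need not be distinct: for coinciding terminals the contradictory types just get
    -- empty buckets.
    bucket : ∀ {k} → Vec V k → List (V → Bool) → Type k → List (V → Bool)
    bucket []       xs []      = xs
    bucket (t ∷ ts) xs (b ∷ τ) = bucket ts (sift (λ I → I t) b xs) τ

    cnt-bucket : ∀ {k} (q : (V → Bool) → Bool) (ts : Vec V k) xs → sumT k (λ τ → cnt q (bucket ts xs τ)) ≡ cnt q xs
    cnt-bucket q []       xs = refl
    cnt-bucket q (t ∷ ts) xs = trans (cong₂ _+_ (cnt-bucket q ts _) (cnt-bucket q ts _)) (cnt-sift q (λ I → I t) xs)

    bucket-all : ∀ {k} {P : (V → Bool) → Set} (ts : Vec V k) {xs} τ → All P xs →
      All (λ I → (∀ s → I (Vec.lookup ts s) ≡ Vec.lookup τ s) × P I) (bucket ts xs τ)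
    bucket-all []       []      ps = All.map (λ p → (λ ()) , p) ps
    bucket-all (t ∷ ts) (b ∷ τ) ps = All.map
      (λ (h , eq , p) → (λ { 0F → eq ; (Fin.suc s) → h s }) , p)
      (bucket-all ts τ (sift-all (λ I → I t) b ps))

  cnt-true : ∀ {A : Set} (xs : List A) → cnt (λ _ → true) xs ≡ length xs
  cnt-true []       = refl
  cnt-true (x ∷ xs) = cong suc (cnt-true xs)

  cnt-const : ∀ {A : Set} (q : A → Bool) b {xs} → All (λ x → q x ≡ b) xs → cnt q xs ≡ (if b then length xs else 0)
  cnt-const q true  []         = refl
  cnt-const q false []         = refl
  cnt-const q true  (eq ∷ eqs) rewrite eq = cong suc (cnt-const q true eqs)
  cnt-const q false (eq ∷ eqs) rewrite eq = cnt-const q false eqs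

open Types

-- Templates and extension plans

module Templates where
  open Nat using (_+_; _*_; _≤_; z≤n)
  open import Data.Bool.ListAction using (any; all)

  testBit : ℕ → ℕ → Bool
  testBit m zero    = (m Nat.% 2) Nat.≡ᵇ 1
  testBit m (suc i) = testBit (m Nat./ 2) i

  marginal : ∀ {k} → (Type k → ℕ) → Fin k → ℕ
  marginal {k} m s = sumT k λ τ → if Vec.lookup τ s then m τ else 0

  record Template (k : ℕ) : Set where
    field
      r        : ℕ
      edges    : List (Fin r × Fin r)
      terminal : Fin r → Maybe (Fin k)

    is : Fin r → Fin r → Bool
    is i j = does (i Fin.≟ j)

    joins : Fin r → Fin r → Fin r × Fin r → Bool
    joins i j (a , b) = (is a i ∧ is b j) ∨ (is a j ∧ is b i)

    tadj : Fin r → Fin r → Bool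
    tadj i j = any (joins i j) edges

    neighbours : Fin r → List (Fin r)
    neighbours i = List.filter (λ j → tadj i j Boolₚ.≟ true) (List.allFin r)

    opens : List (Fin r)
    opens = List.filter (λ i → is-just (terminal i) Boolₚ.≟ true) (List.allFin r)

    -- A vertex without a terminal must have three neighbours inside the template; under maximum
    -- degree 3 these are all its neighbours in the host graph.
    isClosed : Fin r → Bool
    isClosed i with terminal i
    ... | just _  = true
    ... | nothing = 3 Nat.≤ᵇ length (neighbours i)

    allFin : (Fin r → Bool) → Bool
    allFin f = all f (List.allFin r)

    -- Sets of template vertices are encoded as bit masks.
    mem : ℕ → Fin r → Bool
    mem m i = testBit m (Fin.toℕ i)

    avoids : Maybe (Fin k) → Type k → Bool
    avoids nothing  τ = true
    avoids (just s) τ = not (Vec.lookup τ s)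

    -- Here `τ` is the trace of one colour on the terminals and `J` the set of template vertices
    -- that are to receive this colour.
    compatible : Type k → ℕ → Bool
    compatible τ J = allFin λ i → not (mem J i) ∨
      (avoids (terminal i) τ ∧ allFin λ j → not (mem J j ∧ tadj i j))

    Plan : Set
    Plan = Type k → List ℕ

    coverage : Plan → Fin r → ℕ
    coverage P i = sumT k λ τ → cnt (λ J → mem J i) (P τ)

    record Ext (m : Type k → ℕ) (b : ℕ) : Set where
      pattern; constructor ext
      field
        plan  : Plan
        valid : ∀ τ → All (λ J → compatible τ J ≡ true) (plan τ)
        fits  : ∀ τ → length (plan τ) ≤ m τ
        cover : ∀ i → b ≤ coverage plan i

    check : (Type k → ℕ) → ℕ → Plan → Bool
    check m b P = allT k (λ τ → all (compatible τ) (P τ) ∧ (length (P τ) Nat.≤ᵇ m τ))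
      ∧ allFin (λ i → b Nat.≤ᵇ coverage P i)

    true⇒T : ∀ {b} → b ≡ true → Data.Bool.T b
    true⇒T refl = _

    all-sound : ∀ {A : Set} (f : A → Bool) xs → all f xs ≡ true → All (λ x → f x ≡ true) xs
    all-sound f []       eq = []
    all-sound f (x ∷ xs) eq = Boolₚ.∧-conicalˡ _ _ eq ∷ all-sound f xs (Boolₚ.∧-conicalʳ _ _ eq)

    allFin-sound : ∀ {f} → allFin f ≡ true → ∀ i → f i ≡ true
    allFin-sound {f} eq i = All.lookup (all-sound f (List.allFin r) eq) (∈ₚ.∈-allFin i)

    check-sound : ∀ m b P → check m b P ≡ true → Ext m b
    check-sound m b P eq = ext P
      (λ τ → all-sound (compatible τ) (P τ) (Boolₚ.∧-conicalˡ _ _ (byType τ)))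
      (λ τ → ℕₚ.≤ᵇ⇒≤ _ _ (true⇒T (Boolₚ.∧-conicalʳ _ _ (byType τ))))
      (λ i → ℕₚ.≤ᵇ⇒≤ _ _ (true⇒T (allFin-sound (Boolₚ.∧-conicalʳ _ _ eq) i)))
      where
      byType : ∀ τ → (all (compatible τ) (P τ) ∧ (length (P τ) Nat.≤ᵇ m τ)) ≡ true
      byType = allT-sound k (Boolₚ.∧-conicalˡ _ _ eq)

    ext-zero : Ext (λ _ → 0) 0
    ext-zero = ext (λ _ → []) (λ _ → []) (λ _ → z≤n) (λ _ → z≤n)

    ext-+ : ∀ {m m′ b b′} → Ext m b → Ext m′ b′ → Ext (λ τ → m τ + m′ τ) (b + b′)
    ext-+ (ext P v f c) (ext P′ v′ f′ c′) = ext (λ τ → P τ ++ P′ τ)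
      (λ τ → Allₚ.++⁺ (v τ) (v′ τ))
      (λ τ → subst (_≤ _) (sym (Listₚ.length-++ (P τ))) (ℕₚ.+-mono-≤ (f τ) (f′ τ)))
      (λ i → subst (_ ≤_) (sym (trans (sumT-cong k λ τ → cnt-++ _ (P τ) (P′ τ)) (sumT-+ k _ _)))
        (ℕₚ.+-mono-≤ (c i) (c′ i)))

    ext-* : ∀ {m b} c → Ext m b → Ext (λ τ → c * m τ) (c * b)
    ext-* zero    e = ext-zero
    ext-* (suc c) e = ext-+ e (ext-* c e)

    ext-mono : ∀ {m m′ b b′} → (∀ τ → m τ ≤ m′ τ) → b′ ≤ b → Ext m b → Ext m′ b′
    ext-mono le le′ (ext P v f c) = ext P v (λ τ → ℕₚ.≤-trans (f τ) (le τ)) (λ i → ℕₚ.≤-trans le′ (c i))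

    -- Equal marginals and the total are all that is known of the outside colouring. The factor `c`
    -- absorbs the denominators that arise when `m` is written as a combination of rays.
    Extendable : Set
    Extendable = ∀ (m : Type k → ℕ) b → 1 ≤ b → (∀ s → marginal m s ≡ b) → 11 * b ≤ 4 * sumT k m →
      ∃ λ c → 1 ≤ c × Ext (λ τ → c * m τ) (c * b)

open Templates

-- Extending light colourings over an embedded template

module Extension {G : Graph} (C : Critical G) where
  open Critical C
  open Subgraphs C
  open Fractional G
  open Nat using (_*_; _≤_; _<_; z≤n; s≤s)
  open import Data.Bool.ListAction using (any)

  unique-length : ∀ {n} (s : Subset n) {xs} → Unique xs → All (_∈ s) xs → length xs ≤ ∣ s ∣
  unique-length s []        []         = z≤n
  unique-length s (x∉ ∷ xs!) (x∈ ∷ xs∈) = ℕₚ.≤-trans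
    (s≤s (unique-length (s Data.Fin.Subset.- _) xs! (All.zipWith (λ (y∈ , x≢y) → Subsetₚ.x∈p∧x≢y⇒x∈p-y y∈ (x≢y ∘ sym)) (xs∈ , x∉))))
    (Subsetₚ.x∈p⇒∣p-x∣<∣p∣ x∈)

  no-four : ∀ {v a b c e} → Edge G v a → Edge G v b → Edge G v c → Edge G v e →
    Unique (a ∷ b ∷ c ∷ e ∷ []) → ⊥
  no-four {v} ea eb ec ee uniq = ℕₚ.<⇒≱ (unique-length (Vec.tabulate (adj G v)) uniq
    (∈N ea ∷ ∈N eb ∷ ∈N ec ∷ ∈N ee ∷ [])) (subcubic v)
    where
    ∈N : ∀ {a} → Edge G v a → a ∈ Vec.tabulate (adj G v)
    ∈N {a} e = Vecₚ.lookup⇒[]= a _ (trans (Vecₚ.lookup∘tabulate (adj G v) a) e)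

  edge-sym : ∀ {u v} → Edge G u v → Edge G v u
  edge-sym {u} {v} e = trans (adj-sym G v u) e

  edge-≢ : ∀ {u v} → Edge G u v → u ≢ v
  edge-≢ {u} e refl with () ← trans (sym e) (adj-irrefl G u)

  -- `closed` and `inner` make the template an induced subgraph, and `outer` confines each open
  -- vertex to its terminal, so compatibility with the type of a colour is the only constraint from
  -- outside.
  record Embedding {k} (t : Template k) (f : Vec (Fin (n G)) (Template.r t)) (ts : Vec (Fin (n G)) k) : Set where
    open Template t
    at : Fin r → Fin (n G)
    at = Vec.lookup f
    field
      injective : ∀ i j → at i ≡ at j → i ≡ j
      present   : All (λ (i , j) → Edge G (at i) (at j)) edges
      closed    : ∀ i → isClosed i ≡ true
      inner     : AllPairs (λ i j → ¬ Edge G (at i) (at j)) opens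
      outer     : All (λ i → ∀ v → Edge G (at i) v → (∀ j → v ≢ at j) → ∃ λ s → terminal i ≡ just s × v ≡ Vec.lookup ts s) opens

  module _ {k} (t : Template k) {f ts} (E : Embedding t f ts) where
    open Template t
    open Embedding E

    is-sound : ∀ {i j} → is i j ≡ true → i ≡ j
    is-sound {i} {j} eq with i Fin.≟ j
    ... | yes p = p

    tadj-sound : ∀ i j → tadj i j ≡ true → Edge G (at i) (at j)
    tadj-sound i j = go present
      where
      go : ∀ {es} → All (λ (i , j) → Edge G (at i) (at j)) es →
        any (joins i j) es ≡ true → Edge G (at i) (at j)
      go {(a , b) ∷ es} (e ∷ es′) eq with is a i ∧ is b j in p | is a j ∧ is b i in q
      ... | true  | _     = subst₂ (λ x y → Edge G (at x) (at y)) (is-sound (Boolₚ.∧-conicalˡ (is a i) _ p)) (is-sound (Boolₚ.∧-conicalʳ (is a i) _ p)) e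
      ... | false | true  = edge-sym (subst₂ (λ x y → Edge G (at x) (at y)) (is-sound (Boolₚ.∧-conicalˡ (is a j) _ q)) (is-sound (Boolₚ.∧-conicalʳ (is a j) _ q)) e)
      ... | false | false = go es′ eq

    tadj-sym : ∀ i j → tadj i j ≡ tadj j i
    tadj-sym i j = go edges
      where
      go : ∀ es → any (joins i j) es ≡ any (joins j i) es
      go []             = refl
      go ((a , b) ∷ es) = cong₂ _∨_ (Boolₚ.∨-comm (is a i ∧ is b j) _) (go es)

    neighbours-sound : ∀ i → All (λ j → tadj i j ≡ true) (neighbours i)
    neighbours-sound i = Allₚ.all-filter (λ j → tadj i j Boolₚ.≟ true) (List.allFin r)

    closed-neighbour : ∀ i → terminal i ≡ nothing → ∀ v → Edge G (at i) v → ∃ λ j → v ≡ at j × tadj i j ≡ true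
    closed-neighbour i eq v e with closed i
    ... | c rewrite eq with neighbours i | neighbours-sound i | Uniqueₚ.filter⁺ (λ j → tadj i j Boolₚ.≟ true) (Uniqueₚ.allFin⁺ r)
    ... | a ∷ b ∷ c ∷ _ | ta ∷ tb ∷ tc ∷ _ | (a≢b ∷ a≢c ∷ _) ∷ (b≢c ∷ _) ∷ _ with v Fin.≟ at a | v Fin.≟ at b | v Fin.≟ at c
    ... | yes p | _ | _ = a , p , ta
    ... | _ | yes p | _ = b , p , tb
    ... | _ | _ | yes p = c , p , tc
    ... | no p | no q | no s = ⊥-elim (no-four e (tadj-sound i a ta) (tadj-sound i b tb) (tadj-sound i c tc)
      ((p ∷ q ∷ s ∷ []) ∷ (a≢b ∘ injective a b ∷ a≢c ∘ injective a c ∷ []) ∷ (b≢c ∘ injective b c ∷ []) ∷ [] ∷ []))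

    ∈-opens : ∀ {i s} → terminal i ≡ just s → i ∈ˡ opens
    ∈-opens {i} eq = ∈ₚ.∈-filter⁺ (λ i → is-just (terminal i) Boolₚ.≟ true) (∈ₚ.∈-allFin i) (cong is-just eq)

    -- If one end has no terminal, its neighbours are exhausted by the template; two ends with
    -- terminals are covered by `inner`.
    edge-known : ∀ i j → Edge G (at i) (at j) → tadj i j ≡ true
    edge-known i j e with terminal i in ti | terminal j in tj
    ... | nothing | _ = let (j′ , eq , t) = closed-neighbour i ti (at j) e in subst (λ z → tadj i z ≡ true) (sym (injective j j′ eq)) t
    ... | just _ | nothing = let (i′ , eq , t) = closed-neighbour j tj (at i) (edge-sym e) in
      trans (tadj-sym i j) (subst (λ z → tadj j z ≡ true) (sym (injective i i′ eq)) t)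
    ... | just _ | just _ with i Fin.≟ j
    ...   | yes refl = ⊥-elim (edge-≢ e refl)
    ...   | no i≢j = ⊥-elim (pair inner (∈-opens ti) (∈-opens tj) e)
      where
      pair : ∀ {l} → AllPairs (λ i j → ¬ Edge G (at i) (at j)) l → i ∈ˡ l → j ∈ˡ l → ¬ Edge G (at i) (at j)
      pair (ps ∷ _)  (here refl) (here refl) = λ _ → i≢j refl
      pair (ps ∷ _)  (here refl) (there j∈)  = All.lookup ps j∈
      pair (ps ∷ _)  (there i∈)  (here refl) = All.lookup ps i∈ ∘ edge-sym
      pair (_ ∷ pss) (there i∈)  (there j∈)  = pair pss i∈ j∈

    R : Fin (n G) → Bool
    R v = does (Finₚ.any? λ i → at i Fin.≟ v)

    R-false : ∀ v → R v ≡ false → ∀ i → v ≢ at i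
    R-false v eq i refl with Finₚ.any? (λ j → at j Fin.≟ at i)
    ... | no ¬p = ¬p (i , refl)

    R-at : ∀ i → R (at i) ≡ true
    R-at i = dec-true (Finₚ.any? (λ j → at j Fin.≟ at i)) (i , refl)

    R-true : ∀ v → R v ≡ true → ∃ λ i → at i ≡ v
    R-true v eq with Finₚ.any? (λ j → at j Fin.≟ v)
    ... | yes p = p

    place : ℕ → VSet
    place J v = does (Finₚ.any? λ i → (at i Fin.≟ v) ×-dec (mem J i Boolₚ.≟ true))

    place-at : ∀ J i → place J (at i) ≡ true → mem J i ≡ true
    place-at J i eq with Finₚ.any? (λ j → (at j Fin.≟ at i) ×-dec (mem J j Boolₚ.≟ true))
    ... | yes (j , p , m) = subst (λ z → mem J z ≡ true) (injective j i p) m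

    cnt-place : ∀ i Js → cnt (λ J → mem J i) Js ≤ multiplicity (at i) (map place Js)
    cnt-place i []       = z≤n
    cnt-place i (J ∷ Js) = ℕₚ.+-mono-≤ (le J) (cnt-place i Js)
      where
      le : ∀ J → bit (mem J i) ≤ bit (place J (at i))
      le J with mem J i in eq
      ... | false = z≤n
      ... | true rewrite dec-true (Finₚ.any? λ j → (at j Fin.≟ at i) ×-dec (mem J j Boolₚ.≟ true)) (i , refl , eq) = s≤s z≤n

    boundary : ∀ τ {I : VSet} {J} i v → compatible τ J ≡ true → (∀ s → I (Vec.lookup ts s) ≡ true → Vec.lookup τ s ≡ true) →
      place J (at i) ≡ true → I v ≡ true → Edge G (at i) v → R v ≡ false → ⊥
    boundary τ {I} {J} i v ok ty iu iv e rv with allFin-sound ok i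
    ... | c rewrite place-at J i iu with terminal i in ti
    ... | nothing = let (j , eq , _) = closed-neighbour i ti v e in R-false v rv j eq
    ... | just s with All.lookup outer (∈-opens ti) v e (R-false v rv)
    ... | s′ , eq , refl with trans (sym ti) eq
    ... | refl rewrite ty s iv with () ← c

    disjoint : ∀ τ {J} i j → compatible τ J ≡ true → place J (at i) ≡ true → place J (at j) ≡ true → ¬ Edge G (at i) (at j)
    disjoint τ {J} i j ok iu iv e with allFin-sound ok i
    ... | c rewrite place-at J i iu with allFin-sound (Boolₚ.∧-conicalʳ (avoids (terminal i) τ) _ c) j
    ... | c′ rewrite place-at J j iv | edge-known i j e with () ← c′

    Typed : Type k → VSet → Set
    Typed τ I = (∀ s → I (Vec.lookup ts s) ≡ true → Vec.lookup τ s ≡ true) × Fractional.Independent (remove G R) I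

    glue-∅ : ∀ τ {I : VSet} → Typed τ I → Independent (glue R I (λ _ → false))
    glue-∅ τ (ty , iI) u v iu iv e with R u in ru | R v in rv
    ... | false | false = iI u v iu iv (remove-edge R e ru rv)

    glue-independent : ∀ τ {I : VSet} {J} → Typed τ I →
      compatible τ J ≡ true → Independent (glue R I (place J))
    glue-independent τ {I} {J} (ty , iI) ok u v iu iv e with R u in ru | R v in rv
    ... | false | false = iI u v iu iv (remove-edge R e ru rv)
    ... | true  | false with R-true u ru
    ...   | i , refl = boundary τ {I} i v ok ty iu iv e rv
    glue-independent τ {I} {J} (ty , iI) ok u v iu iv e | false | true with R-true v rv
    ...   | i , refl = boundary τ {I} i u ok ty iv iu (edge-sym e) ru
    glue-independent τ {I} {J} (ty , iI) ok u v iu iv e | true  | true with R-true u ru | R-true v rv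
    ...   | i , refl | j , refl = disjoint τ i j ok iu iv e

    -- A light colouring of the graph without the edges at `R` is kept outside `R`, repeated `c`
    -- times, and replaced on `R` by the plan. By `fits` the plan creates no additional class for
    -- any type, so the ratio does not change and a colouring of `G` below χ_f(G) results. The edge
    -- at the template makes the deletion proper.
    irreducible : Extendable → ∀ i v → ¬ Edge G (at i) v
    irreducible extendable i₀ v₀ e₀ = light-exists R e₀ (R-at i₀) contradiction-from
      where
      contradiction-from : ¬ Light R
      contradiction-from L = ℕₚ.<⇒≱ light-zs (minimal-sets zs (c * size) (ℕₚ.*-mono-≤ c>0 pos) indep-zs cover-zs)
        where
        open Light L
        m : Type k → ℕ
        m τ = length (bucket ts sets τ)
        typed : ∀ τ → All (λ I → (∀ s → I (Vec.lookup ts s) ≡ Vec.lookup τ s) × Fractional.Independent (remove G R) I) (bucket ts sets τ)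
        typed τ = bucket-all ts τ indep
        total : sumT k m ≡ length sets
        total = trans (sumT-cong k λ τ → sym (cnt-true (bucket ts sets τ)))
          (trans (cnt-bucket (λ _ → true) ts sets) (cnt-true sets))
        -- The edge-deleted colouring gives every vertex exactly `size` classes, so the marginals
        -- agree even when terminals coincide or lie in the template.
        marg : ∀ s → marginal m s ≡ size
        marg s = trans (sumT-cong k λ τ → sym (cnt-const (λ I → I (Vec.lookup ts s)) (Vec.lookup τ s) (All.map (λ h → h .proj₁ s) (typed τ))))
          (trans (cnt-bucket (λ I → I (Vec.lookup ts s)) ts sets) (covers (Vec.lookup ts s)))
        extension = extendable m size pos marg (subst (λ z → 11 * size ≤ 4 * z) (sym total) dense)
        c = extension .proj₁
        c>0 = extension .proj₂ .proj₁
        open Ext (extension .proj₂ .proj₂)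
        part : Type k → List VSet
        part τ = merge R (rep c (bucket ts sets τ)) (map place (plan τ))
        zs = concatT k part
        length-part : ∀ τ → length (part τ) ≡ c * m τ
        length-part τ = trans (length-merge R (rep c (bucket ts sets τ)) (map place (plan τ)))
          (trans (cong₂ Nat._⊔_ (length-rep c (bucket ts sets τ)) (Listₚ.length-map place (plan τ))) (ℕₚ.m≥n⇒m⊔n≡m (fits τ)))
        length-zs : length zs ≡ c * length sets
        length-zs = trans (length-concatT k part) (trans (sumT-cong k length-part)
          (trans (sumT-* k c m) (cong (c *_) total)))
        light-zs : length zs * suc d < p * (c * size)
        light-zs = subst₂ _<_ (trans (sym (ℕₚ.*-assoc c (length sets) (suc d))) (cong (_* suc d) (sym length-zs)))
          (trans (sym (ℕₚ.*-assoc c p size)) (trans (cong (_* size) (ℕₚ.*-comm c p)) (ℕₚ.*-assoc p c size)))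
          (ℕₚ.*-monoʳ-< c {{Nat.>-nonZero c>0}} light)
        indep-zs : All Independent zs
        indep-zs = All-concatT k λ τ → All-merge R {P = Typed τ} {Q = λ K → ∀ {I} → Typed τ I → Independent (glue R I K)}
          ((λ s ()) , λ _ _ ()) (glue-∅ τ) (λ t g → g t)
          (All-rep c (All.map (λ (ty , iI) → (λ s eq → trans (sym (ty s)) eq) , iI) (typed τ)))
          (Allₚ.map⁺ (All.map (λ ok {I} t → glue-independent τ {I} t ok) (valid τ)))
        cover-zs : ∀ v → c * size ≤ multiplicity v zs
        cover-zs v with R v in rv
        ... | false = ℕₚ.≤-reflexive (sym (trans (cnt-concatT _ k part) (trans
          (sumT-cong k λ τ → trans (cnt-merge-out R v rv (rep c (bucket ts sets τ)) (map place (plan τ))) (cnt-rep _ c (bucket ts sets τ)))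
          (trans (sumT-* k c _) (cong (c *_) (trans (cnt-bucket _ ts sets) (covers v)))))))
        ... | true with R-true v rv
        ... | i , refl = ℕₚ.≤-trans (cover i) (subst (coverage plan i ≤_)
          (sym (trans (cnt-concatT _ k part) (sumT-cong k λ τ → cnt-merge-in R (at i) rv (rep c (bucket ts sets τ)) (map place (plan τ)))))
          (sumT-mono k λ τ → cnt-place i (plan τ)))

-- Decomposing type counts into extreme rays

module Decomposition where
  open Nat using (_+_; _*_; _≤_; z≤n; s≤s)
  open ℕₚ using (≤-trans; *-monoˡ-≤)
  open +-*-Solver using (solve; _:=_; _:+_; _:*_; con)
  open ℕₚ using () renaming (≤-reflexive to ≡⇒≤)

  tab₁ : ∀ {A : Set} → A → A → Type 1 → A
  tab₁ a b (true  ∷ []) = a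
  tab₁ a b (false ∷ []) = b

  tab₂ : ∀ {A : Set} → A → A → A → A → Type 2 → A
  tab₂ a b c d (true  ∷ τ) = tab₁ a b τ
  tab₂ a b c d (false ∷ τ) = tab₁ c d τ

  tab₃ : ∀ {A : Set} → A → A → A → A → A → A → A → A → Type 3 → A
  tab₃ a b c d e f g h (true  ∷ τ) = tab₂ a b c d τ
  tab₃ a b c d e f g h (false ∷ τ) = tab₂ e f g h τ

  each₁ : ∀ {P : Type 1 → Set} → P (true ∷ []) → P (false ∷ []) → ∀ τ → P τ
  each₁ a b (true  ∷ []) = a
  each₁ a b (false ∷ []) = b

  each₂ : ∀ {P : Type 2 → Set} → P (true ∷ true ∷ []) → P (true ∷ false ∷ []) →
    P (false ∷ true ∷ []) → P (false ∷ false ∷ []) → ∀ τ → P τ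
  each₂ {P} a b c d (true  ∷ τ) = each₁ {P = P ∘ (true ∷_)} a b τ
  each₂ {P} a b c d (false ∷ τ) = each₁ {P = P ∘ (false ∷_)} c d τ

  each₃ : ∀ {P : Type 3 → Set} →
    P (true ∷ true ∷ true ∷ []) → P (true ∷ true ∷ false ∷ []) → P (true ∷ false ∷ true ∷ []) → P (true ∷ false ∷ false ∷ []) →
    P (false ∷ true ∷ true ∷ []) → P (false ∷ true ∷ false ∷ []) → P (false ∷ false ∷ true ∷ []) → P (false ∷ false ∷ false ∷ []) →
    ∀ τ → P τ
  each₃ {P} a b c d e f g h (true  ∷ τ) = each₂ {P = P ∘ (true ∷_)} a b c d τ
  each₃ {P} a b c d e f g h (false ∷ τ) = each₂ {P = P ∘ (false ∷_)} e f g h τ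

  cancel-≤ : ∀ k {a b x y} → x ≡ k + a → y ≡ k + b → x ≤ y → a ≤ b
  cancel-≤ k refl refl le = ℕₚ.+-cancelˡ-≤ k _ _ le

  module _ (t : Template 1) where
    open Template t

    -- Up to colours that avoid the terminal there is a single ray, with total 11 for marginal 4.
    extendable₁ : Ext (tab₁ 4 7) 4 → Extendable
    extendable₁ same m b _ marg dense = 4 , s≤s z≤n ,
      core (m (true ∷ [])) (m (false ∷ [])) (marg 0F) dense (each₁ refl refl)
      where
      core : ∀ x z → x + 0 ≡ b → 11 * b ≤ 4 * (x + z) → (∀ τ → tab₁ x z τ ≡ m τ) → Ext (λ τ → 4 * m τ) (4 * b)
      core x z refl le same-m = ext-mono (λ τ → ℕₚ.≤-trans (fit τ) (≡⇒≤ (cong (4 *_) (same-m τ))))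
        (≡⇒≤ (solve 1 (λ x → con 4 :* (x :+ con 0) := x :* con 4) refl x)) (ext-* x same)
        where
        fit : ∀ τ → x * tab₁ 4 7 τ ≤ 4 * tab₁ x z τ
        fit = each₁ (≡⇒≤ (ℕₚ.*-comm x 4)) (cancel-≤ (4 * x) {x * 7} {4 * z} (solve 1 (λ x → con 11 :* (x :+ con 0) := con 4 :* x :+ x :* con 7) refl x) (solve 2 (λ x z → con 4 :* (x :+ z) := con 4 :* x :+ con 4 :* z) refl x z) le)

  module _ (t : Template 2) where
    open Template t

    -- Equal marginals force the two mixed types to have equal counts. What remains is a combination
    -- of identical and disjoint terminal sets, and the total supplies the 7 and 3 colours avoiding
    -- both terminals that these rays require.
    extendable₂ : Ext (tab₂ 4 0 0 7) 4 → Ext (tab₂ 0 4 4 3) 4 → Extendable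
    extendable₂ same different m b _ marg dense = 4 , s≤s z≤n ,
      core (m (true ∷ true ∷ [])) (m (true ∷ false ∷ [])) (m (false ∷ true ∷ [])) (m (false ∷ false ∷ []))
        (marg 0F) (marg 1F) dense (each₂ refl refl refl refl)
      where
      core : ∀ x y y′ z → x + y + (0 + 0) ≡ b → x + 0 + (y′ + 0) ≡ b → 11 * b ≤ 4 * (x + y + (y′ + z)) →
        (∀ τ → tab₂ x y y′ z τ ≡ m τ) → Ext (λ τ → 4 * m τ) (4 * b)
      core x y y′ z refl eq le same-m with ℕₚ.+-cancelˡ-≡ x y y′ (trans (sym (ℕₚ.+-identityʳ _)) (trans (sym eq) (solve 2 (λ x y′ → x :+ con 0 :+ (y′ :+ con 0) := x :+ y′) refl x y′)))
      ... | refl = ext-mono (λ τ → ℕₚ.≤-trans (fit τ) (≡⇒≤ (cong (4 *_) (same-m τ)))) (≡⇒≤ (solve 2 (λ x y → con 4 :* (x :+ y :+ (con 0 :+ con 0)) := x :* con 4 :+ y :* con 4) refl x y))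
          (ext-+ (ext-* x same) (ext-* y different))
        where
        fit : ∀ τ → x * tab₂ 4 0 0 7 τ + y * tab₂ 0 4 4 3 τ ≤ 4 * tab₂ x y y z τ
        fit = each₂ (≡⇒≤ (solve 2 (λ x y → x :* con 4 :+ y :* con 0 := con 4 :* x) refl x y)) (≡⇒≤ (solve 2 (λ x y → x :* con 0 :+ y :* con 4 := con 4 :* y) refl x y)) (≡⇒≤ (solve 2 (λ x y → x :* con 0 :+ y :* con 4 := con 4 :* y) refl x y))
          (cancel-≤ (4 * x + 8 * y) {x * 7 + y * 3} {4 * z} (solve 2 (λ x y → con 11 :* (x :+ y :+ (con 0 :+ con 0)) := con 4 :* x :+ con 8 :* y :+ (x :* con 7 :+ y :* con 3)) refl x y) (solve 3 (λ x y z → con 4 :* (x :+ y :+ (y :+ z)) := con 4 :* x :+ con 8 :* y :+ con 4 :* z) refl x y z) le)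

  -- The extreme rays of the cone of type counts with equal marginals b and total at least 11b/4; the tight ones mix a ray with disjoint,
  -- whose total 3b leaves room, up to total 11b/4 without colours that avoid all three terminals.
  record Rays (t : Template 3) : Set where
    open Template t
    field
      all-same   : Ext (tab₃ 4 0 0 0 0 0 0 7) 4
      same-12    : Ext (tab₃ 0 0 0 4 4 0 0 3) 4
      same-02    : Ext (tab₃ 0 0 4 0 0 4 0 3) 4
      same-01    : Ext (tab₃ 0 4 0 0 0 0 4 3) 4
      half       : Ext (tab₃ 0 2 2 0 2 0 0 5) 4
      disjoint   : Ext (tab₃ 0 0 0 4 0 4 4 0) 4
      tight-all  : Ext (tab₃ 1 0 0 7 0 7 7 0) 8
      tight-12   : Ext (tab₃ 0 0 0 4 1 3 3 0) 4
      tight-02   : Ext (tab₃ 0 0 1 3 0 4 3 0) 4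
      tight-01   : Ext (tab₃ 0 1 0 3 0 3 4 0) 4

  module _ (t : Template 3) (rays : Rays t) where
    open Template t
    open Rays rays

    -- Here each pair of terminals outweighs the opposite single terminal, by the same excess `e`.
    -- The balanced parts use the rays with two equal terminals, and the excess is `2 * e` copies of
    -- `half`.
    overlapping : ∀ p x y z e w → 11 * (p + x + y + z + 2 * e) ≤ 4 * (p + 2 * (x + y + z) + 3 * e + w) → Ext (λ τ → 4 * tab₃ p (z + e) (y + e) x (x + e) y z w τ) (4 * (p + x + y + z + 2 * e))
    overlapping p x y z e w le = ext-mono
      (each₃
        (≡⇒≤ (solve 5 (λ p x y z e → p :* con 4 :+ x :* con 0 :+ y :* con 0 :+ z :* con 0 :+ (con 2 :* e) :* con 0 := con 4 :* p) refl p x y z e))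
        (≡⇒≤ (solve 5 (λ p x y z e → p :* con 0 :+ x :* con 0 :+ y :* con 0 :+ z :* con 4 :+ (con 2 :* e) :* con 2 := con 4 :* (z :+ e)) refl p x y z e))
        (≡⇒≤ (solve 5 (λ p x y z e → p :* con 0 :+ x :* con 0 :+ y :* con 4 :+ z :* con 0 :+ (con 2 :* e) :* con 2 := con 4 :* (y :+ e)) refl p x y z e))
        (≡⇒≤ (solve 5 (λ p x y z e → p :* con 0 :+ x :* con 4 :+ y :* con 0 :+ z :* con 0 :+ (con 2 :* e) :* con 0 := con 4 :* x) refl p x y z e))
        (≡⇒≤ (solve 5 (λ p x y z e → p :* con 0 :+ x :* con 4 :+ y :* con 0 :+ z :* con 0 :+ (con 2 :* e) :* con 2 := con 4 :* (x :+ e)) refl p x y z e))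
        (≡⇒≤ (solve 5 (λ p x y z e → p :* con 0 :+ x :* con 0 :+ y :* con 4 :+ z :* con 0 :+ (con 2 :* e) :* con 0 := con 4 :* y) refl p x y z e))
        (≡⇒≤ (solve 5 (λ p x y z e → p :* con 0 :+ x :* con 0 :+ y :* con 0 :+ z :* con 4 :+ (con 2 :* e) :* con 0 := con 4 :* z) refl p x y z e))
        (cancel-≤ (4 * p + 8 * (x + y + z) + 12 * e) {p * 7 + x * 3 + y * 3 + z * 3 + (2 * e) * 5} {4 * w} (solve 5 (λ p x y z e → con 11 :* (p :+ x :+ y :+ z :+ con 2 :* e) := con 4 :* p :+ con 8 :* (x :+ y :+ z) :+ con 12 :* e :+ (p :* con 7 :+ x :* con 3 :+ y :* con 3 :+ z :* con 3 :+ (con 2 :* e) :* con 5)) refl p x y z e)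
          (solve 6 (λ p x y z e w → con 4 :* (p :+ con 2 :* (x :+ y :+ z) :+ con 3 :* e :+ w) := con 4 :* p :+ con 8 :* (x :+ y :+ z) :+ con 12 :* e :+ con 4 :* w) refl p x y z e w) le))
      (≡⇒≤ (solve 5 (λ p x y z e → con 4 :* (p :+ x :+ y :+ z :+ con 2 :* e) := p :* con 4 :+ x :* con 4 :+ y :* con 4 :+ z :* con 4 :+ (con 2 :* e) :* con 4) refl p x y z e))
      (ext-+ (ext-+ (ext-+ (ext-+ (ext-* p all-same) (ext-* x same-12)) (ext-* y same-02)) (ext-* z same-01)) (ext-* (2 * e) half))

    -- Here single terminals outweigh the opposite pairs. An excess of 7 for each colour at all
    -- three terminals and 3 for each at exactly two makes the tight rays suffice, without any
    -- colour avoiding all terminals; the remaining excess `e` goes to `disjoint`.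
    spread : ∀ p x y z e w → Ext (λ τ → 4 * tab₃ p z y (x + (7 * p + 3 * (x + y + z) + e)) x (y + (7 * p + 3 * (x + y + z) + e)) (z + (7 * p + 3 * (x + y + z) + e)) w τ) (4 * (p + x + y + z + (7 * p + 3 * (x + y + z) + e)))
    spread p x y z e w = ext-mono
      (each₃
        (≡⇒≤ (solve 5 (λ p x y z e → (con 4 :* p) :* con 1 :+ (con 4 :* x) :* con 0 :+ (con 4 :* y) :* con 0 :+ (con 4 :* z) :* con 0 :+ e :* con 0 := con 4 :* p) refl p x y z e))
        (≡⇒≤ (solve 5 (λ p x y z e → (con 4 :* p) :* con 0 :+ (con 4 :* x) :* con 0 :+ (con 4 :* y) :* con 0 :+ (con 4 :* z) :* con 1 :+ e :* con 0 := con 4 :* z) refl p x y z e))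
        (≡⇒≤ (solve 5 (λ p x y z e → (con 4 :* p) :* con 0 :+ (con 4 :* x) :* con 0 :+ (con 4 :* y) :* con 1 :+ (con 4 :* z) :* con 0 :+ e :* con 0 := con 4 :* y) refl p x y z e))
        (≡⇒≤ (solve 5 (λ p x y z e → (con 4 :* p) :* con 7 :+ (con 4 :* x) :* con 4 :+ (con 4 :* y) :* con 3 :+ (con 4 :* z) :* con 3 :+ e :* con 4 := con 4 :* (x :+ (con 7 :* p :+ con 3 :* (x :+ y :+ z) :+ e))) refl p x y z e))
        (≡⇒≤ (solve 5 (λ p x y z e → (con 4 :* p) :* con 0 :+ (con 4 :* x) :* con 1 :+ (con 4 :* y) :* con 0 :+ (con 4 :* z) :* con 0 :+ e :* con 0 := con 4 :* x) refl p x y z e))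
        (≡⇒≤ (solve 5 (λ p x y z e → (con 4 :* p) :* con 7 :+ (con 4 :* x) :* con 3 :+ (con 4 :* y) :* con 4 :+ (con 4 :* z) :* con 3 :+ e :* con 4 := con 4 :* (y :+ (con 7 :* p :+ con 3 :* (x :+ y :+ z) :+ e))) refl p x y z e))
        (≡⇒≤ (solve 5 (λ p x y z e → (con 4 :* p) :* con 7 :+ (con 4 :* x) :* con 3 :+ (con 4 :* y) :* con 3 :+ (con 4 :* z) :* con 4 :+ e :* con 4 := con 4 :* (z :+ (con 7 :* p :+ con 3 :* (x :+ y :+ z) :+ e))) refl p x y z e))
        (≤-trans (≡⇒≤ (solve 5 (λ p x y z e → (con 4 :* p) :* con 0 :+ (con 4 :* x) :* con 0 :+ (con 4 :* y) :* con 0 :+ (con 4 :* z) :* con 0 :+ e :* con 0 := con 0) refl p x y z e)) z≤n))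
      (≡⇒≤ (solve 5 (λ p x y z e → con 4 :* (p :+ x :+ y :+ z :+ (con 7 :* p :+ con 3 :* (x :+ y :+ z) :+ e)) := (con 4 :* p) :* con 8 :+ (con 4 :* x) :* con 4 :+ (con 4 :* y) :* con 4 :+ (con 4 :* z) :* con 4 :+ e :* con 4) refl p x y z e))
      (ext-+ (ext-+ (ext-+ (ext-+ (ext-* (4 * p) tight-all) (ext-* (4 * x) tight-12)) (ext-* (4 * y) tight-02)) (ext-* (4 * z) tight-01)) (ext-* e disjoint))

    -- The excess `d` falls short by `e` of what the tight rays alone would need. Giving tight and
    -- plain rays the weights `d` and `e` uses it up exactly; the plain rays then need `e * (d + e)`
    -- colours avoiding all terminals, and `e ≤ 4 * w` provides them.
    mixed : ∀ p x y z d e w → 7 * p + 3 * (x + y + z) ≡ d + e → e ≤ 4 * w →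
      Ext (λ τ → 4 * (d + e) * tab₃ p z y (x + d) x (y + d) (z + d) w τ) (4 * (d + e) * (p + x + y + z + d))
    mixed p x y z d e w eq le = ext-mono
      (each₃
        (≡⇒≤ (solve 6 (λ p x y z d e → (con 4 :* d :* p) :* con 1 :+ (con 4 :* d :* x) :* con 0 :+ (con 4 :* d :* y) :* con 0 :+ (con 4 :* d :* z) :* con 0 :+ (e :* p) :* con 4 :+ (e :* x) :* con 0 :+ (e :* y) :* con 0 :+ (e :* z) :* con 0 := con 4 :* (d :+ e) :* p) refl p x y z d e))
        (≡⇒≤ (solve 6 (λ p x y z d e → (con 4 :* d :* p) :* con 0 :+ (con 4 :* d :* x) :* con 0 :+ (con 4 :* d :* y) :* con 0 :+ (con 4 :* d :* z) :* con 1 :+ (e :* p) :* con 0 :+ (e :* x) :* con 0 :+ (e :* y) :* con 0 :+ (e :* z) :* con 4 := con 4 :* (d :+ e) :* z) refl p x y z d e))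
        (≡⇒≤ (solve 6 (λ p x y z d e → (con 4 :* d :* p) :* con 0 :+ (con 4 :* d :* x) :* con 0 :+ (con 4 :* d :* y) :* con 1 :+ (con 4 :* d :* z) :* con 0 :+ (e :* p) :* con 0 :+ (e :* x) :* con 0 :+ (e :* y) :* con 4 :+ (e :* z) :* con 0 := con 4 :* (d :+ e) :* y) refl p x y z d e))
        (≡⇒≤ (trans (solve 6 (λ p x y z d e → (con 4 :* d :* p) :* con 7 :+ (con 4 :* d :* x) :* con 4 :+ (con 4 :* d :* y) :* con 3 :+ (con 4 :* d :* z) :* con 3 :+ (e :* p) :* con 0 :+ (e :* x) :* con 4 :+ (e :* y) :* con 0 :+ (e :* z) :* con 0 := con 4 :* (d :* (con 7 :* p :+ con 3 :* (x :+ y :+ z))) :+ con 4 :* (d :+ e) :* x) refl p x y z d e)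
          (trans (cong (λ s → 4 * (d * s) + 4 * (d + e) * x) eq) (solve 3 (λ x d e → con 4 :* (d :* (d :+ e)) :+ con 4 :* (d :+ e) :* x := con 4 :* (d :+ e) :* (x :+ d)) refl x d e))))
        (≡⇒≤ (solve 6 (λ p x y z d e → (con 4 :* d :* p) :* con 0 :+ (con 4 :* d :* x) :* con 1 :+ (con 4 :* d :* y) :* con 0 :+ (con 4 :* d :* z) :* con 0 :+ (e :* p) :* con 0 :+ (e :* x) :* con 4 :+ (e :* y) :* con 0 :+ (e :* z) :* con 0 := con 4 :* (d :+ e) :* x) refl p x y z d e))
        (≡⇒≤ (trans (solve 6 (λ p x y z d e → (con 4 :* d :* p) :* con 7 :+ (con 4 :* d :* x) :* con 3 :+ (con 4 :* d :* y) :* con 4 :+ (con 4 :* d :* z) :* con 3 :+ (e :* p) :* con 0 :+ (e :* x) :* con 0 :+ (e :* y) :* con 4 :+ (e :* z) :* con 0 := con 4 :* (d :* (con 7 :* p :+ con 3 :* (x :+ y :+ z))) :+ con 4 :* (d :+ e) :* y) refl p x y z d e)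
          (trans (cong (λ s → 4 * (d * s) + 4 * (d + e) * y) eq) (solve 3 (λ y d e → con 4 :* (d :* (d :+ e)) :+ con 4 :* (d :+ e) :* y := con 4 :* (d :+ e) :* (y :+ d)) refl y d e))))
        (≡⇒≤ (trans (solve 6 (λ p x y z d e → (con 4 :* d :* p) :* con 7 :+ (con 4 :* d :* x) :* con 3 :+ (con 4 :* d :* y) :* con 3 :+ (con 4 :* d :* z) :* con 4 :+ (e :* p) :* con 0 :+ (e :* x) :* con 0 :+ (e :* y) :* con 0 :+ (e :* z) :* con 4 := con 4 :* (d :* (con 7 :* p :+ con 3 :* (x :+ y :+ z))) :+ con 4 :* (d :+ e) :* z) refl p x y z d e)
          (trans (cong (λ s → 4 * (d * s) + 4 * (d + e) * z) eq) (solve 3 (λ z d e → con 4 :* (d :* (d :+ e)) :+ con 4 :* (d :+ e) :* z := con 4 :* (d :+ e) :* (z :+ d)) refl z d e))))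
        (≤-trans (≡⇒≤ (trans (solve 6 (λ p x y z d e → (con 4 :* d :* p) :* con 0 :+ (con 4 :* d :* x) :* con 0 :+ (con 4 :* d :* y) :* con 0 :+ (con 4 :* d :* z) :* con 0 :+ (e :* p) :* con 7 :+ (e :* x) :* con 3 :+ (e :* y) :* con 3 :+ (e :* z) :* con 3 := e :* (con 7 :* p :+ con 3 :* (x :+ y :+ z))) refl p x y z d e) (cong (e *_) eq)))
          (≤-trans (*-monoˡ-≤ (d + e) le) (≡⇒≤ (solve 3 (λ w d e → con 4 :* w :* (d :+ e) := con 4 :* (d :+ e) :* w) refl w d e)))))
      (≡⇒≤ (trans (solve 6 (λ p x y z d e → con 4 :* (d :+ e) :* (p :+ x :+ y :+ z :+ d) := con 4 :* (d :+ e) :* (p :+ x :+ y :+ z) :+ con 4 :* (d :* (d :+ e))) refl p x y z d e)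
        (trans (cong (λ s → 4 * (d + e) * (p + x + y + z) + 4 * (d * s)) (sym eq)) (solve 6 (λ p x y z d e → con 4 :* (d :+ e) :* (p :+ x :+ y :+ z) :+ con 4 :* (d :* (con 7 :* p :+ con 3 :* (x :+ y :+ z))) := (con 4 :* d :* p) :* con 8 :+ (con 4 :* d :* x) :* con 4 :+ (con 4 :* d :* y) :* con 4 :+ (con 4 :* d :* z) :* con 4 :+ (e :* p) :* con 4 :+ (e :* x) :* con 4 :+ (e :* y) :* con 4 :+ (e :* z) :* con 4) refl p x y z d e))))
      (ext-+ (ext-+ (ext-+ (ext-+ (ext-+ (ext-+ (ext-+ (ext-* (4 * d * p) tight-all) (ext-* (4 * d * x) tight-12)) (ext-* (4 * d * y) tight-02)) (ext-* (4 * d * z) tight-01)) (ext-* (e * p) all-same)) (ext-* (e * x) same-12)) (ext-* (e * y) same-02)) (ext-* (e * z) same-01))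

    extendable₃ : Extendable
    extendable₃ m b b>0 marg dense = finish (split (m (τ true true true)) (m (τ true true false)) (m (τ true false true)) (m (τ true false false))
      (m (τ false true true)) (m (τ false true false)) (m (τ false false true)) (m (τ false false false))
      (marg 0F) (marg 1F) (marg 2F) dense)
      where
      τ : Bool → Bool → Bool → Type 3
      τ x y z = x ∷ y ∷ z ∷ []
      Goal : (Type 3 → ℕ) → Set
      Goal m = ∃ λ c → 1 ≤ c × Ext (λ τ → c * m τ) (c * b)
      finish : Goal (tab₃ (m (τ true true true)) (m (τ true true false)) (m (τ true false true)) (m (τ true false false))
        (m (τ false true true)) (m (τ false true false)) (m (τ false false true)) (m (τ false false false))) → Goal m
      finish (c , c>0 , e) = c , c>0 , ext-mono (each₃ ℕₚ.≤-refl ℕₚ.≤-refl ℕₚ.≤-refl ℕₚ.≤-refl ℕₚ.≤-refl ℕₚ.≤-refl ℕₚ.≤-refl ℕₚ.≤-refl) ℕₚ.≤-refl e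
      split : ∀ p ga be x al y z w →
        p + ga + (be + x) + (0 + 0 + (0 + 0)) ≡ b → p + ga + (0 + 0) + (al + y + (0 + 0)) ≡ b → p + 0 + (be + 0) + (al + 0 + (z + 0)) ≡ b →
        11 * b ≤ 4 * (p + ga + (be + x) + (al + y + (z + w))) → Goal (tab₃ p ga be x al y z w)
      -- Comparing marginals gives al - x = be - y = ga - z, so the sign of one difference decides
      -- the case for all three.
      split p ga be x al y z w e₀ e₁ e₂ le with ℕₚ.≤-total al x
      ... | inj₂ x≤al with ℕₚ.m≤n⇒∃[o]m+o≡n x≤al
      ...   | e , refl with ℕₚ.+-cancelˡ-≡ (p + ga + x) be (y + e) (trans (solve 4 (λ p ga be x → p :+ ga :+ x :+ be := p :+ ga :+ (be :+ x) :+ (con 0 :+ con 0 :+ (con 0 :+ con 0))) refl p ga be x) (trans (trans e₀ (sym e₁)) (solve 5 (λ p ga x e y → p :+ ga :+ (con 0 :+ con 0) :+ (x :+ e :+ y :+ (con 0 :+ con 0)) := p :+ ga :+ x :+ (y :+ e)) refl p ga x e y))) | ℕₚ.+-cancelˡ-≡ (p + be + x) ga (z + e) (trans (solve 4 (λ p ga be x → p :+ be :+ x :+ ga := p :+ ga :+ (be :+ x) :+ (con 0 :+ con 0 :+ (con 0 :+ con 0))) refl p ga be x) (trans (trans e₀ (sym e₂)) (solve 5 (λ p be x e z → p :+ con 0 :+ (be :+ con 0) :+ (x :+ e :+ con 0 :+ (z :+ con 0)) := p :+ be :+ x :+ (z :+ e)) refl p be x e z)))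
      ...     | refl | refl = 4 , s≤s z≤n , ext-mono (λ _ → ℕₚ.≤-refl) (≡⇒≤ (cong (4 *_) (trans (sym e₀) (solve 5 (λ p x y z e → p :+ (z :+ e) :+ (y :+ e :+ x) :+ (con 0 :+ con 0 :+ (con 0 :+ con 0)) := p :+ x :+ y :+ z :+ con 2 :* e) refl p x y z e))))
        (overlapping p x y z e w (subst₂ _≤_ (cong (11 *_) (trans (sym e₀) (solve 5 (λ p x y z e → p :+ (z :+ e) :+ (y :+ e :+ x) :+ (con 0 :+ con 0 :+ (con 0 :+ con 0)) := p :+ x :+ y :+ z :+ con 2 :* e) refl p x y z e))) (solve 6 (λ p x y z e w → con 4 :* (p :+ (z :+ e) :+ (y :+ e :+ x) :+ (x :+ e :+ y :+ (z :+ w))) := con 4 :* (p :+ con 2 :* (x :+ y :+ z) :+ con 3 :* e :+ w)) refl p x y z e w) le))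
      split p ga be x al y z w e₀ e₁ e₂ le | inj₁ al≤x with ℕₚ.m≤n⇒∃[o]m+o≡n al≤x
      ...   | d , refl with ℕₚ.+-cancelˡ-≡ (p + ga + al) y (be + d) (trans (solve 4 (λ p ga al y → p :+ ga :+ al :+ y := p :+ ga :+ (con 0 :+ con 0) :+ (al :+ y :+ (con 0 :+ con 0))) refl p ga al y) (trans (trans e₁ (sym e₀)) (solve 5 (λ p ga be al d → p :+ ga :+ (be :+ (al :+ d)) :+ (con 0 :+ con 0 :+ (con 0 :+ con 0)) := p :+ ga :+ al :+ (be :+ d)) refl p ga be al d))) | ℕₚ.+-cancelˡ-≡ (p + be + al) z (ga + d) (trans (solve 4 (λ p be al z → p :+ be :+ al :+ z := p :+ con 0 :+ (be :+ con 0) :+ (al :+ con 0 :+ (z :+ con 0))) refl p be al z) (trans (trans e₂ (sym e₀)) (solve 5 (λ p ga be al d → p :+ ga :+ (be :+ (al :+ d)) :+ (con 0 :+ con 0 :+ (con 0 :+ con 0)) := p :+ be :+ al :+ (ga :+ d)) refl p ga be al d)))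
      ...     | refl | refl with ℕₚ.<-≤-connex d (7 * p + 3 * (al + be + ga))
      ...       | inj₂ m≤d with ℕₚ.m≤n⇒∃[o]m+o≡n m≤d
      ...         | e , refl = 4 , s≤s z≤n , ext-mono (λ _ → ℕₚ.≤-refl) (≡⇒≤ (cong (4 *_) (trans (sym e₀) (solve 5 (λ p al be ga e → p :+ ga :+ (be :+ (al :+ (con 7 :* p :+ con 3 :* (al :+ be :+ ga) :+ e))) :+ (con 0 :+ con 0 :+ (con 0 :+ con 0)) := p :+ al :+ be :+ ga :+ (con 7 :* p :+ con 3 :* (al :+ be :+ ga) :+ e)) refl p al be ga e))))
        (spread p al be ga e w)
      split p ga be x al y z w e₀ e₁ e₂ le | inj₁ al≤x | d , refl | refl | refl | inj₁ d<m with ℕₚ.m≤n⇒∃[o]m+o≡n (ℕₚ.<⇒≤ d<m)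
      ...         | e , eq = 4 * (d + e) , ≤-trans d+e>0 (ℕₚ.m≤n*m (d + e) 4) ,
        ext-mono (λ _ → ℕₚ.≤-refl) (≡⇒≤ (cong (4 * (d + e) *_) (trans (sym e₀) (solve 5 (λ p al be ga d → p :+ ga :+ (be :+ (al :+ d)) :+ (con 0 :+ con 0 :+ (con 0 :+ con 0)) := p :+ al :+ be :+ ga :+ d) refl p al be ga d))))
          (mixed p al be ga d e w (sym eq) (cancel-≤ (4 * p + 8 * (al + be + ga) + 12 * d) {e} {4 * w}
            (trans (solve 5 (λ p al be ga d → con 11 :* (p :+ ga :+ (be :+ (al :+ d)) :+ (con 0 :+ con 0 :+ (con 0 :+ con 0))) := con 4 :* p :+ con 8 :* (al :+ be :+ ga) :+ con 11 :* d :+ (con 7 :* p :+ con 3 :* (al :+ be :+ ga))) refl p al be ga d) (trans (cong (4 * p + 8 * (al + be + ga) + 11 * d +_) (sym eq)) (solve 6 (λ p al be ga d e → con 4 :* p :+ con 8 :* (al :+ be :+ ga) :+ con 11 :* d :+ (d :+ e) := con 4 :* p :+ con 8 :* (al :+ be :+ ga) :+ con 12 :* d :+ e) refl p al be ga d e)))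
            (solve 6 (λ p al be ga d w → con 4 :* (p :+ ga :+ (be :+ (al :+ d)) :+ (al :+ (be :+ d) :+ (ga :+ d :+ w))) := con 4 :* p :+ con 8 :* (al :+ be :+ ga) :+ con 12 :* d :+ con 4 :* w) refl p al be ga d w) (subst (λ s → 11 * s ≤ 4 * (p + ga + (be + (al + d)) + (al + (be + d) + (ga + d + w)))) (sym e₀) le)))
        where
        d+e>0 : 1 ≤ d + e
        d+e>0 = subst (1 ≤_) (sym eq) (≤-trans (s≤s z≤n) d<m)

open Decomposition

-- The reducible configurations and their certificates

-- The vertices of a template are listed as u, its neighbours x, y, z (no z in template-xyxy), the path w₁ w₂ …, and,
-- if it is removed as well, the vertex w₀ closing the cycle.  The name lists the neighbours of u attached to w₁, w₂, ….
module Reducible where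
  open Template using (check-sound; Extendable)

  template-xyxy : Template 2
  template-xyxy = record { r = 7 ; terminal = Vec.lookup (just (# 1) ∷ nothing ∷ nothing ∷ just (# 0) ∷ nothing ∷ nothing ∷ just (# 0) ∷ [])
    ; edges = (# 3 , # 4) ∷ (# 4 , # 5) ∷ (# 5 , # 6) ∷ (# 0 , # 1) ∷ (# 0 , # 2) ∷ (# 3 , # 1) ∷ (# 4 , # 2) ∷ (# 5 , # 1) ∷ (# 6 , # 2) ∷ [] }

  -- The certificates are bit masks over the positions in the template: 18 is the set of positions 1
  -- and 4, that is of x and w₂. Since `check` evaluates to `true`, `refl` verifies them.
  extendable-xyxy : Extendable template-xyxy
  extendable-xyxy = extendable₂ template-xyxy
    (check-sound template-xyxy _ 4 (tab₂ (18 ∷ 18 ∷ 36 ∷ 36 ∷ []) [] [] (81 ∷ 44 ∷ 6 ∷ 41 ∷ 82 ∷ 73 ∷ 73 ∷ [])) refl)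
    (check-sound template-xyxy _ 4 (tab₂ [] (6 ∷ 6 ∷ 33 ∷ 17 ∷ []) (44 ∷ 44 ∷ 82 ∷ 72 ∷ []) (82 ∷ 41 ∷ 81 ∷ [])) refl)

  template-xyxz : Template 3
  template-xyxz = record { r = 9 ; terminal = Vec.lookup (nothing ∷ nothing ∷ just (# 1) ∷ just (# 2) ∷ nothing ∷ nothing ∷ nothing ∷ nothing ∷ just (# 0) ∷ [])
    ; edges = (# 4 , # 5) ∷ (# 5 , # 6) ∷ (# 6 , # 7) ∷ (# 8 , # 4) ∷ (# 8 , # 7) ∷ (# 0 , # 1) ∷ (# 0 , # 2) ∷ (# 0 , # 3) ∷ (# 4 , # 1) ∷ (# 5 , # 2) ∷ (# 6 , # 1) ∷ (# 7 , # 3) ∷ [] }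

  rays-xyxz : Rays template-xyxz
  rays-xyxz = record
    { all-same = ray _ 4 (tab₃ (145 ∷ 161 ∷ 162 ∷ 162 ∷ []) [] [] [] [] [] [] (321 ∷ 321 ∷ 92 ∷ 92 ∷ 92 ∷ 270 ∷ 298 ∷ [])) refl
    ; same-12 = ray _ 4 (tab₃ [] [] [] (161 ∷ 161 ∷ 92 ∷ 92 ∷ []) (162 ∷ 290 ∷ 290 ∷ 321 ∷ []) [] [] (92 ∷ 145 ∷ 270 ∷ [])) refl
    ; same-02 = ray _ 4 (tab₃ [] [] (81 ∷ 148 ∷ 134 ∷ 84 ∷ []) [] [] (161 ∷ 161 ∷ 81 ∷ 328 ∷ []) [] (270 ∷ 298 ∷ 298 ∷ [])) refl
    ; same-01 = ray _ 4 (tab₃ [] (145 ∷ 162 ∷ 162 ∷ 42 ∷ []) [] [] [] [] (148 ∷ 289 ∷ 81 ∷ 81 ∷ []) (332 ∷ 332 ∷ 270 ∷ [])) refl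
    ; half = ray _ 4 (tab₃ [] (162 ∷ 161 ∷ []) (148 ∷ 148 ∷ []) [] (321 ∷ 321 ∷ []) [] [] (298 ∷ 298 ∷ 81 ∷ 92 ∷ 270 ∷ [])) refl
    ; disjoint = ray _ 4 (tab₃ [] [] [] (92 ∷ 92 ∷ 92 ∷ 92 ∷ []) [] (289 ∷ 289 ∷ 289 ∷ 289 ∷ []) (134 ∷ 134 ∷ 134 ∷ 134 ∷ []) []) refl
    ; tight-all = ray _ 8 (tab₃ (145 ∷ []) [] [] (92 ∷ 92 ∷ 148 ∷ 148 ∷ 148 ∷ 14 ∷ 14 ∷ []) [] (321 ∷ 162 ∷ 162 ∷ 298 ∷ 298 ∷ 298 ∷ 298 ∷ []) (161 ∷ 161 ∷ 81 ∷ 81 ∷ 324 ∷ 321 ∷ 321 ∷ []) []) refl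
    ; tight-12 = ray _ 4 (tab₃ [] [] [] (161 ∷ 14 ∷ 92 ∷ 92 ∷ []) (162 ∷ []) (298 ∷ 298 ∷ 321 ∷ []) (324 ∷ 145 ∷ 145 ∷ []) []) refl
    ; tight-02 = ray _ 4 (tab₃ [] [] (161 ∷ []) (161 ∷ 92 ∷ 92 ∷ []) [] (81 ∷ 145 ∷ 328 ∷ 298 ∷ []) (262 ∷ 262 ∷ 162 ∷ []) []) refl
    ; tight-01 = ray _ 4 (tab₃ [] (81 ∷ []) [] (161 ∷ 14 ∷ 92 ∷ []) [] (162 ∷ 298 ∷ 298 ∷ []) (324 ∷ 324 ∷ 145 ∷ 145 ∷ []) []) refl
    }
    where ray = check-sound template-xyxz

  extendable-xyxz : Extendable template-xyxz
  extendable-xyxz = extendable₃ template-xyxz rays-xyxz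

  -- The additional edge from w₀ to y joins two open vertices of `template-xyxz`, which `inner`
  -- forbids there. With the edge included both become closed and only z keeps a terminal.
  template-xyxz-chord : Template 1
  template-xyxz-chord = record { r = 9 ; terminal = Vec.lookup (nothing ∷ nothing ∷ nothing ∷ just (# 0) ∷ nothing ∷ nothing ∷ nothing ∷ nothing ∷ nothing ∷ [])
    ; edges = (# 4 , # 5) ∷ (# 5 , # 6) ∷ (# 6 , # 7) ∷ (# 8 , # 4) ∷ (# 8 , # 7) ∷ (# 0 , # 1) ∷ (# 0 , # 2) ∷ (# 0 , # 3) ∷ (# 4 , # 1) ∷ (# 5 , # 2) ∷ (# 6 , # 1) ∷ (# 7 , # 3) ∷ (# 8 , # 2) ∷ [] }

  extendable-xyxz-chord : Extendable template-xyxz-chord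
  extendable-xyxz-chord = extendable₁ template-xyxz-chord
    (check-sound template-xyxz-chord _ 4 (tab₁ (289 ∷ 289 ∷ 162 ∷ 81 ∷ []) (328 ∷ 134 ∷ 134 ∷ 298 ∷ 92 ∷ 92 ∷ 145 ∷ [])) refl)

  template-xyzx : Template 3
  template-xyzx = record { r = 8 ; terminal = Vec.lookup (nothing ∷ nothing ∷ just (# 1) ∷ just (# 2) ∷ just (# 0) ∷ nothing ∷ nothing ∷ just (# 0) ∷ [])
    ; edges = (# 4 , # 5) ∷ (# 5 , # 6) ∷ (# 6 , # 7) ∷ (# 0 , # 1) ∷ (# 0 , # 2) ∷ (# 0 , # 3) ∷ (# 4 , # 1) ∷ (# 5 , # 2) ∷ (# 6 , # 3) ∷ (# 7 , # 1) ∷ [] }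

  rays-xyzx : Rays template-xyzx
  rays-xyzx = record
    { all-same = ray _ 4 (tab₃ (34 ∷ 34 ∷ 65 ∷ 65 ∷ []) [] [] [] [] [] [] (156 ∷ 156 ∷ 156 ∷ 42 ∷ 161 ∷ 81 ∷ 70 ∷ [])) refl
    ; same-12 = ray _ 4 (tab₃ [] [] [] (70 ∷ 70 ∷ 14 ∷ 33 ∷ []) (34 ∷ 81 ∷ 81 ∷ 145 ∷ []) [] [] (168 ∷ 168 ∷ 156 ∷ [])) refl
    ; same-02 = ray _ 4 (tab₃ [] [] (33 ∷ 70 ∷ 70 ∷ 70 ∷ []) [] [] (168 ∷ 168 ∷ 145 ∷ 42 ∷ []) [] (145 ∷ 81 ∷ 156 ∷ [])) refl
    ; same-01 = ray _ 4 (tab₃ [] (65 ∷ 66 ∷ 42 ∷ 42 ∷ []) [] [] [] [] (161 ∷ 161 ∷ 148 ∷ 70 ∷ []) (81 ∷ 156 ∷ 156 ∷ [])) refl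
    ; half = ray _ 4 (tab₃ [] (42 ∷ 42 ∷ []) (65 ∷ 70 ∷ []) [] (145 ∷ 145 ∷ []) [] [] (14 ∷ 161 ∷ 168 ∷ 84 ∷ 84 ∷ [])) refl
    ; disjoint = ray _ 4 (tab₃ [] [] [] (14 ∷ 14 ∷ 14 ∷ 14 ∷ []) [] (168 ∷ 168 ∷ 168 ∷ 168 ∷ []) (81 ∷ 81 ∷ 81 ∷ 81 ∷ []) []) refl
    ; tight-all = ray _ 8 (tab₃ (66 ∷ []) [] [] (42 ∷ 42 ∷ 42 ∷ 14 ∷ 14 ∷ 14 ∷ 65 ∷ []) [] (81 ∷ 81 ∷ 161 ∷ 161 ∷ 161 ∷ 168 ∷ 168 ∷ []) (145 ∷ 145 ∷ 148 ∷ 84 ∷ 84 ∷ 84 ∷ 70 ∷ []) []) refl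
    ; tight-12 = ray _ 4 (tab₃ [] [] [] (33 ∷ 14 ∷ 70 ∷ 70 ∷ []) (161 ∷ []) (152 ∷ 152 ∷ 42 ∷ []) (84 ∷ 81 ∷ 161 ∷ []) []) refl
    ; tight-02 = ray _ 4 (tab₃ [] [] (70 ∷ []) (65 ∷ 42 ∷ 14 ∷ []) [] (42 ∷ 81 ∷ 152 ∷ 161 ∷ []) (84 ∷ 161 ∷ 148 ∷ []) []) refl
    ; tight-01 = ray _ 4 (tab₃ [] (66 ∷ []) [] (42 ∷ 14 ∷ 14 ∷ []) [] (161 ∷ 161 ∷ 168 ∷ []) (148 ∷ 81 ∷ 81 ∷ 84 ∷ []) []) refl
    }
    where ray = check-sound template-xyzx

  extendable-xyzx : Extendable template-xyzx
  extendable-xyzx = extendable₃ template-xyzx rays-xyzx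

  template-xyxzyz : Template 1
  template-xyxzyz = record { r = 10 ; terminal = Vec.lookup (nothing ∷ nothing ∷ nothing ∷ nothing ∷ just (# 0) ∷ nothing ∷ nothing ∷ nothing ∷ nothing ∷ just (# 0) ∷ [])
    ; edges = (# 4 , # 5) ∷ (# 5 , # 6) ∷ (# 6 , # 7) ∷ (# 7 , # 8) ∷ (# 8 , # 9) ∷ (# 0 , # 1) ∷ (# 0 , # 2) ∷ (# 0 , # 3) ∷ (# 4 , # 1) ∷ (# 5 , # 2) ∷ (# 6 , # 1) ∷ (# 7 , # 3) ∷ (# 8 , # 2) ∷ (# 9 , # 3) ∷ [] }

  extendable-xyxzyz : Extendable template-xyxzyz
  extendable-xyxzyz = extendable₁ template-xyxzyz
    (check-sound template-xyxzyz _ 4 (tab₁ (298 ∷ 298 ∷ 298 ∷ 321 ∷ []) (92 ∷ 92 ∷ 92 ∷ 673 ∷ 673 ∷ 657 ∷ 646 ∷ [])) refl)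

  template-xyzxyz : Template 1
  template-xyzxyz = record { r = 10 ; terminal = Vec.lookup (nothing ∷ nothing ∷ nothing ∷ nothing ∷ just (# 0) ∷ nothing ∷ nothing ∷ nothing ∷ nothing ∷ just (# 0) ∷ [])
    ; edges = (# 4 , # 5) ∷ (# 5 , # 6) ∷ (# 6 , # 7) ∷ (# 7 , # 8) ∷ (# 8 , # 9) ∷ (# 0 , # 1) ∷ (# 0 , # 2) ∷ (# 0 , # 3) ∷ (# 4 , # 1) ∷ (# 5 , # 2) ∷ (# 6 , # 3) ∷ (# 7 , # 1) ∷ (# 8 , # 2) ∷ (# 9 , # 3) ∷ [] }

  extendable-xyzxyz : Extendable template-xyzxyz
  extendable-xyzxyz = extendable₁ template-xyzxyz
    (check-sound template-xyzxyz _ 4 (tab₁ (298 ∷ 298 ∷ 298 ∷ 70 ∷ []) (596 ∷ 596 ∷ 673 ∷ 673 ∷ 673 ∷ 156 ∷ 337 ∷ [])) refl)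

  template-xyzxzy : Template 1
  template-xyzxzy = record { r = 10 ; terminal = Vec.lookup (nothing ∷ nothing ∷ nothing ∷ nothing ∷ just (# 0) ∷ nothing ∷ nothing ∷ nothing ∷ nothing ∷ just (# 0) ∷ [])
    ; edges = (# 4 , # 5) ∷ (# 5 , # 6) ∷ (# 6 , # 7) ∷ (# 7 , # 8) ∷ (# 8 , # 9) ∷ (# 0 , # 1) ∷ (# 0 , # 2) ∷ (# 0 , # 3) ∷ (# 4 , # 1) ∷ (# 5 , # 2) ∷ (# 6 , # 3) ∷ (# 7 , # 1) ∷ (# 8 , # 3) ∷ (# 9 , # 2) ∷ [] }

  extendable-xyzxzy : Extendable template-xyzxzy
  extendable-xyzxzy = extendable₁ template-xyzxzy
    (check-sound template-xyzxzy _ 4 (tab₁ (14 ∷ 290 ∷ 168 ∷ 326 ∷ []) (664 ∷ 673 ∷ 673 ∷ 337 ∷ 593 ∷ 14 ∷ 340 ∷ [])) refl)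

  template-xyzyxz : Template 1
  template-xyzyxz = record { r = 10 ; terminal = Vec.lookup (nothing ∷ nothing ∷ nothing ∷ nothing ∷ just (# 0) ∷ nothing ∷ nothing ∷ nothing ∷ nothing ∷ just (# 0) ∷ [])
    ; edges = (# 4 , # 5) ∷ (# 5 , # 6) ∷ (# 6 , # 7) ∷ (# 7 , # 8) ∷ (# 8 , # 9) ∷ (# 0 , # 1) ∷ (# 0 , # 2) ∷ (# 0 , # 3) ∷ (# 4 , # 1) ∷ (# 5 , # 2) ∷ (# 6 , # 3) ∷ (# 7 , # 2) ∷ (# 8 , # 1) ∷ (# 9 , # 3) ∷ [] }

  extendable-xyzyxz : Extendable template-xyzyxz
  extendable-xyzyxz = extendable₁ template-xyzyxz
    (check-sound template-xyzyxz _ 4 (tab₁ (268 ∷ 268 ∷ 170 ∷ 289 ∷ []) (657 ∷ 170 ∷ 170 ∷ 593 ∷ 596 ∷ 582 ∷ 337 ∷ [])) refl)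

  template-xyzyzx : Template 1
  template-xyzyzx = record { r = 10 ; terminal = Vec.lookup (nothing ∷ nothing ∷ nothing ∷ nothing ∷ just (# 0) ∷ nothing ∷ nothing ∷ nothing ∷ nothing ∷ just (# 0) ∷ [])
    ; edges = (# 4 , # 5) ∷ (# 5 , # 6) ∷ (# 6 , # 7) ∷ (# 7 , # 8) ∷ (# 8 , # 9) ∷ (# 0 , # 1) ∷ (# 0 , # 2) ∷ (# 0 , # 3) ∷ (# 4 , # 1) ∷ (# 5 , # 2) ∷ (# 6 , # 3) ∷ (# 7 , # 2) ∷ (# 8 , # 3) ∷ (# 9 , # 1) ∷ [] }

  extendable-xyzyzx : Extendable template-xyzyzx
  extendable-xyzyzx = extendable₁ template-xyzyzx
    (check-sound template-xyzyzx _ 4 (tab₁ (170 ∷ 289 ∷ 289 ∷ 326 ∷ []) (673 ∷ 540 ∷ 664 ∷ 664 ∷ 326 ∷ 326 ∷ 593 ∷ [])) refl)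

-- Sizes of vertex sets

module Subsets where
  open Nat using (_≤_; _<_; z≤n; s≤s)

  bit-mono : ∀ {b c} → (b ≡ true → c ≡ true) → bit b ≤ bit c
  bit-mono {false} h = z≤n
  bit-mono {true}  h rewrite h refl = s≤s z≤n

  cnt-mono : ∀ {A : Set} {p q : A → Bool} xs → (∀ x → p x ≡ true → q x ≡ true) → cnt p xs ≤ cnt q xs
  cnt-mono []       h = z≤n
  cnt-mono (x ∷ xs) h = ℕₚ.+-mono-≤ (bit-mono (h x)) (cnt-mono xs h)

  cnt-strict : ∀ {A : Set} {p q : A → Bool} {xs y} → (∀ x → p x ≡ true → q x ≡ true) →
    y ∈ˡ xs → p y ≡ false → q y ≡ true → cnt p xs < cnt q xs
  cnt-strict {xs = x ∷ xs} h (here refl) py qy rewrite py | qy = s≤s (cnt-mono xs h)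
  cnt-strict {xs = x ∷ xs} h (there y∈)  py qy = ℕₚ.+-mono-≤-< (bit-mono (h x)) (cnt-strict h y∈ py qy)

  size : ∀ {n} → (Fin n → Bool) → ℕ
  size {n} S = cnt S (List.allFin n)

  size-strict : ∀ {n} {S T : Fin n → Bool} y → (∀ x → S x ≡ true → T x ≡ true) → S y ≡ false → T y ≡ true → size S < size T
  size-strict y h = cnt-strict h (∈ₚ.∈-allFin y)

open Subsets

-- The edge `u₀x₀` is disjoint from every cycle that forms a component avoiding `X`; together with
-- `connected` it rules out such a cycle.
record AdmissibleClass (G : Graph) : Set where
  field
    X          : Fin (n G) → Bool
    part       : Fin (n G) → Fin 3
    admissible : ∀ u v → X u ≡ true → X v ≡ true →
      (part u ≡ part v → ¬ InN G 1 u v × ¬ InN G 3 u v × ¬ InN G 5 u v)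
      × (part u ≢ part v → ¬ InN G 1 u v × ¬ InN G 2 u v × ¬ InN G 4 u v)
    u₀ x₀      : Fin (n G)
    Xu₀        : X u₀ ≡ true
    u₀x₀       : Edge G u₀ x₀

-- Precolouring and the list-colouring problem

module Colouring {G : Graph} (C : Critical G) (A : AdmissibleClass G) where
  open AdmissibleClass A
  open Critical C
  open Subgraphs C
  open Extension C using (no-four; edge-sym; edge-≢; unique-length)
  open Nat using (_+_; _≤_; _<_; z≤n; s≤s)
  import Data.List.Membership.DecPropositional as DecMembership
  open import Data.List.Relation.Binary.Permutation.Propositional using (_↭_; ↭-refl; ↭-sym; ↭-trans; ↭⇒↭ₛ)
  import Data.List.Relation.Binary.Permutation.Propositional.Properties as ↭ₚ
  import Data.List.Relation.Binary.Permutation.Setoid.Properties as ↭Setoid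
  module ↭ₛ = ↭Setoid (Relation.Binary.PropositionalEquality.setoid (Fin (n G)))

  private
    V : Set
    V = Fin (n G)
    variable
      u v w x y z : V
      i j α : Fin 3
      S T : V → Bool
      c : V → Fin 3

  open DecMembership {A = V} Fin._≟_ using () renaming (_∈?_ to _∈ˡ?_)

  edge? : ∀ u v → Dec (Edge G u v)
  edge? u v = adj G u v Boolₚ.≟ true

  path : ∀ {k} (p : Vec V (suc k)) → VecUnique.Unique p →
    (∀ (j : Fin k) → Edge G (Vec.lookup p (Fin.inject₁ j)) (Vec.lookup p (Fin.suc j))) →
    Path G k (Vec.lookup p Fin.zero) (Vec.lookup p (Fin.fromℕ k))
  path p uniq edges = p , refl , refl , edges , VecUniqueₚ.lookup-injective uniq

  ≢-by : (P : V → Bool) → P u ≡ true → P v ≡ false → u ≢ v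
  ≢-by P pu pv refl with () ← trans (sym pu) pv

  NX : Fin 3 → V → Set
  NX i x = ∃ λ u → X u ≡ true × part u ≡ i × Edge G u x

  NX? : ∀ i x → Dec (NX i x)
  NX? i x = Finₚ.any? λ u → (X u Boolₚ.≟ true) ×-dec (part u Fin.≟ i) ×-dec edge? u x

  W : V → Set
  W v = X v ≡ false × ∀ i → ¬ NX i v

  X-independent : X u ≡ true → X v ≡ true → ¬ Edge G u v
  X-independent {u} {v} Xu Xv e with part u Fin.≟ part v | admissible u v Xu Xv
  ... | yes eq | same , _ = same eq .proj₁ one
    where
    one : InN G 1 u v
    one = edge-≢ e ∘ sym , path (u ∷ v ∷ []) ((edge-≢ e ∷ᵃ []ᵃ) ∷ᵖ []ᵃ ∷ᵖ []ᵖ) λ { 0F → e }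
  ... | no neq | _ , diff = diff neq .proj₁ one
    where
    one : InN G 1 u v
    one = edge-≢ e ∘ sym , path (u ∷ v ∷ []) ((edge-≢ e ∷ᵃ []ᵃ) ∷ᵖ []ᵃ ∷ᵖ []ᵖ) λ { 0F → e }

  NX∉X : NX i x → X x ≡ false
  NX∉X {x = x} (u , Xu , _ , e) with X x in eq
  ... | false = refl
  ... | true  = ⊥-elim (X-independent Xu eq e)

  X≢NX : X u ≡ true → NX i x → u ≢ x
  X≢NX Xu nx = ≢-by X Xu (NX∉X nx)

  W≢NX : W w → NX i x → w ≢ x
  W≢NX (_ , ¬nx) nx refl = ¬nx _ nx

  X≢W : X u ≡ true → W w → u ≢ w
  X≢W Xu (Xw , _) = ≢-by X Xu Xw

  -- The next four lemmas use that there are no paths of length 2, 3, 4 and 5, respectively, between certain vertices of X.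
  NX-type : NX i x → NX j x → i ≡ j
  NX-type {x = x} nx@(u , Xu , refl , e) nx′@(v , Xv , refl , e′) with part u Fin.≟ part v
  ... | yes eq = eq
  ... | no neq = ⊥-elim (admissible u v Xu Xv .proj₂ neq .proj₂ .proj₁
    ( (λ { refl → neq refl })
    , path (u ∷ x ∷ v ∷ []) ((X≢NX Xu nx ∷ᵃ (λ { refl → neq refl }) ∷ᵃ []ᵃ) ∷ᵖ
        ((X≢NX Xv nx ∘ sym) ∷ᵃ []ᵃ) ∷ᵖ []ᵃ ∷ᵖ []ᵖ)
        λ { 0F → e ; 1F → edge-sym e′ } ))

  NX-independent : NX i x → NX i y → ¬ Edge G x y
  NX-independent {x = x} {y} nx@(u , Xu , refl , e) ny@(v , Xv , eq , e′) xy with u Fin.≟ v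
  ... | yes refl = triangle-free u x y (e , xy , e′)
  ... | no u≢v   = admissible u v Xu Xv .proj₁ (sym eq) .proj₂ .proj₁
    ( u≢v ∘ sym
    , path (u ∷ x ∷ y ∷ v ∷ []) ((X≢NX Xu nx ∷ᵃ X≢NX Xu ny ∷ᵃ u≢v ∷ᵃ []ᵃ) ∷ᵖ
        (edge-≢ xy ∷ᵃ (X≢NX Xv nx ∘ sym) ∷ᵃ []ᵃ) ∷ᵖ ((X≢NX Xv ny ∘ sym) ∷ᵃ []ᵃ) ∷ᵖ []ᵃ ∷ᵖ []ᵖ)
        λ { 0F → e ; 1F → xy ; 2F → edge-sym e′ } )

  one-type : W w → Edge G w x → NX i x → Edge G w y → NX j y → i ≡ j
  one-type {w = w} {x} {i} {y} {j} Ww wx nx@(u , Xu , refl , e) wy ny@(v , Xv , refl , e′) with part u Fin.≟ part v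
  ... | yes eq = eq
  ... | no neq = ⊥-elim (admissible u v Xu Xv .proj₂ neq .proj₂ .proj₂
    ( (λ { refl → neq refl })
    , path (u ∷ x ∷ w ∷ y ∷ v ∷ [])
        ((X≢NX Xu nx ∷ᵃ X≢W Xu Ww ∷ᵃ X≢NX Xu ny ∷ᵃ (λ { refl → neq refl }) ∷ᵃ []ᵃ) ∷ᵖ
         ((W≢NX Ww nx ∘ sym) ∷ᵃ (λ { refl → neq (NX-type nx ny) }) ∷ᵃ (X≢NX Xv nx ∘ sym) ∷ᵃ []ᵃ) ∷ᵖ
         (W≢NX Ww ny ∷ᵃ (X≢W Xv Ww ∘ sym) ∷ᵃ []ᵃ) ∷ᵖ ((X≢NX Xv ny ∘ sym) ∷ᵃ []ᵃ) ∷ᵖ []ᵃ ∷ᵖ []ᵖ)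
        λ { 0F → e ; 1F → edge-sym wx ; 2F → wy ; 3F → edge-sym e′ } ))

  same-centre : W w → W z → Edge G w z → X u ≡ true → X v ≡ true → part u ≡ part v →
    Edge G u x → Edge G w x → Edge G v y → Edge G z y → u ≡ v
  same-centre {w = w} {z} {u} {v} {x} {y} Ww Wz wz Xu Xv eq ux wx vy zy with u Fin.≟ v
  ... | yes p = p
  ... | no u≢v = ⊥-elim (admissible u v Xu Xv .proj₁ eq .proj₂ .proj₂
    ( u≢v ∘ sym
    , path (u ∷ x ∷ w ∷ z ∷ y ∷ v ∷ [])
        ((X≢NX Xu nx ∷ᵃ X≢W Xu Ww ∷ᵃ X≢W Xu Wz ∷ᵃ X≢NX Xu ny ∷ᵃ u≢v ∷ᵃ []ᵃ) ∷ᵖ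
         ((W≢NX Ww nx ∘ sym) ∷ᵃ (W≢NX Wz nx ∘ sym) ∷ᵃ x≢y ∷ᵃ (X≢NX Xv nx ∘ sym) ∷ᵃ []ᵃ) ∷ᵖ
         (edge-≢ wz ∷ᵃ W≢NX Ww ny ∷ᵃ (X≢W Xv Ww ∘ sym) ∷ᵃ []ᵃ) ∷ᵖ
         (W≢NX Wz ny ∷ᵃ (X≢W Xv Wz ∘ sym) ∷ᵃ []ᵃ) ∷ᵖ ((X≢NX Xv ny ∘ sym) ∷ᵃ []ᵃ) ∷ᵖ []ᵃ ∷ᵖ []ᵖ)
        λ { 0F → ux ; 1F → edge-sym wx ; 2F → wz
          ; 3F → zy ; 4F → edge-sym vy } ))
    where
    nx : NX (part u) x
    nx = u , Xu , refl , ux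
    ny : NX (part v) y
    ny = v , Xv , refl , vy
    x≢y : x ≢ y
    x≢y refl = triangle-free w z x (wz , zy , wx)

  Block : Fin 3 → V → Set
  Block i v = ∃ λ x → Edge G v x × NX i x

  Block? : ∀ i v → Dec (Block i v)
  Block? i v = Finₚ.any? λ x → edge? v x ×-dec NX? i x

  record Good (S : V → Bool) (c : V → Fin 3) : Set where
    constructor good
    field
      inside : ∀ v → S v ≡ true → W v
      listed : ∀ v → S v ≡ true → ¬ Block (c v) v
      proper : ∀ u v → S u ≡ true → S v ≡ true → Edge G u v → c u ≢ c v

  Colourable : (V → Bool) → Set
  Colourable S = ∃ λ c → Good S c

  good-⊆ : (∀ v → T v ≡ true → S v ≡ true) → Good S c → Good T c
  good-⊆ sub (good ins lis pro) = good (λ v → ins v ∘ sub v) (λ v → lis v ∘ sub v) (λ u v Tu Tv → pro u v (sub u Tu) (sub v Tv))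

  Avail : (V → Bool) → (V → Fin 3) → V → Fin 3 → Set
  Avail S c v α = ¬ Block α v × (∀ y → Edge G v y → S y ≡ true → c y ≢ α)

  Used : (V → Bool) → (V → Fin 3) → V → Fin 3 → Set
  Used S c v α = ∃ λ y → Edge G v y × S y ≡ true × c y ≡ α

  avail? : ∀ S c v α → Avail S c v α ⊎ (Block α v ⊎ (¬ Block α v × Used S c v α))
  avail? S c v α with Block? α v
  ... | yes b = inj₂ (inj₁ b)
  ... | no ¬b with Finₚ.any? (λ y → edge? v y ×-dec (S y Boolₚ.≟ true) ×-dec (c y Fin.≟ α))
  ...   | yes u = inj₂ (inj₂ (¬b , u))
  ...   | no ¬u = inj₁ (¬b , λ y e Sy eq → ¬u (y , e , Sy , eq))

  -- The three situations in which some neighbour costs `v` no colour of its own.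
  data Free (S : V → Bool) (c : V → Fin 3) (v : V) : Set where
    uncoloured : ∀ z → Edge G v z → W z → S z ≡ false → Free S c v
    repeated   : ∀ y z → y ≢ z → Edge G v y → Edge G v z → S y ≡ true → S z ≡ true → c y ≡ c z → Free S c v
    wasted     : ∀ y → Edge G v y → S y ≡ true → Block (c y) v → Free S c v

  -- A neighbour that is charged with the loss of colour `i`. A coloured neighbour is charged only
  -- if `i` is not already lost to the precolouring; this is what makes `wasted` contradictory when
  -- every neighbour is charged.
  Blocker : (V → Bool) → (V → Fin 3) → V → Fin 3 → V → Set
  Blocker S c v i y = Edge G v y × (NX i y ⊎ (¬ Block i v × S y ≡ true × c y ≡ i))

  blocker-injective : Good S c → Blocker S c v i y → Blocker S c v j y → i ≡ j
  blocker-injective g (_ , inj₁ nx) (_ , inj₁ ny) = NX-type nx ny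
  blocker-injective g (_ , inj₁ nx) (_ , inj₂ (_ , Sy , _)) = ⊥-elim (Good.inside g _ Sy .proj₂ _ nx)
  blocker-injective g (_ , inj₂ (_ , Sy , _)) (_ , inj₁ ny) = ⊥-elim (Good.inside g _ Sy .proj₂ _ ny)
  blocker-injective g (_ , inj₂ (_ , _ , ei)) (_ , inj₂ (_ , _ , ej)) = trans (sym ei) ej

  all-blocked : Good S c → (b : Fin 3 → V) → (∀ i → Blocker S c v i (b i)) → Edge G v y → ∃ λ i → y ≡ b i
  all-blocked {S} {c} {v} {y} g b blk e with y Fin.≟ b 0F | y Fin.≟ b 1F | y Fin.≟ b 2F
  ... | yes p | _ | _ = 0F , p
  ... | _ | yes p | _ = 1F , p
  ... | _ | _ | yes p = 2F , p
  ... | no p | no q | no r = ⊥-elim (no-four e (blk 0F .proj₁) (blk 1F .proj₁) (blk 2F .proj₁)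
    ((p ∷ q ∷ r ∷ []) ∷ (distinct 0F 1F (λ ()) ∷ distinct 0F 2F (λ ()) ∷ []) ∷ (distinct 1F 2F (λ ()) ∷ []) ∷ [] ∷ []))
    where
    distinct : ∀ i j → i ≢ j → b i ≢ b j
    distinct i j i≢j eq = i≢j (blocker-injective g (blk i) (subst (Blocker S c v j) (sym eq) (blk j)))

  avail-or-blocked : ∀ S c v → (∃ λ α → Avail S c v α) ⊎ (∀ i → ∃ λ y → Blocker S c v i y)
  avail-or-blocked S c v with avail? S c v 0F | avail? S c v 1F | avail? S c v 2F
  ... | inj₁ a | _ | _ = inj₁ (0F , a)
  ... | _ | inj₁ a | _ = inj₁ (1F , a)
  ... | _ | _ | inj₁ a = inj₁ (2F , a)
  ... | inj₂ p | inj₂ q | inj₂ r = inj₂ λ { 0F → blocker p ; 1F → blocker q ; 2F → blocker r }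
    where
    blocker : ∀ {i} → Block i v ⊎ (¬ Block i v × Used S c v i) → ∃ λ y → Blocker S c v i y
    blocker (inj₁ (x , e , nx)) = x , e , inj₁ nx
    blocker (inj₂ (¬b , y , e , Sy , eq)) = y , e , inj₂ (¬b , Sy , eq)

  -- If all three colours were lost, three distinct blockers would be charged, and by the degree
  -- bound there are no further neighbours. Each case of `Free` exhibits a neighbour that cannot
  -- carry a charge of its own.
  choose : Good S c → Free S c v → ∃ λ α → Avail S c v α
  choose {S} {c} {v} g free with avail-or-blocked S c v
  ... | inj₁ a = a
  ... | inj₂ bs = ⊥-elim (impossible free)
    where
    b : Fin 3 → V
    b i = bs i .proj₁
    known : ∀ {y} → Edge G v y → ∃ λ i → y ≡ b i
    known = all-blocked g b (λ i → bs i .proj₂)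
    coloured : ∀ {y i} → S y ≡ true → y ≡ b i → c y ≡ i × ¬ Block i v
    coloured {i = i} Sy refl with bs i .proj₂
    ... | _ , inj₁ nx             = ⊥-elim (Good.inside g _ Sy .proj₂ _ nx)
    ... | _ , inj₂ (¬b , _ , eq) = eq , ¬b
    impossible : Free S c v → ⊥
    impossible (uncoloured z e Wz Sz) with known e
    ... | i , refl with bs i .proj₂
    ...   | _ , inj₁ nx           = Wz .proj₂ _ nx
    ...   | _ , inj₂ (_ , Sb , _) with () ← trans (sym Sz) Sb
    impossible (repeated y z y≢z ey ez Sy Sz eq) with known ey | known ez
    ... | i , y≡ | j , z≡ with trans (sym (coloured Sy y≡ .proj₁)) (trans eq (coloured Sz z≡ .proj₁))
    ...   | refl = y≢z (trans y≡ (sym z≡))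
    impossible (wasted y e Sy blk) with known e
    ... | i , y≡ = let (eq , ¬b) = coloured Sy y≡ in ¬b (subst (λ z → Block z v) eq blk)

  add : (V → Bool) → V → V → Bool
  add S v x = does (x Fin.≟ v) ∨ S x

  paint : (V → Fin 3) → V → Fin 3 → V → Fin 3
  paint c v α x = if does (x Fin.≟ v) then α else c x

  add-self : ∀ S v → add S v v ≡ true
  add-self S v rewrite dec-true (v Fin.≟ v) refl = refl

  add-⊆ : ∀ S v x → S x ≡ true → add S v x ≡ true
  add-⊆ S v x eq rewrite eq = Boolₚ.∨-zeroʳ _

  add-other : ∀ S {v x} → x ≢ v → add S v x ≡ S x
  add-other S {v} {x} neq rewrite dec-false (x Fin.≟ v) neq = refl

  paint-self : ∀ c v α → paint c v α v ≡ α
  paint-self c v α rewrite dec-true (v Fin.≟ v) refl = refl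

  paint-other : ∀ c {v x} α → x ≢ v → paint c v α x ≡ c x
  paint-other c {v} {x} α neq rewrite dec-false (x Fin.≟ v) neq = refl

  colour : Good S c → W v → Avail S c v α → Good (add S v) (paint c v α)
  colour {S} {c} {v} {α} (good ins lis pro) Wv (¬blk , unused) = good ins′ lis′ pro′
    where
    ins′ : ∀ x → add S v x ≡ true → W x
    ins′ x h with x Fin.≟ v
    ... | yes refl = Wv
    ... | no _     = ins x h
    lis′ : ∀ x → add S v x ≡ true → ¬ Block (paint c v α x) x
    lis′ x h with x Fin.≟ v
    ... | yes refl = ¬blk
    ... | no _     = lis x h
    pro′ : ∀ x y → add S v x ≡ true → add S v y ≡ true → Edge G x y → paint c v α x ≢ paint c v α y
    pro′ x y hx hy e with x Fin.≟ v | y Fin.≟ v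
    ... | yes refl | yes refl = λ _ → edge-≢ e refl
    ... | yes refl | no _     = unused y e hy ∘ sym
    ... | no _     | yes refl = unused x (edge-sym e) hx
    ... | no _     | no _     = pro x y hx hy e

  -- Paths and cycles, and greedy colouring along them

  Chain : V → List V → Set
  Chain v []       = Data.Unit.⊤
  Chain v (w ∷ ws) = Edge G v w × Chain w ws

  last : V → List V → V
  last v []       = v
  last v (w ∷ ws) = last w ws

  chain-last : ∀ v ws → Chain v (ws ++ x ∷ []) → Edge G (last v ws) x
  chain-last v []       (e , _) = e
  chain-last v (w ∷ ws) (_ , h) = chain-last w ws h

  chain-snoc : ∀ v ws → Chain v ws → Edge G (last v ws) x → Chain v (ws ++ x ∷ [])
  chain-snoc v []       _       e = e , _
  chain-snoc v (w ∷ ws) (f , h) e = f , chain-snoc w ws h e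

  chain-init : ∀ v ws → Chain v (ws ++ x ∷ []) → Chain v ws
  chain-init v []       _       = _
  chain-init v (w ∷ ws) (e , h) = e , chain-init w ws h

  record Extends (S : V → Bool) (c : V → Fin 3) (T : V → Bool) (d : V → Fin 3) : Set where
    field
      ⊆    : ∀ x → S x ≡ true → T x ≡ true
      same : ∀ x → S x ≡ true → d x ≡ c x

  extends-refl : Extends S c S c
  extends-refl = record { ⊆ = λ _ h → h ; same = λ _ _ → refl }

  extends-trans : ∀ {S c S′ c′ S″ c″} → Extends S c S′ c′ → Extends S′ c′ S″ c″ → Extends S c S″ c″
  extends-trans p q = record { ⊆ = λ x h → Extends.⊆ q x (Extends.⊆ p x h)
    ; same = λ x h → trans (Extends.same q x (Extends.⊆ p x h)) (Extends.same p x h) }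

  extends-colour : S v ≡ false → Extends S c (add S v) (paint c v α)
  extends-colour {S} {v} {c} {α} Sv = record { ⊆ = add-⊆ S v ; same = λ x h → paint-other c α (≢-by S h Sv) }

  -- Each vertex of the chain has an uncoloured neighbour, namely its successor, when its turn comes.
  greedy : ∀ S c v ws → Good S c → Chain v ws → Unique (v ∷ ws) → All W (v ∷ ws) → All (λ x → S x ≡ false) (v ∷ ws) →
    (∀ {T d} → Good T d → Extends S c T d → Free T d (last v ws)) →
    ∃ λ T → Colourable T × (∀ x → S x ≡ true ⊎ x ∈ˡ v ∷ ws → T x ≡ true)
  greedy S c v [] g _ _ (Wv ∷ []) (Sv ∷ []) free with choose g (free g extends-refl)
  ... | α , av = add S v , (paint c v α , colour g Wv av) , λ { x (inj₁ h) → add-⊆ S v x h ; x (inj₂ (here refl)) → add-self S v }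
  greedy S c v (w ∷ ws) g (e , chain) ((v≢w ∷ v∉) ∷ uniq) (Wv ∷ Ww ∷ Wws) (Sv ∷ Sw ∷ Sws) free
    with choose g (uncoloured w e Ww Sw)
  ... | α , av with greedy (add S v) (paint c v α) w ws (colour g Wv av) chain uniq (Ww ∷ Wws)
                      (All.zipWith (λ (neq , h) → trans (add-other S (neq ∘ sym)) h) (v≢w ∷ v∉ , Sw ∷ Sws))
                      (λ g′ ext → free g′ (extends-trans (extends-colour Sv) ext))
  ...   | T , col , cov = T , col , λ
    { x (inj₁ h)           → cov x (inj₁ (add-⊆ S v x h))
    ; x (inj₂ (here refl)) → cov x (inj₁ (add-self S v))
    ; x (inj₂ (there x∈))  → cov x (inj₂ x∈) }

  odd : ℕ → Bool
  odd zero    = false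
  odd (suc k) = not (odd k)

  -- On an even cycle with only two colours available, the greedy colouring alternates, so both neighbours of the last vertex get the same colour.
  alternate : ∀ S c u r ws {α β} → Good S c → (∀ {γ} v → v ∈ˡ ws → Avail S c v γ → γ ≡ α ⊎ γ ≡ β) →
    S u ≡ true → c u ≡ α → S r ≡ true → c r ≡ α → (ws ≡ last u ws ∷ [] → u ≢ r) → r ∉ˡ ws →
    Chain u (ws ++ r ∷ []) → Unique ws → All W ws → All (λ x → S x ≡ false) ws → odd (length ws) ≡ true →
    ∃ λ T → Colourable T × (∀ x → S x ≡ true ⊎ x ∈ˡ ws → T x ≡ true)
  alternate S c u r (v ∷ []) g two Su cu Sr cr u≢r r∉ (e , f , _) uniq (Wv ∷ []) Sws o =
    greedy S c v [] g _ ([] ∷ []) (Wv ∷ []) Sws λ {T} {d} g′ ext →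
      repeated u r (u≢r refl) (edge-sym e) f (Extends.⊆ ext u Su) (Extends.⊆ ext r Sr)
        (trans (Extends.same ext u Su) (trans (trans cu (sym cr)) (sym (Extends.same ext r Sr))))
  alternate S c u r (v ∷ w ∷ []) g two Su cu Sr cr u≢r r∉ (e , f , h , _) uniq Wws Sws ()
  alternate S c u r (v ∷ w ∷ x ∷ ws) {α} {β} g two Su cu Sr cr _ r∉ (e , f , h , chain)
    ((v≢w ∷ v≢x ∷ v∉) ∷ (w≢x ∷ w∉) ∷ uniq) (Wv ∷ Ww ∷ Wx ∷ Wws) (Sv ∷ Sw ∷ Sx ∷ Sws) o
    with choose g (uncoloured w f Ww Sw)
  ... | γ , av with two v (here refl) av
  ...   | inj₁ refl = ⊥-elim (av .proj₂ u (edge-sym e) Su cu)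
  ...   | inj₂ refl with choose g₁ (uncoloured x h Wx (trans (add-other S (v≢x ∘ sym)) Sx))
    where
    g₁ = colour g Wv av
  ...     | δ , aw with two w (there (here refl)) (shrink aw)
    where
    shrink : ∀ {y γ} → Avail (add S v) (paint c v β) y γ → Avail S c y γ
    shrink (¬b , un) = ¬b , λ y e Sy → subst (_≢ _) (paint-other c β (≢-by S Sy Sv)) (un y e (add-⊆ S v y Sy))
  ...       | inj₂ refl = ⊥-elim (aw .proj₂ v (edge-sym f) (add-self S v) (paint-self c v β))
  ...       | inj₁ refl with alternate S₂ c₂ w r (x ∷ ws) (colour (colour g Wv av) Ww aw)
                (λ y y∈ (¬b , un) → two y (there (there y∈)) (¬b , λ z e Sz → subst (_≢ _) (Extends.same ext z Sz) (un z e (Extends.⊆ ext z Sz))))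
                (add-self (add S v) w) (paint-self (paint c v β) w α)
                (Extends.⊆ ext r Sr) (trans (Extends.same ext r Sr) cr)
                (λ _ eq → r∉ (there (here (sym eq)))) (r∉ ∘ there ∘ there) (h , chain) uniq (Wx ∷ Wws)
                (All.zipWith (λ ((v≢ , w≢) , h) → trans (add-other (add S v) (w≢ ∘ sym)) (trans (add-other S (v≢ ∘ sym)) h))
                  (All.zip (v≢x ∷ v∉ , w≢x ∷ w∉) , Sx ∷ Sws)) (trans (sym (Boolₚ.not-involutive _)) o)
    where
    S₂ = add (add S v) w
    c₂ = paint (paint c v β) w α
    ext : Extends S c S₂ c₂
    ext = extends-trans (extends-colour Sv) (extends-colour (trans (add-other S (v≢w ∘ sym)) Sw))
  ...         | T , col , cov = T , col , λ
    { x (inj₁ h)                   → cov x (inj₁ (add-⊆ (add S v) w x (add-⊆ S v x h)))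
    ; x (inj₂ (here refl))         → cov x (inj₁ (add-⊆ (add S v) w x (add-self S v)))
    ; x (inj₂ (there (here refl))) → cov x (inj₁ (add-self (add S v) w))
    ; x (inj₂ (there (there x∈)))  → cov x (inj₂ x∈) }

  last-++ : ∀ v xs w ys → last v (xs ++ w ∷ ys) ≡ last w ys
  last-++ v []       w ys = refl
  last-++ v (x ∷ xs) w ys = last-++ x xs w ys

  chain-++⁺ : ∀ v xs {ys} → Chain v xs → Chain (last v xs) ys → Chain v (xs ++ ys)
  chain-++⁺ v []       _       h = h
  chain-++⁺ v (x ∷ xs) (e , g) h = e , chain-++⁺ x xs g h

  chain-++⁻ˡ : ∀ v xs {ys} → Chain v (xs ++ ys) → Chain v xs
  chain-++⁻ˡ v []       h       = _
  chain-++⁻ˡ v (x ∷ xs) (e , h) = e , chain-++⁻ˡ x xs h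

  chain-++⁻ʳ : ∀ v xs {ys} → Chain v (xs ++ ys) → Chain (last v xs) ys
  chain-++⁻ʳ v []       h       = h
  chain-++⁻ʳ v (x ∷ xs) (e , h) = chain-++⁻ʳ x xs h

  chain-reverse : ∀ v xs w → Chain v (xs ++ w ∷ []) → Chain w (List.reverse xs ++ v ∷ [])
  chain-reverse v []       w (e , _) = edge-sym e , _
  chain-reverse v (x ∷ xs) w (e , h) = subst (λ l → Chain w (l ++ v ∷ [])) (sym (Listₚ.unfold-reverse x xs))
    (chain-snoc w (List.reverse xs ++ x ∷ []) (chain-reverse x xs w h)
      (subst (λ z → Edge G z v) (sym (last-++ w (List.reverse xs) x [])) (edge-sym e)))

  Cyc : V → List V → Set
  Cyc v vs = Chain v (vs ++ v ∷ [])

  rotate : ∀ v w ws → Cyc v (w ∷ ws) → Cyc w (ws ++ v ∷ [])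
  rotate v w ws (e , h) = chain-snoc w (ws ++ v ∷ []) h (subst (λ z → Edge G z w) (sym (last-++ w ws v [])) e)

  rotate-↭ : ∀ (v w : V) ws → w ∷ ws ++ v ∷ [] ↭ v ∷ w ∷ ws
  rotate-↭ v w ws = ↭ₚ.++-comm (w ∷ ws) (v ∷ [])

  rotate-past : ∀ v xs {u ys} → Cyc v (xs ++ u ∷ ys) → Cyc u (ys ++ v ∷ xs)
  rotate-past v []       {u} {ys} h = rotate v u ys h
  rotate-past v (x ∷ xs) {u} {ys} h = subst (Cyc u) (Listₚ.++-assoc ys (v ∷ []) (x ∷ xs))
    (rotate-past x xs {u} {ys ++ v ∷ []} (subst (Cyc x) (Listₚ.++-assoc xs (u ∷ ys) (v ∷ [])) (rotate v x (xs ++ u ∷ ys) h)))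

  rotate-to : ∀ v vs {u} → u ∈ˡ v ∷ vs → Cyc v vs → ∃ λ us → Cyc u us × u ∷ us ↭ v ∷ vs
  rotate-to v vs (here refl) h = vs , h , ↭-refl
  rotate-to v vs (there u∈)  h with ∈ₚ.∈-∃++ u∈
  ... | xs , ys , refl = ys ++ v ∷ xs , rotate-past v xs h , ↭ₚ.++-comm (_ ∷ ys) (v ∷ xs)

  elem : List V → V → Bool
  elem l x = does (x ∈ˡ? l)

  elem-true : ∀ {l x} → x ∈ˡ l → elem l x ≡ true
  elem-true {l} {x} = dec-true (x ∈ˡ? l)

  elem-false : ∀ {l x} → x ∉ˡ l → elem l x ≡ false
  elem-false {l} {x} = dec-false (x ∈ˡ? l)

  -- The cycle at the end of a longest lollipop. The exceptional vertex, where the stick begins, is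
  -- put last, so that the attached vertices form an initial segment; `type` is the colour that the
  -- cycle misses.
  record Leaf (d : V) (ds : List V) : Set where
    field
      cyc        : Cyc d ds
      uniq       : Unique (d ∷ ds)
      inW        : All W (d ∷ ds)
      odd-length : odd (length (d ∷ ds)) ≡ true
      len        : 3 ≤ length (d ∷ ds)
      type       : Fin 3
      attached   : ∀ {u} → u ∈ˡ d ∷ ds → u ≢ last d ds → ∃ λ x → Edge G u x × NX type x

  -- Cycles in a minimal uncolourable set

  module Minimal (S : V → Bool) (inW : ∀ v → S v ≡ true → W v)
    (smaller : ∀ T → (∀ v → T v ≡ true → W v) → size T < size S → ¬ ¬ Colourable T)
    (bad : ¬ Colourable S) where

    without : List V → V → Bool
    without l x = S x ∧ not (elem l x)

    without-∉ : ∀ l x → without l x ≡ true → x ∉ˡ l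
    without-∉ l x h x∈ rewrite elem-true x∈ with () ← trans (sym (Boolₚ.∧-zeroʳ (S x))) h

    without-S : ∀ l x → without l x ≡ true → S x ≡ true
    without-S l x = Boolₚ.∧-conicalˡ (S x) _

    without-∈ : ∀ {l x} → x ∈ˡ l → without l x ≡ false
    without-∈ {l} {x} x∈ rewrite elem-true x∈ = Boolₚ.∧-zeroʳ (S x)

    without-intro : ∀ {l x} → S x ≡ true → x ∉ˡ l → without l x ≡ true
    without-intro {l} {x} Sx x∉ rewrite elem-false {l} x∉ | Sx = refl

    without-cover : ∀ l x → S x ≡ true → without l x ≡ true ⊎ x ∈ˡ l
    without-cover l x Sx with x ∈ˡ? l
    ... | yes x∈ = inj₂ x∈
    ... | no x∉ rewrite Sx = inj₁ refl

    colour-without : ∀ l {v} → v ∈ˡ l → S v ≡ true → ¬ ¬ Colourable (without l)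
    colour-without l {v} v∈ Sv = smaller (without l) (λ x h → inW x (without-S l x h))
      (size-strict v (without-S l) (without-∈ v∈) Sv)

    not-extendable : ∀ {l T} → Colourable T → (∀ x → without l x ≡ true ⊎ x ∈ˡ l → T x ≡ true) → ⊥
    not-extendable {l} (c , g) cov = bad (c , good-⊆ (λ x Sx → cov x (without-cover l x Sx)) g)

    not-available : ∀ {v} → S v ≡ true → Good (without (v ∷ [])) c → ∀ {α} → ¬ Avail (without (v ∷ [])) c v α
    not-available {c} {v} Sv g {α} av = not-extendable {v ∷ []} (paint c v α , colour g (inW v Sv) av)
      λ { x (inj₁ h) → add-⊆ (without (v ∷ [])) v x h ; x (inj₂ (here refl)) → add-self (without (v ∷ [])) v }

    -- Otherwise `z` stays uncoloured, so `v` could be coloured after the rest of `S`.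
    closed-in-W : ∀ {v z} → S v ≡ true → Edge G v z → W z → S z ≡ true
    closed-in-W {v} {z} Sv e Wz = decidable-stable (S z Boolₚ.≟ true) λ Sz≢true →
      colour-without (v ∷ []) (here refl) Sv λ (c , g) →
      not-available Sv g (choose g (uncoloured z e Wz (cong (_∧ _) (Boolₚ.¬-not Sz≢true))) .proj₂)

    -- In a colouring of `S` without `v`, all three colours are lost at `v`. The precolouring takes
    -- at most one of them by `one-type`, and a single neighbour `p` at most one more. Hence paths
    -- in `S` never get stuck.
    second-neighbour : ∀ {v} → S v ≡ true → ∀ p → ∃ λ z → z ≢ p × Edge G v z × S z ≡ true
    second-neighbour {v} Sv p = decidable-stable
      (Finₚ.any? λ z → ¬? (z Fin.≟ p) ×-dec edge? v z ×-dec (S z Boolₚ.≟ true)) λ none →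
      colour-without (v ∷ []) (here refl) Sv λ (c , g) → blocked g none (avail-or-blocked _ c v)
      where
      blocked : Good (without (v ∷ [])) c → ¬ (∃ λ z → z ≢ p × Edge G v z × S z ≡ true) →
        (∃ λ α → Avail (without (v ∷ [])) c v α) ⊎ (∀ i → ∃ λ y → Blocker (without (v ∷ [])) c v i y) → ⊥
      blocked {c} g none (inj₁ (_ , av)) = not-available Sv g av
      blocked {c} g none (inj₂ bs) with kind 0F | kind 1F | kind 2F
        where
        kind : ∀ i → Block i v ⊎ Blocker (without (v ∷ [])) c v i p
        kind i with bs i
        ... | y , e , inj₁ nx = inj₁ (y , e , nx)
        ... | y , e , inj₂ (¬b , h , eq) with y Fin.≟ p
        ...   | yes refl = inj₂ (e , inj₂ (¬b , h , eq))
        ...   | no neq   = ⊥-elim (none (y , neq , e , without-S (v ∷ []) y h))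
      ... | inj₁ (_ , e , nx) | inj₁ (_ , f , ny) | _ with () ← one-type (inW v Sv) e nx f ny
      ... | inj₁ (_ , e , nx) | _ | inj₁ (_ , f , ny) with () ← one-type (inW v Sv) e nx f ny
      ... | _ | inj₁ (_ , e , nx) | inj₁ (_ , f , ny) with () ← one-type (inW v Sv) e nx f ny
      ... | inj₂ b | inj₂ b′ | _ with () ← blocker-injective g b b′
      ... | inj₂ b | _ | inj₂ b′ with () ← blocker-injective g b b′
      ... | _ | inj₂ b | inj₂ b′ with () ← blocker-injective g b b′

    record CycleInfo (l : List V) : Set where
      field
        odd-length : odd (length l) ≡ true
        type       : Fin 3
        outer      : ∀ {u} → u ∈ˡ l → ∃ λ y → Edge G u y × y ∉ˡ l × (NX type y ⊎ S y ≡ true)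

    module _ (v₁ v₂ v₃ : V) (vs : List V) (cyc : Cyc v₁ (v₂ ∷ v₃ ∷ vs)) (uniq : Unique (v₁ ∷ v₂ ∷ v₃ ∷ vs))
      (inS : All (λ x → S x ≡ true) (v₁ ∷ v₂ ∷ v₃ ∷ vs)) where

      private
        l : List V
        l = v₁ ∷ v₂ ∷ v₃ ∷ vs
        S₀ : V → Bool
        S₀ = without l

        uniq′ : ∀ {l′} → l′ ↭ l → Unique l′
        uniq′ p = ↭ₛ.Unique-resp-↭ (↭⇒↭ₛ (↭-sym p)) uniq

        inW′ : ∀ {l′} → l′ ↭ l → All W l′
        inW′ p = ↭ₚ.All-resp-↭ (↭-sym p) (All.map (inW _) inS)

        outside : ∀ {l′} → l′ ↭ l → All (λ x → S₀ x ≡ false) l′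
        outside p = All.tabulate λ x∈ → without-∈ (↭ₚ.∈-resp-↭ p x∈)

      two-neighbours : ∀ {u} → u ∈ˡ l → ∃ λ p → ∃ λ q → p ≢ q × Edge G u p × Edge G u q × p ∈ˡ l × q ∈ˡ l
      two-neighbours {u} u∈ with rotate-to v₁ (v₂ ∷ v₃ ∷ vs) u∈ cyc
      ... | []         , h       , p with () ← ↭ₚ.↭-length p
      ... | w ∷ []     , h       , p with () ← ↭ₚ.↭-length p
      ... | w ∷ x ∷ ws , (e , h) , p with uniq′ p
      ...   | (_ ∷ (w∉ ∷ _)) = w , last x ws , All.lookup w∉ (last-∈ x ws) , e , edge-sym (chain-last w (x ∷ ws) h) ,
        ↭ₚ.∈-resp-↭ p (there (here refl)) , ↭ₚ.∈-resp-↭ p (there (there (last-∈ x ws)))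
        where
        last-∈ : ∀ x ws → last x ws ∈ˡ x ∷ ws
        last-∈ x []       = here refl
        last-∈ x (w ∷ ws) = there (last-∈ w ws)

      module _ (c : V → Fin 3) (g : Good S₀ c) where
        -- Otherwise give `v` the colour `α` and colour greedily from `w` around the cycle to the
        -- predecessor of `v`. That vertex has lost `α` already, so its neighbour `v` is `wasted` or
        -- `repeated`, a colour is left for it, and all of `S` is coloured.
        step : ∀ v w ws → Cyc v (w ∷ ws) → v ∷ w ∷ ws ↭ l → ∀ α → Avail S₀ c v α → Avail S₀ c (last w ws) α
        step v w ws h@(_ , h′) p α av with uniq′ p | inW′ p | outside p
        ... | v∉ ∷ uniq″ | Wv ∷ Wws | Sv ∷ Sws with avail? S₀ c (last w ws) α
        ...   | inj₁ a = a
        ...   | inj₂ unavailable with greedy (add S₀ v) (paint c v α) w ws (colour g Wv av) (chain-init w ws h′) uniq″ Wws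
                 (All.zipWith (λ (neq , s) → trans (add-other S₀ (neq ∘ sym)) s) (v∉ , Sws))
                 (λ {T} {d} _ ext → free {T} {d} ext)
          where
          free : ∀ {T d} → Extends (add S₀ v) (paint c v α) T d → Free T d (last w ws)
          free {T} {d} ext = by-cases unavailable
            where
            Tv : T v ≡ true
            Tv = Extends.⊆ ext v (add-self S₀ v)
            dv : d v ≡ α
            dv = trans (Extends.same ext v (add-self S₀ v)) (paint-self c v α)
            by-cases : Block α (last w ws) ⊎ (¬ Block α (last w ws) × Used S₀ c (last w ws) α) → Free T d (last w ws)
            by-cases (inj₁ blk) = wasted v (chain-last w ws h′) Tv (subst (λ β → Block β (last w ws)) (sym dv) blk)
            by-cases (inj₂ (_ , y , e , Sy , eq)) = repeated v y (≢-by S₀ Sy Sv ∘ sym) (chain-last w ws h′) e Tv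
              (Extends.⊆ ext y (add-⊆ S₀ v y Sy))
              (trans dv (sym (trans (Extends.same ext y (add-⊆ S₀ v y Sy)) (trans (paint-other c α (≢-by S₀ Sy Sv)) eq))))
        ...     | T , col , cov = ⊥-elim (not-extendable {l} col λ
          { x (inj₁ h) → cov x (inj₁ (add-⊆ S₀ v x h))
          ; x (inj₂ x∈) → covered x (↭ₚ.∈-resp-↭ (↭-sym p) x∈) })
          where
          covered : ∀ x → x ∈ˡ v ∷ w ∷ ws → T x ≡ true
          covered x (here refl) = cov x (inj₁ (add-self S₀ v))
          covered x (there x∈)  = cov x (inj₂ x∈)

        -- Availability is passed backwards from each vertex to its predecessor. The cycle stays
        -- whole by moving the vertices already passed into `done`.
        sweep : ∀ (A : Fin 3 → Set) v ws done → Cyc v (ws ++ done) → v ∷ ws ++ done ↭ l →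
          (∀ α → Avail S₀ c v α → A α) → ∀ {u} → u ∈ˡ ws → ∀ α → Avail S₀ c u α → A α
        sweep A v (w ∷ ws) done h p hA u∈ = next u∈
          where
          h′ : Cyc w ((ws ++ done) ++ v ∷ [])
          h′ = rotate v w (ws ++ done) h
          p′ : w ∷ (ws ++ done) ++ v ∷ [] ↭ l
          p′ = ↭-trans (rotate-↭ v w (ws ++ done)) p
          hA′ : ∀ α → Avail S₀ c w α → A α
          hA′ α av = hA α (subst (λ z → Avail S₀ c z α) (last-++ w (ws ++ done) v []) (step-any w ((ws ++ done) ++ v ∷ []) h′ p′ α av))
            where
            step-any : ∀ w ws → Cyc w ws → w ∷ ws ↭ l → ∀ α → Avail S₀ c w α → Avail S₀ c (last w ws) α
            step-any w []       h p α av = av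
            step-any w (x ∷ xs) h p α av = step w x xs h p α av
          next : ∀ {u} → u ∈ˡ w ∷ ws → ∀ α → Avail S₀ c u α → A α
          next (here refl) = hA′
          next (there u∈)  = sweep A w ws (done ++ v ∷ []) (subst (Cyc w) (Listₚ.++-assoc ws done (v ∷ [])) h′)
            (subst (λ z → w ∷ z ↭ l) (Listₚ.++-assoc ws done (v ∷ [])) p′) hA′ u∈

        all-alike : ∀ {u w} → u ∈ˡ l → w ∈ˡ l → ∀ α → Avail S₀ c u α → Avail S₀ c w α
        all-alike {u} {w} u∈ w∈ with rotate-to v₁ (v₂ ∷ v₃ ∷ vs) w∈ cyc
        ... | ws , h , p with ↭ₚ.∈-resp-↭ (↭-sym p) u∈
        ...   | here refl = λ _ av → av
        ...   | there u∈′ = sweep (Avail S₀ c w) w ws [] (subst (Cyc w) (sym (Listₚ.++-identityʳ ws)) h)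
          (subst (λ z → w ∷ z ↭ l) (sym (Listₚ.++-identityʳ ws)) p) (λ _ av → av) u∈′

        blocker-outside : ∀ {u i} → Block i u ⊎ (¬ Block i u × Used S₀ c u i) → ∃ λ y → y ∉ˡ l × Blocker S₀ c u i y × (NX i y ⊎ S y ≡ true)
        blocker-outside (inj₁ (y , e , nx)) = y , (λ y∈ → All.lookup (inW′ ↭-refl) y∈ .proj₂ _ nx) , (e , inj₁ nx) , inj₁ nx
        blocker-outside (inj₂ (¬b , y , e , Sy , eq)) = y , without-∉ l y Sy , (e , inj₂ (¬b , Sy , eq)) , inj₂ (without-S l y Sy)

        unavailable : ∀ {u i} → ¬ Avail S₀ c u i → ∃ λ y → y ∉ˡ l × Blocker S₀ c u i y × (NX i y ⊎ S y ≡ true)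
        unavailable {u} {i} ¬av with avail? S₀ c u i
        ... | inj₁ av = ⊥-elim (¬av av)
        ... | inj₂ b  = blocker-outside b

        -- A blocker of a cycle vertex lies off the cycle. Two lost colours need two blockers, which
        -- with the two cycle neighbours would make degree 4.
        one-unavailable : ∀ {u i j} → u ∈ˡ l → ¬ Avail S₀ c u i → ¬ Avail S₀ c u j → i ≡ j
        one-unavailable {u} {i} {j} u∈ ¬i ¬j with i Fin.≟ j | two-neighbours u∈ | unavailable ¬i | unavailable ¬j
        ... | yes eq | _ | _ | _ = eq
        ... | no neq | p , q , p≢q , up , uq , p∈ , q∈ | y , y∉ , by , _ | z , z∉ , bz , _ =
          ⊥-elim (no-four up uq (by .proj₁) (bz .proj₁)
            ((p≢q ∷ ∈≢∉ p∈ y∉ ∷ ∈≢∉ p∈ z∉ ∷ []) ∷ (∈≢∉ q∈ y∉ ∷ ∈≢∉ q∈ z∉ ∷ []) ∷ ((λ { refl → neq (blocker-injective g by bz) }) ∷ []) ∷ [] ∷ []))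
          where
          ∈≢∉ : ∀ {x y} → x ∈ˡ l → y ∉ˡ l → x ≢ y
          ∈≢∉ x∈ y∉ refl = y∉ x∈

        -- Every neighbour off the cycle would cost a colour: one in `W` belongs to `S` and is
        -- coloured, and one in N(X) blocks; a neighbour in `X` would put the cycle vertex itself
        -- into N(X). So the cycle would be a component, while the edge `u₀x₀` lies elsewhere.
        not-all-available : ¬ (∀ α → Avail S₀ c v₁ α)
        not-all-available full = connected (elem l) closed (cyc .proj₁) (elem-true {l} (here refl)) u₀x₀ (elem-false u₀∉)
          where
          full′ : ∀ {u} → u ∈ˡ l → ∀ α → Avail S₀ c u α
          full′ u∈ α = all-alike (here refl) u∈ α (full α)
          u₀∉ : u₀ ∉ˡ l
          u₀∉ u₀∈ with () ← trans (sym Xu₀) (All.lookup (inW′ ↭-refl) u₀∈ .proj₁)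
          neighbour-∈ : ∀ {u w} → u ∈ˡ l → Edge G u w → w ∈ˡ l
          neighbour-∈ {u} {w} u∈ e = decidable-stable (w ∈ˡ? l) λ w∉ →
            full′ u∈ (c w) .proj₂ w e (without-intro (closed-in-W (All.lookup inS u∈) e Ww) w∉) refl
            where
            Ww : W w
            Ww = Boolₚ.¬-not (λ Xw → All.lookup (inW′ ↭-refl) u∈ .proj₂ (part w) (w , Xw , refl , edge-sym e)) ,
              λ i nx → full′ u∈ i .proj₁ (w , e , nx)
          closed : ∀ u v → Edge G u v → elem l u ≡ elem l v
          closed u v e with u ∈ˡ? l | v ∈ˡ? l
          ... | yes u∈ | yes v∈ = trans (elem-true u∈) (sym (elem-true v∈))
          ... | no u∉  | no v∉  = trans (elem-false u∉) (sym (elem-false v∉))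
          ... | yes u∈ | no v∉  = ⊥-elim (v∉ (neighbour-∈ u∈ e))
          ... | no u∉  | yes v∈ = ⊥-elim (u∉ (neighbour-∈ v∈ (edge-sym e)))

        available? : ∀ u i → Avail S₀ c u i ⊎ ¬ Avail S₀ c u i
        available? u i with avail? S₀ c u i
        ... | inj₁ av = inj₁ av
        ... | inj₂ (inj₁ b) = inj₂ λ (¬b , _) → ¬b b
        ... | inj₂ (inj₂ (_ , y , e , Sy , eq)) = inj₂ λ (_ , un) → un y e Sy eq

        -- All vertices miss `i` and have the other two colours, which can alternate around an even
        -- cycle. The painted vertex `v₁` serves as both ends of the chain of the remaining
        -- vertices.
        odd-cycle : ∀ i → ¬ Avail S₀ c v₁ i → odd (length l) ≡ true
        odd-cycle i ¬i with odd (length l) in parity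
        ... | true  = refl
        ... | false = ⊥-elim (even i ¬i parity uniq (inW′ ↭-refl) (outside ↭-refl))
          where
          missing : ∀ {u} → u ∈ˡ l → ¬ Avail S₀ c u i
          missing u∈ = ¬i ∘ all-alike u∈ (here refl) i
          others : ∀ i → ∃ λ α → ∃ λ β → α ≢ i × (∀ γ → γ ≢ i → γ ≡ α ⊎ γ ≡ β)
          others 0F = 1F , 2F , (λ ()) , λ { 0F h → ⊥-elim (h refl) ; 1F h → inj₁ refl ; 2F h → inj₂ refl }
          others 1F = 0F , 2F , (λ ()) , λ { 1F h → ⊥-elim (h refl) ; 0F h → inj₁ refl ; 2F h → inj₂ refl }
          others 2F = 0F , 1F , (λ ()) , λ { 2F h → ⊥-elim (h refl) ; 0F h → inj₁ refl ; 1F h → inj₂ refl }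
          even : ∀ i → ¬ Avail S₀ c v₁ i → odd (length l) ≡ false →
            Unique l → All W l → All (λ x → S₀ x ≡ false) l → ⊥
          even i ¬i parity (v₁∉ ∷ uniq₁) (W₁ ∷ Ws) (S₁ ∷ Ss) with others i
          ... | α , β , α≢i , two with available? v₁ α
          ... | inj₂ ¬α = α≢i (one-unavailable (here refl) ¬α ¬i)
          ... | inj₁ av with alternate (add S₀ v₁) (paint c v₁ α) v₁ v₁ (v₂ ∷ v₃ ∷ vs) {α} {β} (colour g W₁ av)
                 (λ {γ} y y∈ (¬b , un) → two γ λ { refl → ¬i (all-alike (there y∈) (here refl) i
                   (¬b , λ z e Sz → subst (_≢ γ) (paint-other c α (≢-by S₀ Sz S₁)) (un z e (add-⊆ S₀ v₁ z Sz)))) })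
                 (add-self S₀ v₁) (paint-self c v₁ α) (add-self S₀ v₁) (paint-self c v₁ α) (λ ())
                 (λ v₁∈ → All.lookup v₁∉ v₁∈ refl) cyc uniq₁ Ws
                 (All.zipWith (λ (neq , s) → trans (add-other S₀ (neq ∘ sym)) s) (v₁∉ , Ss))
                 (trans (sym (Boolₚ.not-involutive _)) (cong not parity))
          ...   | T , col , cov = not-extendable {l} col λ
            { x (inj₁ h)           → cov x (inj₁ (add-⊆ S₀ v₁ x h))
            ; x (inj₂ (here refl)) → cov x (inj₁ (add-self S₀ v₁))
            ; x (inj₂ (there x∈))  → cov x (inj₂ x∈) }

        missing-info : ∀ i → ¬ Avail S₀ c v₁ i → CycleInfo l
        missing-info i ¬i = record
          { odd-length = odd-cycle i ¬i
          ; type       = i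
          ; outer      = λ u∈ → let (y , y∉ , (e , _) , h) = unavailable (¬i ∘ all-alike u∈ (here refl) i) in y , e , y∉ , h
          }

        info : CycleInfo l
        info with available? v₁ 0F | available? v₁ 1F | available? v₁ 2F
        ... | inj₂ ¬a | _       | _       = missing-info 0F ¬a
        ... | _       | inj₂ ¬a | _       = missing-info 1F ¬a
        ... | _       | _       | inj₂ ¬a = missing-info 2F ¬a
        ... | inj₁ a  | inj₁ b  | inj₁ d  = ⊥-elim (not-all-available λ { 0F → a ; 1F → b ; 2F → d })

      cycle-info : ¬ ¬ CycleInfo l
      cycle-info k = colour-without l (here refl) (All.lookup inS (here refl)) λ (c , g) → k (info c g)

    cycle-info′ : ∀ v vs → Cyc v vs → Unique (v ∷ vs) → All (λ x → S x ≡ true) (v ∷ vs) → 3 ≤ length (v ∷ vs) → ¬ ¬ CycleInfo (v ∷ vs)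
    cycle-info′ v []           _ _ _ (s≤s ())
    cycle-info′ v (w ∷ [])     _ _ _ (s≤s (s≤s ()))
    cycle-info′ v (w ∷ x ∷ vs) h u a _ = cycle-info v w x vs h u a

    odd-+ : ∀ a b → odd (a + b) ≡ odd a Data.Bool.xor odd b
    odd-+ zero    b = refl
    odd-+ (suc a) b rewrite odd-+ a b = not-xor (odd a) (odd b)
      where
      not-xor : ∀ x y → not (x Data.Bool.xor y) ≡ not x Data.Bool.xor y
      not-xor true  y = Boolₚ.not-involutive y
      not-xor false y = refl

    theta-parity : ∀ o a b → odd (o + suc (a + 1)) ≡ true → odd (suc (o + suc b)) ≡ true → odd (suc (a + suc b)) ≡ true → ⊥
    theta-parity o a b p q r rewrite odd-+ o (suc (a + 1)) | odd-+ a 1 | odd-+ o (suc b) | odd-+ a (suc b)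
      with odd o | odd a | odd b
    theta-parity o a b () q r | true  | true  | _
    theta-parity o a b p () r | true  | false | true
    theta-parity o a b p q () | true  | false | false
    theta-parity o a b p q () | false | true  | true
    theta-parity o a b p () r | false | true  | false
    theta-parity o a b () q r | false | false | _

    unique-++⁻ : ∀ (xs : List V) {ys} → Unique (xs ++ ys) → Unique xs × Unique ys × (∀ {x} → x ∈ˡ xs → x ∉ˡ ys)
    unique-++⁻ []       u        = [] , u , λ ()
    unique-++⁻ (x ∷ xs) (x∉ ∷ u) with unique-++⁻ xs u
    ... | uxs , uys , disj = Allₚ.++⁻ˡ xs x∉ ∷ uxs , uys , λ
      { (here refl) y∈ → All.lookup (Allₚ.++⁻ʳ xs x∉) y∈ refl
      ; (there x∈)  y∈ → disj x∈ y∈ }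

    unique-++⁺ : ∀ {xs ys : List V} → Unique xs → Unique ys → (∀ {x} → x ∈ˡ xs → x ∉ˡ ys) → Unique (xs ++ ys)
    unique-++⁺ u u′ disj = Uniqueₚ.++⁺ u u′ λ (x∈ , x∈′) → disj x∈ x∈′

    unique-↭ : ∀ {l l′ : List V} → l ↭ l′ → Unique l → Unique l′
    unique-↭ p = ↭ₛ.Unique-resp-↭ (↭⇒↭ₛ p)

    -- Theta graphs and lollipops

    InS : List V → Set
    InS = All (λ x → S x ≡ true)

    -- A cycle with an ear: the three cycles of this theta graph have lengths with even sum, so they are not all odd.
    theta : ∀ c r R₁ R₂ o os → Cyc c (R₁ ++ r ∷ R₂) → Unique (c ∷ R₁ ++ r ∷ R₂) → InS (c ∷ R₁ ++ r ∷ R₂) →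
      3 ≤ length (c ∷ R₁ ++ r ∷ R₂) → Chain r ((o ∷ os) ++ c ∷ []) → Unique (o ∷ os) → InS (o ∷ os) →
      (∀ {x} → x ∈ˡ o ∷ os → x ∉ˡ c ∷ R₁ ++ r ∷ R₂) → ⊥
    theta c r R₁ R₂ o os cyc uniq inS len ear uniqO inSO disj =
      cycle-info′ c (R₁ ++ r ∷ R₂) cyc uniq inS len λ D →
      cycle-info′ o (os ++ c ∷ R₁ ++ r ∷ []) cycA uniqA inSA lenA λ A →
      cycle-info′ c (List.reverse (o ∷ os) ++ r ∷ R₂) cycB uniqB inSB lenB λ B →
      theta-parity (length (o ∷ os)) (length R₁) (length R₂)
        (subst (λ k → odd k ≡ true) lengthA (CycleInfo.odd-length A))
        (subst (λ k → odd (suc k) ≡ true) lengthB (CycleInfo.odd-length B))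
        (subst (λ k → odd (suc k) ≡ true) (Listₚ.length-++ R₁) (CycleInfo.odd-length D))
      where
      O = o ∷ os
      split : (c ∷ R₁ ++ r ∷ []) ++ R₂ ≡ c ∷ R₁ ++ r ∷ R₂
      split = cong (c ∷_) (Listₚ.++-assoc R₁ (r ∷ []) R₂)
      cyc′ : Chain c (R₁ ++ r ∷ R₂ ++ c ∷ [])
      cyc′ = subst (Chain c) (Listₚ.++-assoc R₁ (r ∷ R₂) (c ∷ [])) cyc
      c-to-r : Chain c (R₁ ++ r ∷ [])
      c-to-r = chain-++⁺ c R₁ (chain-++⁻ˡ c R₁ cyc′) (chain-++⁻ʳ c R₁ cyc′ .proj₁ , _)
      r-to-c : Chain r (R₂ ++ c ∷ [])
      r-to-c = chain-++⁻ʳ c R₁ cyc′ .proj₂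
      cycA : Cyc o (os ++ c ∷ R₁ ++ r ∷ [])
      cycA = subst (Chain o) (sym (Listₚ.++-assoc os (c ∷ R₁ ++ r ∷ []) (o ∷ [])))
        (chain-++⁺ o os (chain-++⁻ˡ o os (ear .proj₂))
          (chain-++⁻ʳ o os (ear .proj₂) .proj₁ , chain-snoc c (R₁ ++ r ∷ []) c-to-r
            (subst (λ z → Edge G z o) (sym (last-++ c R₁ r [])) (ear .proj₁))))
      uniqCR : Unique (c ∷ R₁ ++ r ∷ [])
      uniqCR = unique-++⁻ (c ∷ R₁ ++ r ∷ []) (subst Unique (sym split) uniq) .proj₁
      uniqA : Unique (O ++ c ∷ R₁ ++ r ∷ [])
      uniqA = unique-++⁺ uniqO uniqCR λ {x} x∈ x∈′ → disj x∈ (subst (x ∈ˡ_) split (∈ₚ.∈-++⁺ˡ x∈′))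
      inSA : InS (O ++ c ∷ R₁ ++ r ∷ [])
      inSA = Allₚ.++⁺ inSO (Allₚ.++⁻ˡ (c ∷ R₁ ++ r ∷ []) (subst InS (sym split) inS))
      lengthA : length (O ++ c ∷ R₁ ++ r ∷ []) ≡ length O + suc (length R₁ + 1)
      lengthA = trans (Listₚ.length-++ O) (cong (λ k → length O + suc k) (Listₚ.length-++ R₁))
      lenA : 3 ≤ length (O ++ c ∷ R₁ ++ r ∷ [])
      lenA = subst (3 ≤_) (sym lengthA) (ℕₚ.+-mono-≤ {1} {length O} {2} (s≤s z≤n) (s≤s (ℕₚ.m≤n+m 1 (length R₁))))
      cycB : Cyc c (List.reverse O ++ r ∷ R₂)
      cycB = subst (Chain c) (trans (Listₚ.++-assoc (List.reverse O) (r ∷ []) (R₂ ++ c ∷ [])) (sym (Listₚ.++-assoc (List.reverse O) (r ∷ R₂) (c ∷ []))))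
        (chain-++⁺ c (List.reverse O ++ r ∷ []) (chain-reverse r O c ear)
          (subst (λ z → Chain z (R₂ ++ c ∷ [])) (sym (last-++ c (List.reverse O) r [])) r-to-c))
      uniq-crR : Unique (c ∷ r ∷ R₂)
      uniq-crR = drop uniq
        where
        drop : Unique (c ∷ R₁ ++ r ∷ R₂) → Unique (c ∷ r ∷ R₂)
        drop (c∉ ∷ u) = Allₚ.++⁻ʳ R₁ c∉ ∷ unique-++⁻ R₁ u .proj₂ .proj₁
      uniqB : Unique (c ∷ List.reverse O ++ r ∷ R₂)
      uniqB = unique-↭ (↭-trans (↭ₚ.++⁺ʳ (c ∷ r ∷ R₂) (↭-sym (↭ₚ.↭-reverse O))) (↭ₚ.shift c (List.reverse O) (r ∷ R₂)))
        (unique-++⁺ uniqO uniq-crR λ { x∈ (here refl) → disj x∈ (here refl) ; x∈ (there x∈′) → disj x∈ (there (∈ₚ.∈-++⁺ʳ R₁ x∈′)) })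
      inSB : InS (c ∷ List.reverse O ++ r ∷ R₂)
      inSB = reversed inS
        where
        reversed : InS (c ∷ R₁ ++ r ∷ R₂) → InS (c ∷ List.reverse O ++ r ∷ R₂)
        reversed (Sc ∷ SR) = Sc ∷ Allₚ.++⁺ (↭ₚ.All-resp-↭ (↭-sym (↭ₚ.↭-reverse O)) inSO) (Allₚ.++⁻ʳ R₁ SR)
      lengthB : length (List.reverse O ++ r ∷ R₂) ≡ length O + suc (length R₂)
      lengthB = trans (Listₚ.length-++ (List.reverse O)) (cong (_+ suc (length R₂)) (Listₚ.length-reverse O))
      lenB : 3 ≤ suc (length (List.reverse O ++ r ∷ R₂))
      lenB = s≤s (subst (2 ≤_) (sym lengthB) (ℕₚ.+-mono-≤ {1} {length O} {1} (s≤s z≤n) (s≤s z≤n)))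

    -- The stick `T` is attached at the last vertex of the cycle and may be empty.
    record Lollipop (d : V) (ds T : List V) : Set where
      field
        cyc   : Cyc d ds
        chain : Chain (last d ds) T
        uniq  : Unique (d ∷ ds ++ T)
        inS   : InS (d ∷ ds ++ T)
        len   : 3 ≤ length (d ∷ ds)

    unique-bound : ∀ {l : List V} → Unique l → length l ≤ n G
    unique-bound {l} u = subst (length l ≤_) (Subsetₚ.∣⊤∣≡n (n G)) (unique-length Data.Fin.Subset.⊤ u (All.tabulate λ _ → Subsetₚ.∈⊤))

    -- An edge of S leaving the cycle elsewhere than at its last vertex gives an ear or a lollipop with a longer stick.
    module Exits {d ds T} (L : Lollipop d ds T)
      (longer : ∀ {d′ ds′ T′} → Lollipop d′ ds′ T′ → length T < length T′ → ⊥) where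
      open Lollipop L

      D = d ∷ ds
      e = last d ds

      uniqD : Unique D
      uniqD = unique-++⁻ D uniq .proj₁
      inSD : InS D
      inSD = Allₚ.++⁻ˡ D inS
      D∌T : ∀ {x} → x ∈ˡ D → x ∉ˡ T
      D∌T = unique-++⁻ D uniq .proj₂ .proj₂

      e∈D : e ∈ˡ D
      e∈D = go d ds
        where
        go : ∀ d ds → last d ds ∈ˡ d ∷ ds
        go d []       = here refl
        go d (x ∷ ds) = there (go x ds)

      no-ear : ∀ {c r} → c ∈ˡ D → r ∈ˡ D → c ≢ r → ∀ O → 0 < length O → Chain r (O ++ c ∷ []) → Unique O → InS O →
        (∀ {x} → x ∈ˡ O → x ∉ˡ D) → ⊥
      no-ear {c} {r} c∈ r∈ c≢r (o ∷ os) _ ear uniqO inSO disj with rotate-to d ds c∈ cyc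
      ... | us , h , p with ↭ₚ.∈-resp-↭ (↭-sym p) r∈
      ...   | here refl = c≢r refl
      ...   | there r∈′ with ∈ₚ.∈-∃++ r∈′
      ...     | R₁ , R₂ , refl = theta c r R₁ R₂ o os h (unique-↭ (↭-sym p) uniqD) (↭ₚ.All-resp-↭ (↭-sym p) inSD)
        (subst (3 ≤_) (sym (↭ₚ.↭-length p)) len) ear uniqO inSO (λ x∈ x∈′ → disj x∈ (↭ₚ.∈-resp-↭ p x∈′))

      -- An ear from c that ends on the stick is continued along the stick to the end of the cycle.
      no-ear-via-stick : ∀ {c z} → c ∈ˡ D → c ≢ e → z ∈ˡ T → ∀ Q → Chain z (Q ++ c ∷ []) → Unique (z ∷ Q) → InS (z ∷ Q) →
        (∀ {x} → x ∈ˡ Q → x ∉ˡ D ++ T) → ⊥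
      no-ear-via-stick {c} {z} c∈ c≢e z∈T Q h uniqQ inSQ disj with ∈ₚ.∈-∃++ z∈T
      ... | T₁ , T₂ , eq = no-ear c∈ e∈D c≢e (T₁ ++ z ∷ Q) nonempty ear
          (unique-++⁺ (unique-++⁻ T₁ uniqT .proj₁) uniqQ λ
            { x∈ (here refl) → unique-++⁻ T₁ uniqT .proj₂ .proj₂ x∈ (here refl)
            ; x∈ (there x∈′) → disj x∈′ (∈ₚ.∈-++⁺ʳ D (from-T₁ x∈)) })
          (Allₚ.++⁺ (Allₚ.++⁻ˡ T₁ (subst InS eq (Allₚ.++⁻ʳ D inS))) inSQ)
          λ x∈ x∈D → [ (λ x∈₁ → D∌T x∈D (from-T₁ x∈₁)) , (λ { (here refl) → D∌T x∈D z∈T ; (there x∈Q) → disj x∈Q (∈ₚ.∈-++⁺ˡ x∈D) }) ]′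
            (∈ₚ.∈-++⁻ T₁ x∈)
        where
        uniqT : Unique (T₁ ++ z ∷ T₂)
        uniqT = subst Unique eq (unique-++⁻ D uniq .proj₂ .proj₁)
        from-T₁ : ∀ {x} → x ∈ˡ T₁ → x ∈ˡ T
        from-T₁ x∈ = subst (_ ∈ˡ_) (sym eq) (∈ₚ.∈-++⁺ˡ x∈)
        nonempty : 0 < length (T₁ ++ z ∷ Q)
        nonempty = subst (0 <_) (sym (Listₚ.length-++ T₁)) (ℕₚ.≤-trans (s≤s z≤n) (ℕₚ.m≤n+m (suc (length Q)) (length T₁)))
        ear : Chain e ((T₁ ++ z ∷ Q) ++ c ∷ [])
        ear = subst (Chain e) (sym (Listₚ.++-assoc T₁ (z ∷ Q) (c ∷ [])))
          (chain-++⁺ e T₁ (chain-++⁻ˡ e T₁ (subst (Chain e) eq chain)) (chain-++⁻ʳ e T₁ (subst (Chain e) eq chain) .proj₁ , h))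

      module _ {c} (c≢e : c ≢ e) (D₁ : List V) (D₂ : List V) (eq : D ≡ D₁ ++ c ∷ D₂) where
        c∈ : c ∈ˡ D
        c∈ = subst (c ∈ˡ_) (sym eq) (∈ₚ.∈-++⁺ʳ D₁ (here refl))

        suffix-chain : ∀ d ds D₁ → d ∷ ds ≡ D₁ ++ c ∷ D₂ → Chain d ds → Chain c D₂ × last c D₂ ≡ last d ds
        suffix-chain d ds []       refl h = h , refl
        suffix-chain d ds (_ ∷ D₁) refl h = chain-++⁻ʳ d D₁ h .proj₂ , sym (last-++ d D₁ c D₂)

        last-D₂ : last c D₂ ≡ e
        last-D₂ = suffix-chain d ds D₁ eq (chain-init d ds cyc) .proj₂

        tail-chain : Chain c (D₂ ++ T)
        tail-chain = chain-++⁺ c D₂ (suffix-chain d ds D₁ eq (chain-init d ds cyc) .proj₁) (subst (λ z → Chain z T) (sym last-D₂) chain)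

        D₂-nonempty : 0 < length D₂
        D₂-nonempty = nonempty D₂ last-D₂
          where
          nonempty : ∀ D₂ → last c D₂ ≡ e → 0 < length D₂
          nonempty []      c≡e = ⊥-elim (c≢e c≡e)
          nonempty (_ ∷ _) _   = s≤s z≤n

        split : D ++ T ≡ D₁ ++ c ∷ D₂ ++ T
        split = trans (cong (_++ T) eq) (Listₚ.++-assoc D₁ (c ∷ D₂) T)

        uniq-tail : Unique (c ∷ D₂ ++ T)
        uniq-tail = unique-++⁻ D₁ (subst Unique split uniq) .proj₂ .proj₁

        inS-tail : InS (c ∷ D₂ ++ T)
        inS-tail = Allₚ.++⁻ʳ D₁ (subst InS split inS)

        previous : List V → V
        previous []      = c
        previous (q ∷ _) = q

        -- The path leaving the old cycle at `c` meets itself at `z`. The new cycle runs between `w`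
        -- and `z`; its stick goes back to `c`, on along `D₂` to the end `e` of the old cycle, and
        -- then through all of `T`. It is longer because `c ≢ e` makes `D₂` nonempty.
        close : ∀ w Q z → z ≢ previous Q → Edge G w z → z ∈ˡ Q ++ c ∷ [] → Chain w (Q ++ c ∷ []) → Unique (w ∷ Q) → InS (w ∷ Q) →
          (∀ {x} → x ∈ˡ w ∷ Q → x ∉ˡ D ++ T) → ⊥
        close w Q z z≢ wz z∈ h uniqQ inSQ disj with ∈ₚ.∈-∃++ z∈
        ... | Q₁ , Q₂ , eqQ = longer lollipop longer-stick
          where
          whole : w ∷ Q ++ c ∷ D₂ ++ T ≡ (w ∷ Q₁ ++ z ∷ []) ++ Q₂ ++ D₂ ++ T
          whole = cong (w ∷_) (trans (sym (Listₚ.++-assoc Q (c ∷ []) (D₂ ++ T))) (trans (cong (_++ D₂ ++ T) eqQ)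
            (trans (Listₚ.++-assoc Q₁ (z ∷ Q₂) (D₂ ++ T)) (sym (Listₚ.++-assoc Q₁ (z ∷ []) (Q₂ ++ D₂ ++ T))))))
          chain-whole : Chain w ((Q₁ ++ z ∷ []) ++ Q₂ ++ D₂ ++ T)
          chain-whole = subst (Chain w) (trans (Listₚ.++-assoc Q (c ∷ []) (D₂ ++ T)) (Listₚ.∷-injectiveʳ whole))
            (chain-++⁺ w (Q ++ c ∷ []) h (subst (λ v → Chain v (D₂ ++ T)) (sym (last-++ w Q c [])) tail-chain))
          three : ∀ Q Q₁ → z ≢ previous Q → Q ++ c ∷ [] ≡ Q₁ ++ z ∷ Q₂ → 3 ≤ length (w ∷ Q₁ ++ z ∷ [])
          three []      []       z≢ refl = ⊥-elim (z≢ refl)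
          three (_ ∷ _) []       z≢ refl = ⊥-elim (z≢ refl)
          three _       (x ∷ Q₁) z≢ _    = s≤s (s≤s (subst (1 ≤_) (sym (Listₚ.length-++ Q₁)) (ℕₚ.m≤n+m 1 (length Q₁))))
          lollipop : Lollipop w (Q₁ ++ z ∷ []) (Q₂ ++ D₂ ++ T)
          lollipop = record
            { cyc   = chain-snoc w (Q₁ ++ z ∷ []) (chain-++⁻ˡ w (Q₁ ++ z ∷ []) chain-whole)
                        (subst (λ v → Edge G v w) (sym (last-++ w Q₁ z [])) (edge-sym wz))
            ; chain = chain-++⁻ʳ w (Q₁ ++ z ∷ []) chain-whole
            ; uniq  = subst Unique whole (unique-++⁺ uniqQ uniq-tail λ x∈ x∈′ → disj x∈ (subst (_ ∈ˡ_) (sym split) (∈ₚ.∈-++⁺ʳ D₁ x∈′)))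
            ; inS   = subst InS whole (Allₚ.++⁺ inSQ inS-tail)
            ; len   = three Q Q₁ z≢ eqQ
            }
          longer-stick : length T < length (Q₂ ++ D₂ ++ T)
          longer-stick = subst (length T <_) (sym (trans (Listₚ.length-++ Q₂) (cong (length Q₂ +_) (Listₚ.length-++ D₂))))
            (ℕₚ.≤-trans (ℕₚ.+-monoˡ-≤ (length T) D₂-nonempty) (ℕₚ.m≤n+m _ (length Q₂)))

        fresh : ∀ {w z Q} → z ∉ˡ Q ++ c ∷ [] → Edge G w z → All (z ≢_) (w ∷ Q)
        fresh {Q = Q} z∉ wz = (edge-≢ wz ∘ sym) ∷ All.tabulate (λ x∈ eq → z∉ (∈ₚ.∈-++⁺ˡ (subst (_∈ˡ Q) (sym eq) x∈)))

        -- The exit path is prolonged by `second-neighbour` until it meets itself, the cycle or the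
        -- stick, each of which is contradictory. The fuel `m` lasts because a path has at most
        -- `n G` vertices.
        grow : ∀ m w Q → n G < length (w ∷ Q) + m → Chain w (Q ++ c ∷ []) → Unique (w ∷ Q) → InS (w ∷ Q) →
          (∀ {x} → x ∈ˡ w ∷ Q → x ∉ˡ D ++ T) → ⊥
        grow zero    w Q lt h uniqQ inSQ disj = ℕₚ.<⇒≱ lt (subst (_≤ n G) (sym (ℕₚ.+-identityʳ _)) (unique-bound uniqQ))
        grow (suc m) w Q lt h uniqQ (Sw ∷ SQ) disj with second-neighbour Sw (previous Q)
        ... | z , z≢ , wz , Sz with z ∈ˡ? (Q ++ c ∷ []) | z ∈ˡ? D | z ∈ˡ? T
        ... | yes z∈ | _ | _ = close w Q z z≢ wz z∈ h uniqQ (Sw ∷ SQ) disj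
        ... | no z∉Q | yes z∈D | _ = no-ear c∈ z∈D (λ { refl → z∉Q (∈ₚ.∈-++⁺ʳ Q (here refl)) }) (w ∷ Q) (s≤s z≤n) (edge-sym wz , h) uniqQ (Sw ∷ SQ)
          (λ x∈ x∈D → disj x∈ (∈ₚ.∈-++⁺ˡ x∈D))
        ... | no z∉Q | no z∉D | yes z∈T = no-ear-via-stick c∈ c≢e z∈T (w ∷ Q) (edge-sym wz , h) (fresh z∉Q wz ∷ uniqQ) (Sz ∷ Sw ∷ SQ) disj
        ... | no z∉Q | no z∉D | no z∉T = grow m z (w ∷ Q) (subst (n G <_) (ℕₚ.+-suc (length (w ∷ Q)) m) lt) (edge-sym wz , h)
          (fresh z∉Q wz ∷ uniqQ) (Sz ∷ Sw ∷ SQ) λ { (here refl) x∈ → [ z∉D , z∉T ]′ (∈ₚ.∈-++⁻ D x∈) ; (there x∈) x∈′ → disj x∈ x∈′ }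

      no-exit : ∀ {c y} → c ∈ˡ D → c ≢ e → Edge G c y → S y ≡ true → y ∉ˡ D → ⊥
      no-exit {c} {y} c∈D c≢e cy Sy y∉D with ∈ₚ.∈-∃++ c∈D | y ∈ˡ? T
      ... | _ | yes y∈T = no-ear-via-stick c∈D c≢e y∈T [] (edge-sym cy , _) ([] ∷ []) (Sy ∷ []) λ ()
      ... | D₁ , D₂ , eq | no y∉T = grow c≢e D₁ D₂ eq (n G) y [] ℕₚ.≤-refl (edge-sym cy , _) ([] ∷ []) (Sy ∷ [])
        λ { (here refl) x∈ → [ y∉D , y∉T ]′ (∈ₚ.∈-++⁻ D x∈) }

    -- `k` bounds how far the stick can still grow, so this is an induction from long sticks to
    -- short ones. With longer sticks excluded, `no-exit` leaves only N(X) for the outer neighbours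
    -- promised by `CycleInfo`, and the cycle is a leaf.
    no-lollipop : (∀ {d ds} → ¬ Leaf d ds) → ∀ k {d ds T} → n G < length T + k → ¬ Lollipop d ds T
    no-lollipop no-leaf zero {d} {ds} {T} lt L = ℕₚ.<⇒≱ lt (subst (_≤ n G) (sym (ℕₚ.+-identityʳ (length T)))
      (unique-bound (unique-++⁻ (d ∷ ds) (Lollipop.uniq L) .proj₂ .proj₁)))
    no-lollipop no-leaf (suc k) {d} {ds} {T} lt L = cycle-info′ d ds cyc uniqD inSD len λ I → no-leaf record
      { cyc = cyc ; uniq = uniqD ; inW = All.map (inW _) inSD ; odd-length = CycleInfo.odd-length I ; len = len ; type = CycleInfo.type I
      ; attached = λ u∈ u≢ → attach u∈ u≢ (CycleInfo.outer I u∈) }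
      where
      open Lollipop L using (cyc; len)
      open Exits L (λ {_} {_} {T′} L′ lt′ → no-lollipop no-leaf k (ℕₚ.<-≤-trans lt
        (subst (_≤ length T′ + k) (sym (ℕₚ.+-suc (length T) k)) (ℕₚ.+-monoˡ-≤ k lt′))) L′)
      attach : ∀ {u i} → u ∈ˡ D → u ≢ e → (∃ λ y → Edge G u y × y ∉ˡ D × (NX i y ⊎ S y ≡ true)) → ∃ λ x → Edge G u x × NX i x
      attach u∈ u≢ (y , uy , y∉ , inj₁ nx) = y , uy , nx
      attach u∈ u≢ (y , uy , y∉ , inj₂ Sy) = ⊥-elim (no-exit u∈ u≢ uy Sy y∉)

    -- A path in `S` can always be prolonged without turning back, so it finally returns to itself;
    -- the part beyond the return point is the stick.
    lollipop-exists : (∀ {d ds T} → ¬ Lollipop d ds T) → ∀ k w Q → n G < length (w ∷ Q) + k → Chain w Q → Unique (w ∷ Q) → InS (w ∷ Q) → ⊥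
    lollipop-exists none zero    w Q lt h uniqQ inSQ = ℕₚ.<⇒≱ lt (subst (_≤ n G) (sym (ℕₚ.+-identityʳ _)) (unique-bound uniqQ))
    lollipop-exists none (suc k) w Q lt h uniqQ (Sw ∷ SQ) with second-neighbour Sw (next Q)
      where
      next : List V → V
      -- A default for the trivial path: no neighbour of `w` equals `w`, so nothing is excluded.
      next []      = w
      next (q ∷ _) = q
    ... | z , z≢ , wz , Sz with z ∈ˡ? Q
    ... | no z∉  = lollipop-exists none k z (w ∷ Q) (subst (n G <_) (ℕₚ.+-suc (length (w ∷ Q)) k) lt) (edge-sym wz , h)
      (((edge-≢ wz ∘ sym) ∷ All.tabulate (λ x∈ eq → z∉ (subst (_∈ˡ Q) (sym eq) x∈))) ∷ uniqQ) (Sz ∷ Sw ∷ SQ)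
    ... | yes z∈ with ∈ₚ.∈-∃++ z∈
    ...   | []      , Q₂ , refl = z≢ refl
    ...   | q ∷ Q₁ , Q₂ , refl = none record
      { cyc   = chain-snoc w (q ∷ Q₁ ++ z ∷ []) (chain-++⁻ˡ w (q ∷ Q₁ ++ z ∷ []) h′) (subst (λ v → Edge G v w) (sym (last-++ w (q ∷ Q₁) z [])) (edge-sym wz))
      ; chain = chain-++⁻ʳ w (q ∷ Q₁ ++ z ∷ []) h′
      ; uniq  = subst (λ l → Unique (w ∷ l)) assoc uniqQ
      ; inS   = subst (λ l → InS (w ∷ l)) assoc (Sw ∷ SQ)
      ; len   = s≤s (s≤s (subst (1 ≤_) (sym (Listₚ.length-++ Q₁)) (ℕₚ.m≤n+m 1 (length Q₁))))
      }
      where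
      assoc : q ∷ Q₁ ++ z ∷ Q₂ ≡ (q ∷ Q₁ ++ z ∷ []) ++ Q₂
      assoc = sym (Listₚ.++-assoc (q ∷ Q₁) (z ∷ []) Q₂)
      h′ : Chain w ((q ∷ Q₁ ++ z ∷ []) ++ Q₂)
      h′ = subst (Chain w) assoc h

    leaf-exists : ¬ ¬ (∃ λ d → ∃ λ ds → Leaf d ds)
    leaf-exists no-leaf = bad (( λ _ → 0F) , good inW (λ v Sv → ⊥-elim (empty Sv)) (λ u v Su → ⊥-elim (empty Su)))
      where
      empty : ∀ {v} → S v ≡ true → ⊥
      empty {v} Sv = lollipop-exists (no-lollipop (λ L → no-leaf (_ , _ , L)) (suc (n G)) (ℕₚ.≤-trans (ℕₚ.n<1+n (n G)) (ℕₚ.m≤n+m _ _)))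
        (n G) v [] ℕₚ.≤-refl _ ([] ∷ []) (Sv ∷ [])

-- Leaf cycles contain reducible configurations

module Leaves {G : Graph} (C : Critical G) (A : AdmissibleClass G) where
  open Critical C
  open Extension C
  open AdmissibleClass A
  open Colouring C A
  open Reducible
  open Nat using (_≤_; s≤s)
  open Template using (allFin-sound)

  private
    V : Set
    V = Fin (n G)
    variable
      a b c t u v w x y z : V

  saturated : Edge G v a → Edge G v b → Edge G v t → a ≢ b → a ≢ t → b ≢ t → Edge G v z → z ≢ a → z ≢ b → z ≡ t
  saturated {t = t} {z = z} va vb vt a≢b a≢t b≢t vz z≢a z≢b with z Fin.≟ t
  ... | yes eq = eq
  ... | no z≢t = ⊥-elim (no-four vz va vb vt ((z≢a ∷ z≢b ∷ z≢t ∷ []) ∷ (a≢b ∷ a≢t ∷ []) ∷ (b≢t ∷ []) ∷ [] ∷ []))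

  third? : ∀ v a b → Dec (∃ λ t → Edge G v t × t ≢ a × t ≢ b)
  third? v a b = Finₚ.any? λ t → edge? v t ×-dec ¬? (t Fin.≟ a) ×-dec ¬? (t Fin.≟ b)

  -- The value is v if there is no third neighbour.
  third : V → V → V → V
  third v a b with third? v a b
  ... | yes (t , _) = t
  ... | no _        = v

  third-unique : ∀ {v a b z} → Edge G v a → Edge G v b → a ≢ b → Edge G v z → z ≢ a → z ≢ b → z ≡ third v a b
  third-unique {v} {a} {b} {z} va vb a≢b vz z≢a z≢b with third? v a b
  ... | yes (t , vt , t≢a , t≢b) = saturated va vb vt a≢b (t≢a ∘ sym) (t≢b ∘ sym) vz z≢a z≢b
  ... | no none = ⊥-elim (none (z , vz , z≢a , z≢b))

  All-fromList : ∀ {P : V → Set} {l} → All P l → VecAll.All P (Vec.fromList l)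
  All-fromList []       = []ᵃ
  All-fromList (p ∷ ps) = p ∷ᵃ All-fromList ps

  Unique-fromList : ∀ {l : List V} → Unique l → VecUnique.Unique (Vec.fromList l)
  Unique-fromList []       = []ᵖ
  Unique-fromList (p ∷ ps) = All-fromList p ∷ᵖ Unique-fromList ps

  spoke-NX : X c ≡ true → Edge G c x → NX (part c) x
  spoke-NX {c} Xc cx = c , Xc , refl , cx

  distinct : X c ≡ true → ∀ xs ws → All (Edge G c) xs → Unique xs → All W ws → Unique ws →
    ∀ i j → Vec.lookup (c ∷ Vec.fromList xs Vec.++ Vec.fromList ws) i ≡ Vec.lookup (c ∷ Vec.fromList xs Vec.++ Vec.fromList ws) j → i ≡ j
  distinct {c} Xc xs ws cxs uniq Wws uniq′ = VecUniqueₚ.lookup-injective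
    (VecAllₚ.++⁺ (All-fromList (All.map edge-≢ cxs)) (All-fromList (All.map (X≢W Xc) Wws)) ∷ᵖ
     VecAllPairsₚ.++⁺ (Unique-fromList uniq) (Unique-fromList uniq′)
       (VecAll.map (λ cx → VecAll.map (λ Ww → W≢NX Ww (spoke-NX Xc cx) ∘ sym) (All-fromList Wws)) (All-fromList cxs)))

  prefix-unique : ∀ (l : List V) {l′} → Unique (l ++ l′) → Unique l
  prefix-unique []      _        = []
  prefix-unique (x ∷ l) (p ∷ ps) = Allₚ.++⁻ˡ l p ∷ prefix-unique l ps

  module Pentagon {c w₁ w₂ w₃ w₄ w₀ : V} (Xc : X c ≡ true) (cyc : Cyc w₁ (w₂ ∷ w₃ ∷ w₄ ∷ w₀ ∷ []))
    (Ws : All W (w₁ ∷ w₂ ∷ w₃ ∷ w₄ ∷ w₀ ∷ [])) (uniq : Unique (w₁ ∷ w₂ ∷ w₃ ∷ w₄ ∷ w₀ ∷ [])) where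

    private
      e₁₂ : Edge G w₁ w₂
      e₁₂ = cyc .proj₁
      e₂₃ : Edge G w₂ w₃
      e₂₃ = cyc .proj₂ .proj₁
      e₃₄ : Edge G w₃ w₄
      e₃₄ = cyc .proj₂ .proj₂ .proj₁
      e₀₄ : Edge G w₀ w₄
      e₀₄ = edge-sym (cyc .proj₂ .proj₂ .proj₂ .proj₁)
      e₀₁ : Edge G w₀ w₁
      e₀₁ = cyc .proj₂ .proj₂ .proj₂ .proj₂ .proj₁
      Ws₄ = Allₚ.++⁻ˡ (w₁ ∷ w₂ ∷ w₃ ∷ w₄ ∷ []) Ws
      uniq₄ = prefix-unique (w₁ ∷ w₂ ∷ w₃ ∷ w₄ ∷ []) uniq

    -- Both ends have their third neighbour in `w₀`, which can therefore serve as one common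
    -- terminal for them.
    ends-saturated : ∀ {x y} → Edge G c x → Edge G c y → Edge G w₁ x → Edge G w₄ y → x ≢ y →
      (∀ {v} → Edge G w₁ v → v ≢ w₂ → v ≢ x → v ≡ w₀) × (∀ {v} → Edge G w₄ v → v ≢ w₃ → v ≢ y → v ≡ w₀) × ¬ Edge G w₁ w₄
    ends-saturated {x} {y} cx cy a₁ a₄ x≢y = first ,
      (λ e → saturated (edge-sym e₃₄) a₄ (edge-sym e₀₄) (ne (# 5) (# 2)) (ne (# 5) (# 7)) (ne (# 2) (# 7)) e) ,
      λ e → ne (# 6) (# 7) (first e (ne (# 6) (# 4)) (ne (# 6) (# 1)))
      where
      ne : ∀ i j {i≢j : False (i Fin.≟ j)} → Vec.lookup (c ∷ x ∷ y ∷ w₁ ∷ w₂ ∷ w₃ ∷ w₄ ∷ w₀ ∷ []) i ≢ Vec.lookup (c ∷ x ∷ y ∷ w₁ ∷ w₂ ∷ w₃ ∷ w₄ ∷ w₀ ∷ []) j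
      ne i j {i≢j} eq = toWitnessFalse i≢j (distinct Xc (x ∷ y ∷ []) (w₁ ∷ w₂ ∷ w₃ ∷ w₄ ∷ w₀ ∷ []) (cx ∷ cy ∷ []) ((x≢y ∷ []) ∷ [] ∷ []) Ws uniq i j eq)
      first : ∀ {v} → Edge G w₁ v → v ≢ w₂ → v ≢ x → v ≡ w₀
      first e = saturated e₁₂ a₁ (edge-sym e₀₁) (ne (# 4) (# 1)) (ne (# 4) (# 7)) (ne (# 1) (# 7)) e

    xyxy : Edge G c x → Edge G c y → x ≢ y → Edge G w₁ x → Edge G w₂ y → Edge G w₃ x → Edge G w₄ y → ⊥
    xyxy {x} {y} cx cy x≢y a₁ a₂ a₃ a₄ with ends-saturated cx cy a₁ a₄ x≢y
    ... | first , fourth , nonadjacent = irreducible template-xyxy embedding extendable-xyxy (# 0) x cx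
      where
      embedding : Embedding template-xyxy (c ∷ x ∷ y ∷ w₁ ∷ w₂ ∷ w₃ ∷ w₄ ∷ []) (w₀ ∷ third c x y ∷ [])
      embedding = record
        { injective = distinct Xc (x ∷ y ∷ []) (w₁ ∷ w₂ ∷ w₃ ∷ w₄ ∷ []) (cx ∷ cy ∷ []) ((x≢y ∷ []) ∷ [] ∷ []) Ws₄ uniq₄
        ; present   = e₁₂ ∷ e₂₃ ∷ e₃₄ ∷ cx ∷ cy ∷ a₁ ∷ a₂ ∷ a₃ ∷ a₄ ∷ []
        ; closed    = allFin-sound template-xyxy refl
        ; inner     = ((λ e → All.lookup Ws (here refl) .proj₂ _ (spoke-NX Xc e)) ∷
                       (λ e → All.lookup Ws (there (there (there (here refl)))) .proj₂ _ (spoke-NX Xc e)) ∷ []) ∷ (nonadjacent ∷ []) ∷ [] ∷ []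
        ; outer     = (λ v e out → # 1 , refl , third-unique cx cy x≢y e (out (# 1)) (out (# 2)))
                    ∷ (λ v e out → # 0 , refl , first e (out (# 4)) (out (# 1)))
                    ∷ (λ v e out → # 0 , refl , fourth e (out (# 5)) (out (# 2))) ∷ []
        }

    module _ (cx : Edge G c x) (cy : Edge G c y) (cz : Edge G c z) (uniqN : Unique (x ∷ y ∷ z ∷ [])) where
      private
        ne : ∀ i j {i≢j : False (i Fin.≟ j)} → Vec.lookup (c ∷ x ∷ y ∷ z ∷ w₁ ∷ w₂ ∷ w₃ ∷ w₄ ∷ w₀ ∷ []) i ≢ Vec.lookup (c ∷ x ∷ y ∷ z ∷ w₁ ∷ w₂ ∷ w₃ ∷ w₄ ∷ w₀ ∷ []) j
        ne i j {i≢j} eq = toWitnessFalse i≢j (distinct Xc (x ∷ y ∷ z ∷ []) (w₁ ∷ w₂ ∷ w₃ ∷ w₄ ∷ w₀ ∷ []) (cx ∷ cy ∷ cz ∷ []) uniqN Ws uniq i j eq)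

        hub-independent : ∀ {x y} → Edge G c x → Edge G c y → ¬ Edge G x y
        hub-independent cx cy xy = triangle-free _ _ _ (cx , xy , cy)

      xyxz : Edge G w₁ x → Edge G w₂ y → Edge G w₃ x → Edge G w₄ z → ⊥
      -- Among the open vertices y, z, w₀ only the pair y, w₀ may be adjacent; the other two pairs
      -- have a common neighbour, `c` or `w₄`, and would complete a triangle.
      xyxz a₁ a₂ a₃ a₄ with edge? w₀ y
      ... | yes w₀y = irreducible template-xyxz-chord embedding extendable-xyxz-chord (# 0) x cx
        where
        embedding : Embedding template-xyxz-chord (c ∷ x ∷ y ∷ z ∷ w₁ ∷ w₂ ∷ w₃ ∷ w₄ ∷ w₀ ∷ []) (third z c w₄ ∷ [])
        embedding = record
          { injective = distinct Xc (x ∷ y ∷ z ∷ []) (w₁ ∷ w₂ ∷ w₃ ∷ w₄ ∷ w₀ ∷ []) (cx ∷ cy ∷ cz ∷ []) uniqN Ws uniq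
          ; present   = e₁₂ ∷ e₂₃ ∷ e₃₄ ∷ e₀₁ ∷ e₀₄ ∷ cx ∷ cy ∷ cz ∷ a₁ ∷ a₂ ∷ a₃ ∷ a₄ ∷ w₀y ∷ []
          ; closed    = allFin-sound template-xyxz-chord refl
          ; inner     = [] ∷ []
          ; outer     = (λ v e out → # 0 , refl , third-unique (edge-sym cz) (edge-sym a₄) (ne (# 0) (# 7)) e (out (# 0)) (out (# 7))) ∷ []
          }
      ... | no ¬w₀y = irreducible template-xyxz embedding extendable-xyxz (# 0) x cx
        where
        embedding : Embedding template-xyxz (c ∷ x ∷ y ∷ z ∷ w₁ ∷ w₂ ∷ w₃ ∷ w₄ ∷ w₀ ∷ []) (third w₀ w₁ w₄ ∷ third y c w₂ ∷ third z c w₄ ∷ [])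
        embedding = record
          { injective = distinct Xc (x ∷ y ∷ z ∷ []) (w₁ ∷ w₂ ∷ w₃ ∷ w₄ ∷ w₀ ∷ []) (cx ∷ cy ∷ cz ∷ []) uniqN Ws uniq
          ; present   = e₁₂ ∷ e₂₃ ∷ e₃₄ ∷ e₀₁ ∷ e₀₄ ∷ cx ∷ cy ∷ cz ∷ a₁ ∷ a₂ ∷ a₃ ∷ a₄ ∷ []
          ; closed    = allFin-sound template-xyxz refl
          ; inner     = (hub-independent cy cz ∷ ¬w₀y ∘ edge-sym ∷ []) ∷ ((λ e → triangle-free _ _ _ (e , e₀₄ , edge-sym a₄)) ∷ []) ∷ [] ∷ []
          ; outer     = (λ v e out → # 1 , refl , third-unique (edge-sym cy) (edge-sym a₂) (ne (# 0) (# 5)) e (out (# 0)) (out (# 5)))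
                      ∷ (λ v e out → # 2 , refl , third-unique (edge-sym cz) (edge-sym a₄) (ne (# 0) (# 7)) e (out (# 0)) (out (# 7)))
                      ∷ (λ v e out → # 0 , refl , third-unique e₀₁ e₀₄ (ne (# 4) (# 7)) e (out (# 4)) (out (# 7))) ∷ []
          }

      xyzx : Edge G w₁ x → Edge G w₂ y → Edge G w₃ z → Edge G w₄ x → ⊥
      xyzx a₁ a₂ a₃ a₄ = irreducible template-xyzx embedding extendable-xyzx (# 0) x cx
        where
        first : ∀ {v} → Edge G w₁ v → v ≢ w₂ → v ≢ x → v ≡ w₀
        first e = saturated e₁₂ a₁ (edge-sym e₀₁) (ne (# 5) (# 1)) (ne (# 5) (# 8)) (ne (# 1) (# 8)) e
        fourth : ∀ {v} → Edge G w₄ v → v ≢ w₃ → v ≢ x → v ≡ w₀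
        fourth e = saturated (edge-sym e₃₄) a₄ (edge-sym e₀₄) (ne (# 6) (# 1)) (ne (# 6) (# 8)) (ne (# 1) (# 8)) e
        embedding : Embedding template-xyzx (c ∷ x ∷ y ∷ z ∷ w₁ ∷ w₂ ∷ w₃ ∷ w₄ ∷ []) (w₀ ∷ third y c w₂ ∷ third z c w₃ ∷ [])
        embedding = record
          { injective = distinct Xc (x ∷ y ∷ z ∷ []) (w₁ ∷ w₂ ∷ w₃ ∷ w₄ ∷ []) (cx ∷ cy ∷ cz ∷ []) uniqN Ws₄ uniq₄
          ; present   = e₁₂ ∷ e₂₃ ∷ e₃₄ ∷ cx ∷ cy ∷ cz ∷ a₁ ∷ a₂ ∷ a₃ ∷ a₄ ∷ []
          ; closed    = allFin-sound template-xyzx refl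
          ; inner     = (hub-independent cy cz
                         ∷ (λ e → ne (# 2) (# 8) (first (edge-sym e) (ne (# 2) (# 5)) (ne (# 2) (# 1))))
                         ∷ (λ e → ne (# 2) (# 8) (fourth (edge-sym e) (ne (# 2) (# 6)) (ne (# 2) (# 1)))) ∷ [])
                      ∷ ((λ e → ne (# 3) (# 8) (first (edge-sym e) (ne (# 3) (# 5)) (ne (# 3) (# 1))))
                         ∷ (λ e → ne (# 3) (# 8) (fourth (edge-sym e) (ne (# 3) (# 6)) (ne (# 3) (# 1)))) ∷ [])
                      ∷ ((λ e → ne (# 7) (# 8) (first e (ne (# 7) (# 5)) (ne (# 7) (# 1)))) ∷ []) ∷ [] ∷ []
          ; outer     = (λ v e out → # 1 , refl , third-unique (edge-sym cy) (edge-sym a₂) (ne (# 0) (# 5)) e (out (# 0)) (out (# 5)))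
                      ∷ (λ v e out → # 2 , refl , third-unique (edge-sym cz) (edge-sym a₃) (ne (# 0) (# 6)) e (out (# 0)) (out (# 6)))
                      ∷ (λ v e out → # 0 , refl , first e (out (# 5)) (out (# 1)))
                      ∷ (λ v e out → # 0 , refl , fourth e (out (# 6)) (out (# 1))) ∷ []
          }

  module Heptagon {c x y z w₁ w₂ w₃ w₄ w₅ w₆ w₀ : V} (Xc : X c ≡ true) (cyc : Cyc w₁ (w₂ ∷ w₃ ∷ w₄ ∷ w₅ ∷ w₆ ∷ w₀ ∷ []))
    (Ws : All W (w₁ ∷ w₂ ∷ w₃ ∷ w₄ ∷ w₅ ∷ w₆ ∷ w₀ ∷ [])) (uniq : Unique (w₁ ∷ w₂ ∷ w₃ ∷ w₄ ∷ w₅ ∷ w₆ ∷ w₀ ∷ []))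
    (cx : Edge G c x) (cy : Edge G c y) (cz : Edge G c z) (uniqN : Unique (x ∷ y ∷ z ∷ [])) where

    private
      e₁₂ : Edge G w₁ w₂
      e₁₂ = cyc .proj₁
      e₂₃ : Edge G w₂ w₃
      e₂₃ = cyc .proj₂ .proj₁
      e₃₄ : Edge G w₃ w₄
      e₃₄ = cyc .proj₂ .proj₂ .proj₁
      e₄₅ : Edge G w₄ w₅
      e₄₅ = cyc .proj₂ .proj₂ .proj₂ .proj₁
      e₅₆ : Edge G w₅ w₆
      e₅₆ = cyc .proj₂ .proj₂ .proj₂ .proj₂ .proj₁
      e₆₀ : Edge G w₆ w₀
      e₆₀ = cyc .proj₂ .proj₂ .proj₂ .proj₂ .proj₂ .proj₁
      e₀₁ : Edge G w₀ w₁
      e₀₁ = cyc .proj₂ .proj₂ .proj₂ .proj₂ .proj₂ .proj₂ .proj₁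

      vertices : Vec V 10
      vertices = c ∷ x ∷ y ∷ z ∷ w₁ ∷ w₂ ∷ w₃ ∷ w₄ ∷ w₅ ∷ w₆ ∷ []

      injective : ∀ i j → Vec.lookup vertices i ≡ Vec.lookup vertices j → i ≡ j
      injective = distinct Xc (x ∷ y ∷ z ∷ []) (w₁ ∷ w₂ ∷ w₃ ∷ w₄ ∷ w₅ ∷ w₆ ∷ []) (cx ∷ cy ∷ cz ∷ []) uniqN
        (Allₚ.++⁻ˡ (w₁ ∷ w₂ ∷ w₃ ∷ w₄ ∷ w₅ ∷ w₆ ∷ []) Ws) (prefix-unique (w₁ ∷ w₂ ∷ w₃ ∷ w₄ ∷ w₅ ∷ w₆ ∷ []) uniq)

      ne : ∀ i j {i≢j : False (i Fin.≟ j)} → Vec.lookup vertices i ≢ Vec.lookup vertices j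
      ne i j {i≢j} eq = toWitnessFalse i≢j (injective i j eq)

      ≢w₀ : ∀ i → Vec.lookup vertices i ≢ w₀
      ≢w₀ i eq = Finₚ.fromℕ≢inject₁ (sym (distinct Xc (x ∷ y ∷ z ∷ []) (w₁ ∷ w₂ ∷ w₃ ∷ w₄ ∷ w₅ ∷ w₆ ∷ w₀ ∷ []) (cx ∷ cy ∷ cz ∷ []) uniqN Ws uniq
        (Fin.inject₁ i) (Fin.fromℕ 10) (trans (prefix i) eq)))
        where
        prefix : ∀ i → Vec.lookup (c ∷ x ∷ y ∷ z ∷ w₁ ∷ w₂ ∷ w₃ ∷ w₄ ∷ w₅ ∷ w₆ ∷ w₀ ∷ []) (Fin.inject₁ i) ≡ Vec.lookup vertices i
        prefix i = go vertices i
          where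
          go : ∀ {m} (xs : Vec V m) i → Vec.lookup (xs Vec.∷ʳ w₀) (Fin.inject₁ i) ≡ Vec.lookup xs i
          go (x ∷ xs) Fin.zero    = refl
          go (x ∷ xs) (Fin.suc i) = go xs i

      first : ∀ {v} i {5≢i : False (# 5 Fin.≟ i)} → Edge G w₁ (Vec.lookup vertices i) → Edge G w₁ v → v ≢ w₂ → v ≢ Vec.lookup vertices i → v ≡ w₀
      first i {5≢i} a₁ e = saturated e₁₂ a₁ (edge-sym e₀₁)
        (ne (# 5) i {5≢i}) (≢w₀ (# 5)) (≢w₀ i) e

      sixth : ∀ {v} i {8≢i : False (# 8 Fin.≟ i)} → Edge G w₆ (Vec.lookup vertices i) → Edge G w₆ v → v ≢ w₅ → v ≢ Vec.lookup vertices i → v ≡ w₀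
      sixth i {8≢i} a₆ e = saturated (edge-sym e₅₆) a₆ e₆₀
        (ne (# 8) i {8≢i}) (≢w₀ (# 8)) (≢w₀ i) e
    xyxzyz : Edge G w₁ x → Edge G w₂ y → Edge G w₃ x → Edge G w₄ z → Edge G w₅ y → Edge G w₆ z → ⊥
    xyxzyz a₁ a₂ a₃ a₄ a₅ a₆ = irreducible template-xyxzyz embedding extendable-xyxzyz (# 0) x cx
      where
      embedding : Embedding template-xyxzyz vertices (w₀ ∷ [])
      embedding = record
        { injective = injective
        ; present   = e₁₂ ∷ e₂₃ ∷ e₃₄ ∷ e₄₅ ∷ e₅₆ ∷ cx ∷ cy ∷ cz ∷ a₁ ∷ a₂ ∷ a₃ ∷ a₄ ∷ a₅ ∷ a₆ ∷ []
        ; closed    = allFin-sound template-xyxzyz refl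
        ; inner     = ((λ e → ≢w₀ (# 9) (first (# 1) a₁ e (ne (# 9) (# 5)) (ne (# 9) (# 1)))) ∷ []) ∷ [] ∷ []
        ; outer     = (λ v e out → # 0 , refl , first (# 1) a₁ e (out (# 5)) (out (# 1)))
                    ∷ (λ v e out → # 0 , refl , sixth (# 3) a₆ e (out (# 8)) (out (# 3))) ∷ []
        }
    xyzxyz : Edge G w₁ x → Edge G w₂ y → Edge G w₃ z → Edge G w₄ x → Edge G w₅ y → Edge G w₆ z → ⊥
    xyzxyz a₁ a₂ a₃ a₄ a₅ a₆ = irreducible template-xyzxyz embedding extendable-xyzxyz (# 0) x cx
      where
      embedding : Embedding template-xyzxyz vertices (w₀ ∷ [])
      embedding = record
        { injective = injective
        ; present   = e₁₂ ∷ e₂₃ ∷ e₃₄ ∷ e₄₅ ∷ e₅₆ ∷ cx ∷ cy ∷ cz ∷ a₁ ∷ a₂ ∷ a₃ ∷ a₄ ∷ a₅ ∷ a₆ ∷ []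
        ; closed    = allFin-sound template-xyzxyz refl
        ; inner     = ((λ e → ≢w₀ (# 9) (first (# 1) a₁ e (ne (# 9) (# 5)) (ne (# 9) (# 1)))) ∷ []) ∷ [] ∷ []
        ; outer     = (λ v e out → # 0 , refl , first (# 1) a₁ e (out (# 5)) (out (# 1)))
                    ∷ (λ v e out → # 0 , refl , sixth (# 3) a₆ e (out (# 8)) (out (# 3))) ∷ []
        }
    xyzxzy : Edge G w₁ x → Edge G w₂ y → Edge G w₃ z → Edge G w₄ x → Edge G w₅ z → Edge G w₆ y → ⊥
    xyzxzy a₁ a₂ a₃ a₄ a₅ a₆ = irreducible template-xyzxzy embedding extendable-xyzxzy (# 0) x cx
      where
      embedding : Embedding template-xyzxzy vertices (w₀ ∷ [])
      embedding = record
        { injective = injective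
        ; present   = e₁₂ ∷ e₂₃ ∷ e₃₄ ∷ e₄₅ ∷ e₅₆ ∷ cx ∷ cy ∷ cz ∷ a₁ ∷ a₂ ∷ a₃ ∷ a₄ ∷ a₅ ∷ a₆ ∷ []
        ; closed    = allFin-sound template-xyzxzy refl
        ; inner     = ((λ e → ≢w₀ (# 9) (first (# 1) a₁ e (ne (# 9) (# 5)) (ne (# 9) (# 1)))) ∷ []) ∷ [] ∷ []
        ; outer     = (λ v e out → # 0 , refl , first (# 1) a₁ e (out (# 5)) (out (# 1)))
                    ∷ (λ v e out → # 0 , refl , sixth (# 2) a₆ e (out (# 8)) (out (# 2))) ∷ []
        }
    xyzyxz : Edge G w₁ x → Edge G w₂ y → Edge G w₃ z → Edge G w₄ y → Edge G w₅ x → Edge G w₆ z → ⊥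
    xyzyxz a₁ a₂ a₃ a₄ a₅ a₆ = irreducible template-xyzyxz embedding extendable-xyzyxz (# 0) x cx
      where
      embedding : Embedding template-xyzyxz vertices (w₀ ∷ [])
      embedding = record
        { injective = injective
        ; present   = e₁₂ ∷ e₂₃ ∷ e₃₄ ∷ e₄₅ ∷ e₅₆ ∷ cx ∷ cy ∷ cz ∷ a₁ ∷ a₂ ∷ a₃ ∷ a₄ ∷ a₅ ∷ a₆ ∷ []
        ; closed    = allFin-sound template-xyzyxz refl
        ; inner     = ((λ e → ≢w₀ (# 9) (first (# 1) a₁ e (ne (# 9) (# 5)) (ne (# 9) (# 1)))) ∷ []) ∷ [] ∷ []
        ; outer     = (λ v e out → # 0 , refl , first (# 1) a₁ e (out (# 5)) (out (# 1)))
                    ∷ (λ v e out → # 0 , refl , sixth (# 3) a₆ e (out (# 8)) (out (# 3))) ∷ []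
        }
    xyzyzx : Edge G w₁ x → Edge G w₂ y → Edge G w₃ z → Edge G w₄ y → Edge G w₅ z → Edge G w₆ x → ⊥
    xyzyzx a₁ a₂ a₃ a₄ a₅ a₆ = irreducible template-xyzyzx embedding extendable-xyzyzx (# 0) x cx
      where
      embedding : Embedding template-xyzyzx vertices (w₀ ∷ [])
      embedding = record
        { injective = injective
        ; present   = e₁₂ ∷ e₂₃ ∷ e₃₄ ∷ e₄₅ ∷ e₅₆ ∷ cx ∷ cy ∷ cz ∷ a₁ ∷ a₂ ∷ a₃ ∷ a₄ ∷ a₅ ∷ a₆ ∷ []
        ; closed    = allFin-sound template-xyzyzx refl
        ; inner     = ((λ e → ≢w₀ (# 9) (first (# 1) a₁ e (ne (# 9) (# 5)) (ne (# 9) (# 1)))) ∷ []) ∷ [] ∷ []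
        ; outer     = (λ v e out → # 0 , refl , first (# 1) a₁ e (out (# 5)) (out (# 1)))
                    ∷ (λ v e out → # 0 , refl , sixth (# 1) a₆ e (out (# 8)) (out (# 1))) ∷ []
        }
  lookup-injective : ∀ {l : List V} → Unique l → ∀ i j → List.lookup l i ≡ List.lookup l j → i ≡ j
  lookup-injective (p ∷ ps) Fin.zero    Fin.zero    eq = refl
  lookup-injective (p ∷ ps) Fin.zero    (Fin.suc j) eq = ⊥-elim (All.lookup p (∈ₚ.∈-lookup j) eq)
  lookup-injective (p ∷ ps) (Fin.suc i) Fin.zero    eq = ⊥-elim (All.lookup p (∈ₚ.∈-lookup i) (sym eq))
  lookup-injective (p ∷ ps) (Fin.suc i) (Fin.suc j) eq = cong Fin.suc (lookup-injective ps i j eq)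

  Spoke : V → V → Set
  Spoke c w = ∃ λ x → Edge G c x × Edge G w x

  -- By same-centre, consecutive vertices have the same vertex of X at distance two.
  spokes-along : ∀ {i c} w ws → X c ≡ true → part c ≡ i → Spoke c w → Chain w ws → All W (w ∷ ws) →
    All (λ u → ∃ λ x → Edge G u x × NX i x) ws → All (Spoke c) (w ∷ ws)
  spokes-along w []       Xc pc s _       _              []                                      = s ∷ []
  spokes-along w (z ∷ ws) Xc pc s@(x , cx , wx) (e , h) (Ww ∷ Wz ∷ Wws) ((y , zy , c′ , Xc′ , pc′ , c′y) ∷ att)
    with same-centre Ww Wz e Xc Xc′ (trans pc (sym pc′)) cx wx c′y zy
  ... | refl = s ∷ spokes-along z ws Xc pc (y , c′y , zy) h (Wz ∷ Wws) att

  spokes : ∀ {i} w ws → Chain w ws → All W (w ∷ ws) → All (λ u → ∃ λ x → Edge G u x × NX i x) (w ∷ ws) →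
    ∃ λ c → X c ≡ true × All (Spoke c) (w ∷ ws)
  spokes w ws h Ws ((x , wx , c , Xc , pc , cx) ∷ att) = c , Xc , spokes-along w ws Xc pc (x , cx , wx) h Ws att

  hub : Edge G c a → Edge G c b → Edge G c t → Unique (a ∷ b ∷ t ∷ []) → Edge G c v → v ≡ a ⊎ v ≡ b ⊎ v ≡ t
  hub {a = a} {b} {v = v} ca cb ct ((a≢b ∷ a≢t ∷ []) ∷ (b≢t ∷ []) ∷ _) cv with v Fin.≟ a | v Fin.≟ b
  ... | yes eq | _      = inj₁ eq
  ... | no _   | yes eq = inj₂ (inj₁ eq)
  ... | no v≢a | no v≢b = inj₂ (inj₂ (saturated ca cb ct a≢b a≢t b≢t cv v≢a v≢b))

  spokes-≢ : Edge G v w → Edge G v x → Edge G w y → x ≢ y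
  spokes-≢ vw vx wy refl = triangle-free _ _ _ (vw , wy , vx)

  -- One of the at most three edges at `x` leads to `c`.
  at-most-two : X c ≡ true → Edge G c x → W u → W v → W w → Unique (u ∷ v ∷ w ∷ []) →
    Edge G u x → Edge G v x → Edge G w x → ⊥
  at-most-two Xc cx Wu Wv Ww uniq ux vx wx = no-four (edge-sym cx) (edge-sym ux) (edge-sym vx) (edge-sym wx)
    ((X≢W Xc Wu ∷ X≢W Xc Wv ∷ X≢W Xc Ww ∷ []) ∷ uniq)

  -- Neighbouring entries differ by triangle-freeness and `c` has at most three neighbours; these
  -- are the resulting words of length four up to renaming.
  data Four (x₁ x₂ x₃ x₄ : V) : Set where
    xyxy : x₃ ≡ x₁ → x₄ ≡ x₂ → Four x₁ x₂ x₃ x₄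
    xyxz : x₃ ≡ x₁ → Unique (x₁ ∷ x₂ ∷ x₄ ∷ []) → Four x₁ x₂ x₃ x₄
    xyzx : x₄ ≡ x₁ → Unique (x₁ ∷ x₂ ∷ x₃ ∷ []) → Four x₁ x₂ x₃ x₄
    xyzy : x₄ ≡ x₂ → Unique (x₁ ∷ x₂ ∷ x₃ ∷ []) → Four x₁ x₂ x₃ x₄

  four : ∀ {x₁ x₂ x₃ x₄} → Edge G c x₁ → Edge G c x₂ → Edge G c x₃ → Edge G c x₄ → x₁ ≢ x₂ → x₂ ≢ x₃ → x₃ ≢ x₄ → Four x₁ x₂ x₃ x₄
  four {x₁ = x₁} {x₂} {x₃} {x₄} c₁ c₂ c₃ c₄ ≢₁₂ ≢₂₃ ≢₃₄ with x₃ Fin.≟ x₁ | x₄ Fin.≟ x₂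
  ... | yes p    | yes q = xyxy p q
  ... | yes refl | no q  = xyxz refl ((≢₁₂ ∷ ≢₃₄ ∷ []) ∷ ((q ∘ sym) ∷ []) ∷ [] ∷ [])
  ... | no p     | yes q = xyzy q ((≢₁₂ ∷ (p ∘ sym) ∷ []) ∷ (≢₂₃ ∷ []) ∷ [] ∷ [])
  ... | no p     | no q with hub c₁ c₂ c₃ ((≢₁₂ ∷ (p ∘ sym) ∷ []) ∷ (≢₂₃ ∷ []) ∷ [] ∷ []) c₄
  ...   | inj₁ eq          = xyzx eq ((≢₁₂ ∷ (p ∘ sym) ∷ []) ∷ (≢₂₃ ∷ []) ∷ [] ∷ [])
  ...   | inj₂ (inj₁ eq)   = ⊥-elim (q eq)
  ...   | inj₂ (inj₂ refl) = ⊥-elim (≢₃₄ refl)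

  -- By `at-most-two` each of three letters occurs exactly twice, never next to itself; up to
  -- renaming there are five such words.
  data Six (x₁ x₂ x₃ x₄ x₅ x₆ : V) : Set where
    xyxzyz : x₃ ≡ x₁ → x₅ ≡ x₂ → x₆ ≡ x₄ → Unique (x₁ ∷ x₂ ∷ x₄ ∷ []) → Six x₁ x₂ x₃ x₄ x₅ x₆
    xyzxyz : x₄ ≡ x₁ → x₅ ≡ x₂ → x₆ ≡ x₃ → Unique (x₁ ∷ x₂ ∷ x₃ ∷ []) → Six x₁ x₂ x₃ x₄ x₅ x₆
    xyzxzy : x₄ ≡ x₁ → x₅ ≡ x₃ → x₆ ≡ x₂ → Unique (x₁ ∷ x₂ ∷ x₃ ∷ []) → Six x₁ x₂ x₃ x₄ x₅ x₆
    xyzyxz : x₄ ≡ x₂ → x₅ ≡ x₁ → x₆ ≡ x₃ → Unique (x₁ ∷ x₂ ∷ x₃ ∷ []) → Six x₁ x₂ x₃ x₄ x₅ x₆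
    xyzyzx : x₄ ≡ x₂ → x₅ ≡ x₃ → x₆ ≡ x₁ → Unique (x₁ ∷ x₂ ∷ x₃ ∷ []) → Six x₁ x₂ x₃ x₄ x₅ x₆

  module Spine {c w₁ w₂ w₃ w₄ w₅ w₆ x₁ x₂ x₃ x₄ x₅ x₆ : V} (Xc : X c ≡ true) {l : List V}
    (h : Chain w₁ (w₂ ∷ w₃ ∷ w₄ ∷ w₅ ∷ w₆ ∷ l)) (Ws : All W (w₁ ∷ w₂ ∷ w₃ ∷ w₄ ∷ w₅ ∷ w₆ ∷ l)) (uniq : Unique (w₁ ∷ w₂ ∷ w₃ ∷ w₄ ∷ w₅ ∷ w₆ ∷ l))
    (c₁ : Edge G c x₁) (a₁ : Edge G w₁ x₁) (c₂ : Edge G c x₂) (a₂ : Edge G w₂ x₂) (c₃ : Edge G c x₃) (a₃ : Edge G w₃ x₃)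
    (c₄ : Edge G c x₄) (a₄ : Edge G w₄ x₄) (c₅ : Edge G c x₅) (a₅ : Edge G w₅ x₅) (c₆ : Edge G c x₆) (a₆ : Edge G w₆ x₆) where

    ws : List V
    ws = w₁ ∷ w₂ ∷ w₃ ∷ w₄ ∷ w₅ ∷ w₆ ∷ l

    over : ∀ (i j k : Fin (length ws)) {i≢j : False (i Fin.≟ j)} {i≢k : False (i Fin.≟ k)} {j≢k : False (j Fin.≟ k)} → ∀ {x} → Edge G c x →
      Edge G (List.lookup ws i) x → Edge G (List.lookup ws j) x →
      Edge G (List.lookup ws k) x → ⊥
    over i j k {i≢j} {i≢k} {j≢k} cx = at-most-two Xc cx (All.lookup Ws (∈ₚ.∈-lookup i)) (All.lookup Ws (∈ₚ.∈-lookup j)) (All.lookup Ws (∈ₚ.∈-lookup k))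
      ((ne i j i≢j ∷ ne i k i≢k ∷ []) ∷ (ne j k j≢k ∷ []) ∷ [] ∷ [])
      where
      ne : ∀ i j → False (i Fin.≟ j) → List.lookup ws i ≢ List.lookup ws j
      ne i j i≢j eq = toWitnessFalse i≢j (lookup-injective uniq i j eq)

    six : Six x₁ x₂ x₃ x₄ x₅ x₆
    six = go (four c₁ c₂ c₃ c₄ ≢₁₂ (spokes-≢ (h .proj₂ .proj₁) a₂ a₃) (spokes-≢ (h .proj₂ .proj₂ .proj₁) a₃ a₄)) c₂ a₂ c₃ a₃ c₄ a₄ c₅ a₅ c₆ a₆ ≢₁₂ ≢₄₅ ≢₅₆
      where
      ≢₁₂ : x₁ ≢ x₂
      ≢₁₂ = spokes-≢ (h .proj₁) a₁ a₂
      ≢₄₅ : x₄ ≢ x₅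
      ≢₄₅ = spokes-≢ (h .proj₂ .proj₂ .proj₂ .proj₁) a₄ a₅
      ≢₅₆ : x₅ ≢ x₆
      ≢₅₆ = spokes-≢ (h .proj₂ .proj₂ .proj₂ .proj₂ .proj₁) a₅ a₆
      go : ∀ {x₂ x₃ x₄ x₅ x₆} → Four x₁ x₂ x₃ x₄ → Edge G c x₂ → Edge G w₂ x₂ → Edge G c x₃ → Edge G w₃ x₃ → Edge G c x₄ → Edge G w₄ x₄ →
        Edge G c x₅ → Edge G w₅ x₅ → Edge G c x₆ → Edge G w₆ x₆ → x₁ ≢ x₂ → x₄ ≢ x₅ → x₅ ≢ x₆ → Six x₁ x₂ x₃ x₄ x₅ x₆
      go {x₅ = x₅} (xyxy refl refl) c₂ a₂ c₃ a₃ c₄ a₄ c₅ a₅ c₆ a₆ ≢₁₂ ≢₄₅ ≢₅₆ with x₅ Fin.≟ x₁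
      ... | yes refl = ⊥-elim (over (# 0) (# 2) (# 4) c₁ a₁ a₃ a₅)
      ... | no x₅≢x₁ with hub c₁ c₂ c₅ ((≢₁₂ ∷ (x₅≢x₁ ∘ sym) ∷ []) ∷ (≢₄₅ ∷ []) ∷ [] ∷ []) c₆
      ...   | inj₁ refl        = ⊥-elim (over (# 0) (# 2) (# 5) c₁ a₁ a₃ a₆)
      ...   | inj₂ (inj₁ refl) = ⊥-elim (over (# 1) (# 3) (# 5) c₂ a₂ a₄ a₆)
      ...   | inj₂ (inj₂ refl) = ⊥-elim (≢₅₆ refl)
      go (xyxz refl uniqN) c₂ a₂ c₃ a₃ c₄ a₄ c₅ a₅ c₆ a₆ ≢₁₂ ≢₄₅ ≢₅₆ with hub c₁ c₂ c₄ uniqN c₅ | hub c₁ c₂ c₄ uniqN c₆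
      ... | inj₁ refl        | _                = ⊥-elim (over (# 0) (# 2) (# 4) c₁ a₁ a₃ a₅)
      ... | inj₂ (inj₂ refl) | _                = ⊥-elim (≢₄₅ refl)
      ... | inj₂ (inj₁ refl) | inj₁ refl        = ⊥-elim (over (# 0) (# 2) (# 5) c₁ a₁ a₃ a₆)
      ... | inj₂ (inj₁ refl) | inj₂ (inj₁ refl) = ⊥-elim (≢₅₆ refl)
      ... | inj₂ (inj₁ refl) | inj₂ (inj₂ refl) = xyxzyz refl refl refl uniqN
      go (xyzx refl uniqN) c₂ a₂ c₃ a₃ c₄ a₄ c₅ a₅ c₆ a₆ ≢₁₂ ≢₄₅ ≢₅₆ with hub c₁ c₂ c₃ uniqN c₅ | hub c₁ c₂ c₃ uniqN c₆
      ... | inj₁ refl        | _                = ⊥-elim (≢₄₅ refl)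
      ... | inj₂ _           | inj₁ refl        = ⊥-elim (over (# 0) (# 3) (# 5) c₁ a₁ a₄ a₆)
      ... | inj₂ (inj₁ refl) | inj₂ (inj₁ refl) = ⊥-elim (≢₅₆ refl)
      ... | inj₂ (inj₁ refl) | inj₂ (inj₂ refl) = xyzxyz refl refl refl uniqN
      ... | inj₂ (inj₂ refl) | inj₂ (inj₁ refl) = xyzxzy refl refl refl uniqN
      ... | inj₂ (inj₂ refl) | inj₂ (inj₂ refl) = ⊥-elim (≢₅₆ refl)
      go (xyzy refl uniqN) c₂ a₂ c₃ a₃ c₄ a₄ c₅ a₅ c₆ a₆ ≢₁₂ ≢₄₅ ≢₅₆ with hub c₁ c₂ c₃ uniqN c₅ | hub c₁ c₂ c₃ uniqN c₆
      ... | inj₂ (inj₁ refl) | _                = ⊥-elim (≢₄₅ refl)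
      ... | _                | inj₂ (inj₁ refl) = ⊥-elim (over (# 1) (# 3) (# 5) c₂ a₂ a₄ a₆)
      ... | inj₁ refl        | inj₁ refl        = ⊥-elim (≢₅₆ refl)
      ... | inj₁ refl        | inj₂ (inj₂ refl) = xyzyxz refl refl refl uniqN
      ... | inj₂ (inj₂ refl) | inj₁ refl        = xyzyzx refl refl refl uniqN
      ... | inj₂ (inj₂ refl) | inj₂ (inj₂ refl) = ⊥-elim (≢₅₆ refl)

  -- Three neighbours of `c` with at most two attached vertices each serve only six.
  no-seven : ∀ {w₁ w₂ w₃ w₄ w₅ w₆ w₇} → X c ≡ true → Chain w₁ (w₂ ∷ w₃ ∷ w₄ ∷ w₅ ∷ w₆ ∷ w₇ ∷ []) →
    All W (w₁ ∷ w₂ ∷ w₃ ∷ w₄ ∷ w₅ ∷ w₆ ∷ w₇ ∷ []) → Unique (w₁ ∷ w₂ ∷ w₃ ∷ w₄ ∷ w₅ ∷ w₆ ∷ w₇ ∷ []) →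
    ¬ All (Spoke c) (w₁ ∷ w₂ ∷ w₃ ∷ w₄ ∷ w₅ ∷ w₆ ∷ w₇ ∷ [])
  no-seven {w₁ = w₁} {w₂} {w₃} {w₄} {w₅} {w₆} Xc h Ws uniq ((x₁ , c₁ , a₁) ∷ (x₂ , c₂ , a₂) ∷ (x₃ , c₃ , a₃) ∷ (x₄ , c₄ , a₄) ∷ (x₅ , c₅ , a₅) ∷ (x₆ , c₆ , a₆) ∷ (x₇ , c₇ , a₇) ∷ [])
    = seventh (Spine.six Xc h Ws uniq c₁ a₁ c₂ a₂ c₃ a₃ c₄ a₄ c₅ a₅ c₆ a₆) a₁ a₂ a₃ a₄ a₅ a₆
    where
    over = Spine.over Xc h Ws uniq c₁ a₁ c₂ a₂ c₃ a₃ c₄ a₄ c₅ a₅ c₆ a₆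
    seventh : Six x₁ x₂ x₃ x₄ x₅ x₆ → Edge G w₁ x₁ → Edge G w₂ x₂ → Edge G w₃ x₃ → Edge G w₄ x₄ → Edge G w₅ x₅ → Edge G w₆ x₆ → ⊥
    seventh (xyxzyz refl refl refl uniqN) a₁ a₂ a₃ a₄ a₅ a₆ with hub c₁ c₂ c₄ uniqN c₇
    ... | inj₁ refl = over (# 0) (# 2) (# 6) c₁ a₁ a₃ a₇
    ... | inj₂ (inj₁ refl) = over (# 1) (# 4) (# 6) c₂ a₂ a₅ a₇
    ... | inj₂ (inj₂ refl) = over (# 3) (# 5) (# 6) c₄ a₄ a₆ a₇
    seventh (xyzxyz refl refl refl uniqN) a₁ a₂ a₃ a₄ a₅ a₆ with hub c₁ c₂ c₃ uniqN c₇
    ... | inj₁ refl = over (# 0) (# 3) (# 6) c₁ a₁ a₄ a₇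
    ... | inj₂ (inj₁ refl) = over (# 1) (# 4) (# 6) c₂ a₂ a₅ a₇
    ... | inj₂ (inj₂ refl) = over (# 2) (# 5) (# 6) c₃ a₃ a₆ a₇
    seventh (xyzxzy refl refl refl uniqN) a₁ a₂ a₃ a₄ a₅ a₆ with hub c₁ c₂ c₃ uniqN c₇
    ... | inj₁ refl = over (# 0) (# 3) (# 6) c₁ a₁ a₄ a₇
    ... | inj₂ (inj₁ refl) = over (# 1) (# 5) (# 6) c₂ a₂ a₆ a₇
    ... | inj₂ (inj₂ refl) = over (# 2) (# 4) (# 6) c₃ a₃ a₅ a₇
    seventh (xyzyxz refl refl refl uniqN) a₁ a₂ a₃ a₄ a₅ a₆ with hub c₁ c₂ c₃ uniqN c₇
    ... | inj₁ refl = over (# 0) (# 4) (# 6) c₁ a₁ a₅ a₇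
    ... | inj₂ (inj₁ refl) = over (# 1) (# 3) (# 6) c₂ a₂ a₄ a₇
    ... | inj₂ (inj₂ refl) = over (# 2) (# 5) (# 6) c₃ a₃ a₆ a₇
    seventh (xyzyzx refl refl refl uniqN) a₁ a₂ a₃ a₄ a₅ a₆ with hub c₁ c₂ c₃ uniqN c₇
    ... | inj₁ refl = over (# 0) (# 5) (# 6) c₁ a₁ a₆ a₇
    ... | inj₂ (inj₁ refl) = over (# 1) (# 3) (# 6) c₂ a₂ a₄ a₇
    ... | inj₂ (inj₂ refl) = over (# 2) (# 4) (# 6) c₃ a₃ a₅ a₇

  last-∈ : ∀ v vs → last v vs ∈ˡ v ∷ vs
  last-∈ v []       = here refl
  last-∈ v (w ∷ vs) = there (last-∈ w vs)

  -- The exceptional vertex is the last one, and `e` keeps the prefix proper.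
  attached-prefix : ∀ {d ds} (L : Leaf d ds) ws {e rest} → d ∷ ds ≡ ws ++ e ∷ rest →
    All (λ u → ∃ λ x → Edge G u x × NX (Leaf.type L) x) ws
  attached-prefix {d} {ds} L ws {e} {rest} eq = All.tabulate λ {u} u∈ → Leaf.attached L (subst (u ∈ˡ_) (sym eq) (∈ₚ.∈-++⁺ˡ u∈))
    λ u≡last → separate ws (subst Unique eq (Leaf.uniq L)) u∈ (subst (_∈ˡ e ∷ rest) (sym (trans u≡last (last-eq ws eq))) (last-∈ e rest))
    where
    last-eq : ∀ ws → d ∷ ds ≡ ws ++ e ∷ rest → last d ds ≡ last e rest
    last-eq []       refl = refl
    last-eq (w ∷ ws) refl = last-++ d ws e rest
    separate : ∀ ws → Unique (ws ++ e ∷ rest) → ∀ {u} → u ∈ˡ ws → u ∉ˡ e ∷ rest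
    separate (w ∷ ws) (p ∷ ps) (here refl) u∈ = All.lookup (Allₚ.++⁻ʳ ws p) u∈ refl
    separate (w ∷ ws) (p ∷ ps) (there u∈′) u∈ = separate ws ps u∈′ u∈

  no-leaf : ∀ {d ds} → ¬ Leaf d ds
  no-leaf {d} {[]} L with s≤s () ← Leaf.len L
  no-leaf {d} {_ ∷ []} L with s≤s (s≤s ()) ← Leaf.len L
  no-leaf {d} {a ∷ b ∷ []} L with Leaf.cyc L
  ... | da , ab , bd , _ = triangle-free d a b (da , ab , edge-sym bd)
  no-leaf {d} {_ ∷ _ ∷ _ ∷ []} L with () ← Leaf.odd-length L
  no-leaf {w₁} {w₂ ∷ w₃ ∷ w₄ ∷ w₀ ∷ []} L with Leaf.cyc L | Leaf.inW L | Leaf.uniq L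
    | spokes w₁ (w₂ ∷ w₃ ∷ w₄ ∷ []) (chain-++⁻ˡ w₁ (w₂ ∷ w₃ ∷ w₄ ∷ []) (Leaf.cyc L)) (Allₚ.++⁻ˡ (w₁ ∷ w₂ ∷ w₃ ∷ w₄ ∷ []) (Leaf.inW L))
        (attached-prefix L (w₁ ∷ w₂ ∷ w₃ ∷ w₄ ∷ []) refl)
  ... | cyc@(e₁₂ , e₂₃ , e₃₄ , e₄₀ , e₀₁ , _) | Ws@(W₁ ∷ W₂ ∷ W₃ ∷ W₄ ∷ W₀ ∷ []) | uniq
      | c , Xc , (x₁ , c₁ , a₁) ∷ (x₂ , c₂ , a₂) ∷ (x₃ , c₃ , a₃) ∷ (x₄ , c₄ , a₄) ∷ []
    with four c₁ c₂ c₃ c₄ (spokes-≢ e₁₂ a₁ a₂) (spokes-≢ e₂₃ a₂ a₃) (spokes-≢ e₃₄ a₃ a₄)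
  ... | xyxy refl refl  = Pentagon.xyxy Xc cyc Ws uniq c₁ c₂ (spokes-≢ e₁₂ a₁ a₂) a₁ a₂ a₃ a₄
  ... | xyxz refl uniqN = Pentagon.xyxz Xc cyc Ws uniq c₁ c₂ c₄ uniqN a₁ a₂ a₃ a₄
  ... | xyzx refl uniqN = Pentagon.xyzx Xc cyc Ws uniq c₁ c₂ c₃ uniqN a₁ a₂ a₃ a₄
  -- Read backwards, the pattern xyzy is xyxz.
  ... | xyzy refl ((≢₁₂ ∷ ≢₁₃ ∷ []) ∷ (≢₂₃ ∷ []) ∷ _) = Pentagon.xyxz Xc
    (edge-sym e₃₄ , edge-sym e₂₃ , edge-sym e₁₂ , edge-sym e₀₁ , edge-sym e₄₀ , _) (W₄ ∷ W₃ ∷ W₂ ∷ W₁ ∷ W₀ ∷ [])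
    (reverse-unique uniq) c₂ c₃ c₁ ((≢₂₃ ∷ (≢₁₂ ∘ sym) ∷ []) ∷ ((≢₁₃ ∘ sym) ∷ []) ∷ [] ∷ []) a₄ a₃ a₂ a₁
    where
    reverse-unique : ∀ {a b c d e : V} → Unique (a ∷ b ∷ c ∷ d ∷ e ∷ []) → Unique (d ∷ c ∷ b ∷ a ∷ e ∷ [])
    reverse-unique ((ab ∷ ac ∷ ad ∷ ae ∷ []) ∷ (bc ∷ bd ∷ be ∷ []) ∷ (cd ∷ ce ∷ []) ∷ (de ∷ []) ∷ [] ∷ []) =
      ((cd ∘ sym) ∷ (bd ∘ sym) ∷ (ad ∘ sym) ∷ de ∷ []) ∷ ((bc ∘ sym) ∷ (ac ∘ sym) ∷ ce ∷ []) ∷ ((ab ∘ sym) ∷ be ∷ []) ∷ (ae ∷ []) ∷ [] ∷ []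
  no-leaf {d} {_ ∷ _ ∷ _ ∷ _ ∷ _ ∷ []} L with () ← Leaf.odd-length L
  no-leaf {w₁} {w₂ ∷ w₃ ∷ w₄ ∷ w₅ ∷ w₆ ∷ w₀ ∷ []} L with Leaf.cyc L | Leaf.inW L | Leaf.uniq L
    | spokes w₁ (w₂ ∷ w₃ ∷ w₄ ∷ w₅ ∷ w₆ ∷ []) (chain-++⁻ˡ w₁ (w₂ ∷ w₃ ∷ w₄ ∷ w₅ ∷ w₆ ∷ []) (Leaf.cyc L))
        (Allₚ.++⁻ˡ (w₁ ∷ w₂ ∷ w₃ ∷ w₄ ∷ w₅ ∷ w₆ ∷ []) (Leaf.inW L)) (attached-prefix L (w₁ ∷ w₂ ∷ w₃ ∷ w₄ ∷ w₅ ∷ w₆ ∷ []) refl)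
  ... | cyc | Ws | uniq
      | c , Xc , (x₁ , c₁ , a₁) ∷ (x₂ , c₂ , a₂) ∷ (x₃ , c₃ , a₃) ∷ (x₄ , c₄ , a₄) ∷ (x₅ , c₅ , a₅) ∷ (x₆ , c₆ , a₆) ∷ []
    with Spine.six Xc (chain-init w₁ (w₂ ∷ w₃ ∷ w₄ ∷ w₅ ∷ w₆ ∷ w₀ ∷ []) cyc) Ws uniq c₁ a₁ c₂ a₂ c₃ a₃ c₄ a₄ c₅ a₅ c₆ a₆
  ... | xyxzyz refl refl refl uniqN = Heptagon.xyxzyz Xc cyc Ws uniq c₁ c₂ c₄ uniqN a₁ a₂ a₃ a₄ a₅ a₆
  ... | xyzxyz refl refl refl uniqN = Heptagon.xyzxyz Xc cyc Ws uniq c₁ c₂ c₃ uniqN a₁ a₂ a₃ a₄ a₅ a₆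
  ... | xyzxzy refl refl refl uniqN = Heptagon.xyzxzy Xc cyc Ws uniq c₁ c₂ c₃ uniqN a₁ a₂ a₃ a₄ a₅ a₆
  ... | xyzyxz refl refl refl uniqN = Heptagon.xyzyxz Xc cyc Ws uniq c₁ c₂ c₃ uniqN a₁ a₂ a₃ a₄ a₅ a₆
  ... | xyzyzx refl refl refl uniqN = Heptagon.xyzyzx Xc cyc Ws uniq c₁ c₂ c₃ uniqN a₁ a₂ a₃ a₄ a₅ a₆
  no-leaf {d} {_ ∷ _ ∷ _ ∷ _ ∷ _ ∷ _ ∷ _ ∷ []} L with () ← Leaf.odd-length L
  -- From nine vertices on, the first seven are attached and give a contradiction whatever follows.
  no-leaf {w₁} {w₂ ∷ w₃ ∷ w₄ ∷ w₅ ∷ w₆ ∷ w₇ ∷ w₈ ∷ rest@(_ ∷ _)} L = no-seven (S .proj₂ .proj₁) h Ws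
    (prefix-unique (w₁ ∷ l) (Leaf.uniq L)) (S .proj₂ .proj₂)
    where
    l = w₂ ∷ w₃ ∷ w₄ ∷ w₅ ∷ w₆ ∷ w₇ ∷ []
    h = chain-++⁻ˡ w₁ l (Leaf.cyc L)
    Ws = Allₚ.++⁻ˡ (w₁ ∷ l) (Leaf.inW L)
    S = spokes w₁ l h Ws (attached-prefix L (w₁ ∷ l) refl)

-- Three colour classes from one admissible set

module ClassColouring {G : Graph} (C : Critical G) (A : AdmissibleClass G) where
  open AdmissibleClass A
  open Extension C using (edge-sym)
  open Colouring C A
  open Fractional G using (VSet; Independent; multiplicity)
  open Nat using (_≤_; _<_; z≤n; s≤s)

  -- Induction on the size: if all smaller sets are colourable, an uncolourable `S` is minimal and
  -- would contain a leaf.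
  all-colourable : ∀ k S → size S < k → (∀ v → S v ≡ true → W v) → ¬ ¬ Colourable S
  all-colourable (suc k) S (s≤s le) inW bad = Minimal.leaf-exists S inW
    (λ T T⊆W lt → all-colourable k T (ℕₚ.<-≤-trans lt le) T⊆W) bad λ (_ , _ , L) → Leaves.no-leaf C A L

  W? : ∀ v → Dec (W v)
  W? v = (X v Boolₚ.≟ false) ×-dec Finₚ.all? λ i → ¬? (NX? i v)

  isolated? : ∀ v → Dec (∀ w → ¬ Edge G v w)
  isolated? v = Finₚ.all? λ w → ¬? (edge? v w)

  -- A vertex of X gets the two colours other than that of its part, any other vertex its own colour, and an isolated vertex all three.
  entry : Bool → Bool → Fin 3 → Fin 3 → Fin 3 → Bool
  entry isolated inX i colour j = isolated ∨ (if inX then not (does (i Fin.≟ j)) else does (colour Fin.≟ j))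

  tally : Bool → Bool → Fin 3 → Fin 3 → ℕ
  tally isolated inX i colour = cnt (entry isolated inX i colour) (0F ∷ 1F ∷ 2F ∷ [])

  tally-twice : ∀ isolated i colour → 2 ≤ tally isolated true i colour
  tally-twice true  _  _ = s≤s (s≤s z≤n)
  tally-twice false 0F _ = s≤s (s≤s z≤n)
  tally-twice false 1F _ = s≤s (s≤s z≤n)
  tally-twice false 2F _ = s≤s (s≤s z≤n)

  tally-once : ∀ isolated inX i colour → 1 ≤ tally isolated inX i colour
  tally-once isolated true  i colour = ℕₚ.≤-trans (s≤s z≤n) (tally-twice isolated i colour)
  tally-once true     false _ _  = s≤s z≤n
  tally-once false    false _ 0F = s≤s z≤n
  tally-once false    false _ 1F = s≤s z≤n
  tally-once false    false _ 2F = s≤s z≤n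

  module _ {c : Fin (n G) → Fin 3} (g : Good (λ v → does (W? v)) c) where
    open Good g

    colour-of : Fin (n G) → Fin 3
    colour-of v with Finₚ.any? (λ i → NX? i v)
    ... | yes (i , _) = i
    ... | no _        = c v

    carries : Fin 3 → Fin (n G) → Bool
    carries j v = entry false (X v) (part v) (colour-of v) j

    class : Fin 3 → VSet
    class j v = entry (does (isolated? v)) (X v) (part v) (colour-of v) j

    colour-of-NX : ∀ {i v} → NX i v → colour-of v ≡ i
    colour-of-NX {i} {v} nx with Finₚ.any? (λ i → NX? i v)
    ... | yes (_ , nx′) = NX-type nx′ nx
    ... | no none       = ⊥-elim (none (i , nx))

    colour-of-proper : ∀ u v → X u ≡ false → X v ≡ false → Edge G u v → colour-of u ≢ colour-of v
    colour-of-proper u v Xu Xv e with Finₚ.any? (λ i → NX? i u) | Finₚ.any? (λ i → NX? i v)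
    ... | yes (_ , nu) | yes (_ , nv) = λ { refl → NX-independent nu nv e }
    ... | yes (_ , nu) | no none      = λ { refl → listed v (dec-true (W? v) (Xv , λ i nx → none (i , nx))) (u , edge-sym e , nu) }
    ... | no none      | yes (_ , nv) = λ { refl → listed u (dec-true (W? u) (Xu , λ i nx → none (i , nx))) (v , e , nv) }
    ... | no none      | no none′     = proper u v (dec-true (W? u) (Xu , λ i nx → none (i , nx))) (dec-true (W? v) (Xv , λ i nx → none′ (i , nx))) e

    does-≟ : ∀ {i j : Fin 3} → does (i Fin.≟ j) ≡ true → i ≡ j
    does-≟ {i} {j} eq with i Fin.≟ j
    ... | yes p = p

    -- All neighbours of `u` are precoloured with its part, the one colour that `u` does not carry.
    X-avoids : ∀ {u v j} → X u ≡ true → not (does (part u Fin.≟ j)) ≡ true → does (colour-of v Fin.≟ j) ≡ true → ¬ Edge G u v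
    X-avoids {u} {v} Xu neq eq e with trans (sym (colour-of-NX (u , Xu , refl , e))) (does-≟ eq)
    ... | refl rewrite dec-true (part u Fin.≟ part u) refl with () ← neq

    carries-independent : ∀ j → Independent (carries j)
    carries-independent j u v cu cv e with X u in Xu | X v in Xv
    ... | true  | true  = X-independent Xu Xv e
    ... | true  | false = X-avoids Xu cu cv e
    ... | false | true  = X-avoids Xv cv cu (edge-sym e)
    ... | false | false = colour-of-proper u v Xu Xv e (trans (does-≟ cu) (sym (does-≟ cv)))

    class-independent : ∀ j → Independent (class j)
    class-independent j u v cu cv e rewrite dec-false (isolated? u) (λ iso → iso v e) | dec-false (isolated? v) (λ iso → iso u (edge-sym e)) =
      carries-independent j u v cu cv e

    classes : List VSet
    classes = class 0F ∷ class 1F ∷ class 2F ∷ []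

    once : ∀ v → 1 ≤ multiplicity v classes
    once v = tally-once (does (isolated? v)) (X v) (part v) (colour-of v)

    twice-X : ∀ v → X v ≡ true → 2 ≤ multiplicity v classes
    twice-X v Xv = subst (λ x → 2 ≤ tally (does (isolated? v)) x (part v) (colour-of v)) (sym Xv)
      (tally-twice (does (isolated? v)) (part v) (colour-of v))

    twice-isolated : ∀ v → (∀ w → ¬ Edge G v w) → 2 ≤ multiplicity v classes
    twice-isolated v iso = subst (λ b → 2 ≤ tally b (X v) (part v) (colour-of v)) (sym (dec-true (isolated? v) iso)) (s≤s (s≤s z≤n))

  three-classes : ¬ ¬ Σ (List VSet) λ xs → length xs ≡ 3 × All Independent xs × (∀ v → 1 ≤ multiplicity v xs)
    × (∀ v → X v ≡ true → 2 ≤ multiplicity v xs) × (∀ v → (∀ w → ¬ Edge G v w) → 2 ≤ multiplicity v xs)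
  three-classes k = all-colourable (suc (size (λ v → does (W? v)))) (λ v → does (W? v)) ℕₚ.≤-refl from-does λ (c , g) →
    k (classes g , refl , (class-independent g _ ∷ class-independent g _ ∷ class-independent g _ ∷ []) , once g , twice-X g , twice-isolated g)
    where
    from-does : ∀ v → does (W? v) ≡ true → W v
    from-does v eq = invert (subst (Reflects (W v)) eq (proof (W? v)))

-- Combining the colourings of all classes

module Assembly {G : Graph} (C : Critical G) {k : ℕ} (σ : Fin (n G) → Fin k) (admissible : ∀ i → Admissible G (λ v → σ v ≡ i)) where
  open Critical C
  open Subgraphs C
  open Fractional G using (VSet; Independent; multiplicity)
  open Nat using (_+_; _*_; _≤_; z≤n; s≤s)

  edge? : ∀ u v → Dec (Edge G u v)
  edge? u v = adj G u v Boolₚ.≟ true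

  does-≟ : ∀ {m} {i j : Fin m} → does (i Fin.≟ j) ≡ true → i ≡ j
  does-≟ {i = i} {j} eq with i Fin.≟ j
  ... | yes p = p

  -- Without edges one class would contain all vertices, and the ratio would be at most 1.
  edge-exists : ∃ λ u → ∃ λ v → Edge G u v
  edge-exists = decidable-stable (Finₚ.any? λ u → Finₚ.any? λ v → edge? u v) λ none →
    ℕₚ.<⇒≱ big (ℕₚ.≤-trans
      (ℕₚ.*-monoˡ-≤ 4 (subst₂ _≤_ (ℕₚ.*-identityʳ p) (ℕₚ.*-identityˡ (suc d))
        (minimal-sets ((λ _ → true) ∷ []) 1 (s≤s z≤n) ((λ u v _ _ e → none (u , v , e)) ∷ []) (λ _ → s≤s z≤n))))
      (subst (_≤ 11 * suc d) (ℕₚ.*-comm 4 (suc d)) (ℕₚ.*-monoˡ-≤ (suc d) {4} {11} (s≤s (s≤s (s≤s (s≤s z≤n)))))))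

  meeting-class : ∀ i {u v} → σ u ≡ i → Edge G u v → AdmissibleClass G
  meeting-class i {u} {v} σu e = record
    { X = λ w → does (σ w Fin.≟ i) ; part = admissible i .proj₁
    ; admissible = λ u v Xu Xv → admissible i .proj₂ u v (does-≟ Xu) (does-≟ Xv)
    ; u₀ = u ; x₀ = v ; Xu₀ = dec-true (σ u Fin.≟ i) σu ; u₀x₀ = e }

  singleton-class : ∀ {u v} → Edge G u v → AdmissibleClass G
  singleton-class {u} {v} e = record
    { X = λ w → does (w Fin.≟ u) ; part = λ _ → Fin.zero
    ; admissible = λ a b Xa Xb → (λ _ → same a b Xa Xb , same a b Xa Xb , same a b Xa Xb) , λ neq → ⊥-elim (neq refl)
    ; u₀ = u ; x₀ = v ; Xu₀ = dec-true (u Fin.≟ u) refl ; u₀x₀ = e }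
    where
    same : ∀ a b {j} → does (a Fin.≟ u) ≡ true → does (b Fin.≟ u) ≡ true → ¬ InN G j a b
    same a b Xa Xb (b≢a , _) = b≢a (trans (does-≟ Xb) (sym (does-≟ Xa)))

  -- If all vertices of the class are isolated, the admissible set consisting of a single non-isolated vertex is used instead.
  class-sets : ∀ i → ¬ ¬ Σ (List VSet) λ xs → length xs ≡ 3 × All Independent xs × (∀ v → bit (does (σ v Fin.≟ i)) + 1 ≤ multiplicity v xs)
  class-sets i k with Finₚ.any? (λ u → Finₚ.any? λ v → (σ u Fin.≟ i) ×-dec edge? u v)
  ... | yes (u , v , σu , e) = ClassColouring.three-classes C (meeting-class i σu e) λ (xs , len , ind , once , twice , _) →
    k (xs , len , ind , λ v → bound v xs (once v) (twice v))
    where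
    bound : ∀ v xs → 1 ≤ multiplicity v xs → (does (σ v Fin.≟ i) ≡ true → 2 ≤ multiplicity v xs) → bit (does (σ v Fin.≟ i)) + 1 ≤ multiplicity v xs
    bound v xs once twice with does (σ v Fin.≟ i)
    ... | true  = twice refl
    ... | false = once
  ... | no none with edge-exists
  ...   | u , v , e = ClassColouring.three-classes C (singleton-class e) λ (xs , len , ind , once , _ , twice) →
    k (xs , len , ind , λ w → bound w xs (once w) (twice w))
    where
    bound : ∀ v xs → 1 ≤ multiplicity v xs → ((∀ w → ¬ Edge G v w) → 2 ≤ multiplicity v xs) → bit (does (σ v Fin.≟ i)) + 1 ≤ multiplicity v xs
    bound v xs once twice with σ v Fin.≟ i
    ... | yes eq = twice λ w e → none (v , w , eq , e)
    ... | no _   = once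

  all-sets : ∀ is → ¬ ¬ Σ (List VSet) λ xs → length xs ≡ length is * 3 × All Independent xs
    × (∀ v → cnt (λ i → does (σ v Fin.≟ i)) is + length is ≤ multiplicity v xs)
  all-sets []       k = k ([] , refl , [] , λ v → z≤n)
  all-sets (i ∷ is) k = class-sets i λ (xs , len , ind , cov) → all-sets is λ (ys , len′ , ind′ , cov′) →
    k (xs ++ ys , trans (Listₚ.length-++ xs) (cong₂ _+_ len len′) , Allₚ.++⁺ ind ind′ ,
      λ v → subst₂ _≤_ (rearrange (bit (does (σ v Fin.≟ i))) _ (length is)) (sym (cnt-++ _ xs ys)) (ℕₚ.+-mono-≤ (cov v) (cov′ v)))
    where
    open +-*-Solver using (solve; _:=_; _:+_; con)
    rearrange : ∀ a b c → a + 1 + (b + c) ≡ a + b + suc c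
    rearrange = solve 3 (λ a b c → a :+ con 1 :+ (b :+ c) := a :+ b :+ (con 1 :+ c)) refl

  bound : p * suc k ≤ k * 3 * suc d
  -- The inequality of naturals is decidable, so the accumulated double negations disappear here.
  bound = decidable-stable (p * suc k Nat.≤? k * 3 * suc d) λ nle → all-sets (List.allFin k) λ (xs , len , ind , cov) →
    nle (subst (λ z → p * suc k ≤ z * suc d) (trans len (cong (_* 3) (Listₚ.length-tabulate {n = k} id)))
      (minimal-sets xs (suc k) (s≤s z≤n) ind λ v → ℕₚ.≤-trans (ℕₚ.+-mono-≤ (own v) (ℕₚ.≤-reflexive (sym (Listₚ.length-tabulate {n = k} id)))) (cov v)))
    where
    own : ∀ v → 1 ≤ cnt (λ i → does (σ v Fin.≟ i)) (List.allFin k)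
    -- The class of `v` itself contributes the additional colour that turns k into k + 1.
    own v = ℕₚ.≤-trans (s≤s z≤n) (cnt-strict {p = λ _ → false} (λ _ ()) (∈ₚ.∈-allFin (σ v)) refl (dec-true (σ v Fin.≟ σ v) refl))

-- Translation between rationals and naturals

module Conversion where
  open Ratios
  open ℤ using (+_)

  three-minus : ∀ k → (+ 3) ℚ./ 1 ℚ.- (+ 3) ℚ./ suc k ≡ (+ (k Nat.* 3)) ℚ./ suc k
  three-minus k = ℚₚ.toℚᵘ-injective (begin
    ℚ.toℚᵘ ((+ 3) ℚ./ 1 ℚ.- (+ 3) ℚ./ suc k)
      ≈⟨ ℚₚ.toℚᵘ-homo-+ ((+ 3) ℚ./ 1) (ℚ.- ((+ 3) ℚ./ suc k)) ⟩
    ℚ.toℚᵘ ((+ 3) ℚ./ 1) ℚᵘ.+ ℚ.toℚᵘ (ℚ.- ((+ 3) ℚ./ suc k))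
      ≈⟨ ℚᵘₚ.+-cong (toℚᵘ-/ 3 0) (ℚᵘₚ.≃-trans (ℚₚ.toℚᵘ-homo‿- ((+ 3) ℚ./ suc k)) (ℚᵘₚ.-‿cong (toℚᵘ-/ 3 k))) ⟩
    ℚᵘ.mkℚᵘ (+ 3) 0 ℚᵘ.+ ℚᵘ.- ℚᵘ.mkℚᵘ (+ 3) k
      ≈⟨ ℚᵘ.*≡* (arithmetic k) ⟩
    ℚᵘ.mkℚᵘ (+ (k Nat.* 3)) k
      ≈⟨ toℚᵘ-/ (k Nat.* 3) k ⟨
    ℚ.toℚᵘ ((+ (k Nat.* 3)) ℚ./ suc k) ∎)
    where
    open ℚᵘₚ.≃-Reasoning using (begin_; _∎; step-≈-⟩; step-≈-⟨)
    arithmetic : ∀ k → ((+ 3) ℤ.* (+ suc k) ℤ.+ ℤ.- (+ 3) ℤ.* (+ 1)) ℤ.* (+ suc k) ≡ (+ (k Nat.* 3)) ℤ.* ((+ 1) ℤ.* (+ suc k))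
    arithmetic k = trans (solve 1 (λ x → (con (+ 3) :* (con (+ 1) :+ x) :+ con (ℤ.- (+ 3)) :* con (+ 1)) :* (con (+ 1) :+ x) :=
        (x :* con (+ 3)) :* (con (+ 1) :* (con (+ 1) :+ x))) refl (+ k))
      (cong (ℤ._* ((+ 1) ℤ.* (+ suc k))) (sym (ℤₚ.pos-* k 3)))
      where
      open import Data.Integer.Solver using () renaming (module +-*-Solver to ℤ-Solver)
      open ℤ-Solver using (solve; _:=_; _:+_; _:*_; con)

  toCritical : ∀ {G p d} → Coloring G p (suc d) → (∀ a b → Coloring G a (suc b) → (+ p) ℚ./ suc d ℚ.≤ (+ a) ℚ./ suc b) →
    FractionallyCritical G → TriangleFree G → MaxDegreeAtMost 3 G → (+ 11) ℚ./ 4 ℚ.< (+ p) ℚ./ suc d → Critical G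
  toCritical {G} {p} {d} opt@(c , card , disj) lower crit tf deg big = record
    { p = p ; d = d
    ; minimal = λ a b col → /≤/⇒≤ p d a b (lower a b col)
    -- If all colourings of `H` had ratio at least that of `G`, the optimal colouring of `G` pulled
    -- back along `f` would attain this bound. So `H` would have the same fractional chromatic
    -- number, against `crit`; its existence need not be known beforehand.
    ; critical = λ H f sub lowerH → ℚₚ.<-irrefl refl (crit H f sub ((+ p) ℚ./ suc d) ((+ p) ℚ./ suc d)
        ((p , d , (c ∘ f , card ∘ f , λ x y e → disj (f x) (f y) (sub .proj₂ .proj₁ x y e)) , refl) , λ a b col → ≤⇒/≤/ p d a b (lowerH a b col))
        ((p , d , opt , refl) , lower))
    ; big = /</⇒< 11 3 p d big ; triangle-free = tf ; subcubic = deg }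

open import Data.Integer using (+_)
open import Data.Rational using (ℚ; _/_; _<_; _≤_; _-_)

theorem4 : (G : Graph) (q : ℚ) → IsFracChrom G q →
    FractionallyCritical G → TriangleFree G → MaxDegreeAtMost 3 G →
    (+ 11) / 4 < q → q < (+ 3) / 1 →
    (k : ℕ) (σ : Fin (n G) → Fin k) → (∀ i → Admissible G (λ v → σ v ≡ i)) →
    q ≤ (+ 3) / 1 - (+ 3) / suc k
theorem4 G _ ((p , d , opt , refl) , lower) crit tf deg big _ k σ adm =
  subst ((+ p) / suc d ≤_) (sym (Conversion.three-minus k))
    (Ratios.≤⇒/≤/ p d (k Nat.* 3) k (Assembly.bound {G} (Conversion.toCritical {G} opt lower crit tf deg big) σ adm))
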